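{- There is an algorithm that, given a graph $G$ on $n$ vertices, a chordal deletion set $S\subseteq V(G)$ of $G$ and a positive integer $\ell$, determines whether $G$ has a connected vertex cover of size at most $\ell$ in $\mathcal{O}^*(2^{\mathcal{O}(|S| \log |S|)})$ time.
   Context: All graphs are finite, simple and undirected. A connected vertex cover of $G$ is a set $T\subseteq V(G)$ containing an endpoint of every edge of $G$ such that $G[T]$ is connected. A chordal graph is a graph in which every cycle of length at least $4$ has a chord, i.e. an edge joining two vertices that are non-adjacent on the cycle. A chordal deletion set of $G$ is a set $S\subseteq V(G)$ such that $G-S$ is chordal. $\mathcal{O}^*(f(k))$ denotes running time $f(k)\,n^{\mathcal{O}(1)}$; $|S|\log|S|$ is read as $0$ when $S=\emptyset$. -}

module Defs where

open import Data.Bool using (Bool; if_then_else_)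
open import Data.Fin using (Fin; zero; suc; toℕ)
open import Data.Fin.Subset using (Subset; _∈_; ∁; ∣_∣)
open import Data.List using (List; foldr; tabulate)
open import Data.Nat using (ℕ; zero; suc; _+_; _∸_; _≤_)
open import Data.Product using (Σ; ∃-syntax; _×_; _,_; proj₁)
open import Data.Sum using (_⊎_)
open import Data.Vec as Vec using (Vec; []; _∷_)
open import Function.Definitions using (Injective)
open import Level using (0ℓ)
open import Relation.Binary.Construct.Closure.ReflexiveTransitive using (Star)
open import Relation.Binary.Core using (Rel)
open import Relation.Binary.Definitions using (Symmetric; Irreflexive; Decidable)
open import Relation.Binary.PropositionalEquality using (_≡_; refl; cong)
open import Relation.Nullary using (¬_)
open import Relation.Nullary.Decidable using (does)

------------------------------------------------------------------------
-- Graphs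

-- Finite graphs are those with vertex type Fin n, and their induced subgraphs.

record Graph (V : Set) : Set₁ where
  infix 4 _~_ _~?_
  field
    _~_      : Rel V 0ℓ
    _~?_     : Decidable _~_
    ~-sym    : Symmetric _~_
    ~-irrefl : Irreflexive _≡_ _~_

-- For a Subset T the proofs of v ∈ T are unique, so Σ V (_∈ T) really has
-- one element per member of T. (This would not be provable for _∉ T, which
-- is why vertex deletion below goes through the complement.)

_[_] : ∀ {V} → Graph V → (P : V → Set) → Graph (Σ V P)
G [ P ] = record
  { _~_      = λ u v → proj₁ u ~ proj₁ v
  ; _~?_     = λ u v → proj₁ u ~? proj₁ v
  ; ~-sym    = ~-sym
  ; ~-irrefl = λ u≡v → ~-irrefl (cong proj₁ u≡v)
  }
  where open Graph G

_─_ : ∀ {n} (G : Graph (Fin n)) (S : Subset n) → Graph (Σ (Fin n) (_∈ ∁ S))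
G ─ S = G [ _∈ ∁ S ]

-- The graph without vertices counts as connected.

Connected : ∀ {V} → Graph V → Set
Connected G = ∀ u v → Star _~_ u v
  where open Graph G

-- j follows i in the cyclic order 0, 1, …, k-1, 0.

Next : ∀ {k} → Fin k → Fin k → Set
Next {k} i j = suc (toℕ i) ≡ toℕ j ⊎ (suc (toℕ i) ≡ k × toℕ j ≡ 0)

module _ {V : Set} (G : Graph V) where
  open Graph G

  -- Meant for k ≥ 3.
  record Cycle (k : ℕ) : Set where
    field
      vertex    : Fin k → V
      injective : Injective _≡_ _≡_ vertex
      edge      : ∀ {i j} → Next i j → vertex i ~ vertex j

  HasChord : ∀ {k} → Cycle k → Set
  HasChord C = ∃[ i ] ∃[ j ] ¬ Next i j × ¬ Next j i × vertex i ~ vertex j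
    where open Cycle C

  Chordal : Set
  Chordal = ∀ {k} → 4 ≤ k → (C : Cycle k) → HasChord C

module _ {n : ℕ} (G : Graph (Fin n)) where
  open Graph G

  ChordalDeletionSet : Subset n → Set
  ChordalDeletionSet S = Chordal (G ─ S)

  VertexCover : Subset n → Set
  VertexCover T = ∀ {u v} → u ~ v → u ∈ T ⊎ v ∈ T

  ConnectedVertexCover : Subset n → Set
  ConnectedVertexCover T = VertexCover T × Connected (G [ _∈ T ])

  HasConnectedVertexCover≤ : ℕ → Set
  HasConnectedVertexCover≤ l = ∃[ T ] ConnectedVertexCover T × ∣ T ∣ ≤ l

------------------------------------------------------------------------
-- Model of computation

-- Algorithms are programs of a first-order, call-by-value functional
-- language (pure Lisp with integers): finitely many mutually recursive
-- unary functions on binary trees with numbers at the leaves.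

data Val : Set where
  nat  : ℕ → Val
  pair : Val → Val → Val

-- Exp f m: expressions with m variables (de Bruijn indices, the most
-- recently bound one being zero) that may call f functions.

data Exp (f m : ℕ) : Set where
  var  : Fin m → Exp f m
  lit  : ℕ → Exp f m
  add  : Exp f m → Exp f m → Exp f m
  sub  : Exp f m → Exp f m → Exp f m
  cons : Exp f m → Exp f m → Exp f m
  -- The branches are for 0; for suc k, binding k; and for pair v w, binding
  -- v (index 0) and w (index 1).
  case : Exp f m → Exp f m → Exp f (suc m) → Exp f (suc (suc m)) → Exp f m
  bind : Exp f m → Exp f (suc m) → Exp f m
  call : Fin f → Exp f m → Exp f m

-- Execution starts with function zero.

record Program : Set where
  field
    {others} : ℕ
    body     : Fin (suc others) → Exp (suc others) 1

-- ρ ⊢ e ⇓ v / t: in environment ρ, e evaluates to v in time t, which is the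
-- number of rule applications. There is no rule for add or sub on pairs; such
-- expressions are stuck, and diverging ones have no derivation either.
--
-- This is a reasonable time measure, i.e. polynomially related to that of
-- Turing machines: trees are passed by reference, so each step takes a bounded
-- number of pointer operations and at most one addition or subtraction, and
-- numbers grow by at most one bit per step beyond the longest number in the
-- input or the program. Multiplication is left out for that reason.
-- A bound of the form 2^O(k log k) · n^O(1) does not depend on the choice among
-- polynomially related measures.

module Semantics {f : ℕ} (body : Fin f → Exp f 1) where

  infix 4 _⊢_⇓_/_

  data _⊢_⇓_/_ {m : ℕ} (ρ : Vec Val m) : Exp f m → Val → ℕ → Set where

    ⇓var  : ∀ i → ρ ⊢ var i ⇓ Vec.lookup ρ i / 1

    ⇓lit  : ∀ k → ρ ⊢ lit k ⇓ nat k / 1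

    ⇓add  : ∀ {d e j k s t} →
            ρ ⊢ d ⇓ nat j / s → ρ ⊢ e ⇓ nat k / t →
            ρ ⊢ add d e ⇓ nat (j + k) / suc (s + t)

    ⇓sub  : ∀ {d e j k s t} →
            ρ ⊢ d ⇓ nat j / s → ρ ⊢ e ⇓ nat k / t →
            ρ ⊢ sub d e ⇓ nat (j ∸ k) / suc (s + t)

    ⇓cons : ∀ {d e v w s t} →
            ρ ⊢ d ⇓ v / s → ρ ⊢ e ⇓ w / t →
            ρ ⊢ cons d e ⇓ pair v w / suc (s + t)

    ⇓case-zero : ∀ {e e₀ e₁ e₂ v s t} →
            ρ ⊢ e ⇓ nat zero / s → ρ ⊢ e₀ ⇓ v / t →
            ρ ⊢ case e e₀ e₁ e₂ ⇓ v / suc (s + t)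

    ⇓case-suc : ∀ {e e₀ e₁ e₂ k v s t} →
            ρ ⊢ e ⇓ nat (suc k) / s → (nat k ∷ ρ) ⊢ e₁ ⇓ v / t →
            ρ ⊢ case e e₀ e₁ e₂ ⇓ v / suc (s + t)

    ⇓case-pair : ∀ {e e₀ e₁ e₂ x y v s t} →
            ρ ⊢ e ⇓ pair x y / s → (x ∷ y ∷ ρ) ⊢ e₂ ⇓ v / t →
            ρ ⊢ case e e₀ e₁ e₂ ⇓ v / suc (s + t)

    ⇓bind : ∀ {d e v w s t} →
            ρ ⊢ d ⇓ v / s → (v ∷ ρ) ⊢ e ⇓ w / t →
            ρ ⊢ bind d e ⇓ w / suc (s + t)

    ⇓call : ∀ {g e v w s t} →
            ρ ⊢ e ⇓ v / s → (v ∷ []) ⊢ body g ⇓ w / t →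
            ρ ⊢ call g e ⇓ w / suc (s + t)

  -- Evaluation is deterministic in both result and time, so the existence of
  -- a run with some property is a statement about the run.

  deterministic : ∀ {m} {ρ : Vec Val m} {e v w s t} →
                  ρ ⊢ e ⇓ v / s → ρ ⊢ e ⇓ w / t → v ≡ w × s ≡ t
  deterministic (⇓var i) (⇓var .i) = refl , refl
  deterministic (⇓lit k) (⇓lit .k) = refl , refl
  deterministic (⇓add a b) (⇓add a′ b′)
    with refl , refl ← deterministic a a′
       | refl , refl ← deterministic b b′ = refl , refl
  deterministic (⇓sub a b) (⇓sub a′ b′)
    with refl , refl ← deterministic a a′
       | refl , refl ← deterministic b b′ = refl , refl
  deterministic (⇓cons a b) (⇓cons a′ b′)
    with refl , refl ← deterministic a a′
       | refl , refl ← deterministic b b′ = refl , refl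
  deterministic (⇓case-zero a b) (⇓case-zero a′ b′)
    with refl , refl ← deterministic a a′
    with refl , refl ← deterministic b b′ = refl , refl
  deterministic (⇓case-zero a b) (⇓case-suc a′ b′) with () ← deterministic a a′
  deterministic (⇓case-zero a b) (⇓case-pair a′ b′) with () ← deterministic a a′
  deterministic (⇓case-suc a b) (⇓case-zero a′ b′) with () ← deterministic a a′
  deterministic (⇓case-suc a b) (⇓case-suc a′ b′)
    with refl , refl ← deterministic a a′
    with refl , refl ← deterministic b b′ = refl , refl
  deterministic (⇓case-suc a b) (⇓case-pair a′ b′) with () ← deterministic a a′
  deterministic (⇓case-pair a b) (⇓case-zero a′ b′) with () ← deterministic a a′
  deterministic (⇓case-pair a b) (⇓case-suc a′ b′) with () ← deterministic a a′
  deterministic (⇓case-pair a b) (⇓case-pair a′ b′)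
    with refl , refl ← deterministic a a′
    with refl , refl ← deterministic b b′ = refl , refl
  deterministic (⇓bind a b) (⇓bind a′ b′)
    with refl , refl ← deterministic a a′
    with refl , refl ← deterministic b b′ = refl , refl
  deterministic (⇓call a b) (⇓call a′ b′)
    with refl , refl ← deterministic a a′
    with refl , refl ← deterministic b b′ = refl , refl

_on_returns_inTime_ : Program → Val → Val → ℕ → Set
P on x returns y inTime t = (x ∷ []) ⊢ body zero ⇓ y / t
  where
  open Program P
  open Semantics body

------------------------------------------------------------------------
-- Encoding of inputs and outputs

encodeBool : Bool → Val
encodeBool b = if b then nat 1 else nat 0

encodeList : List Val → Val
encodeList = foldr pair (nat 0)

encodeSubset : ∀ {n} → Subset n → Val
encodeSubset S = encodeList (tabulate λ v → encodeBool (Vec.lookup S v))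

-- The number of vertices with the rows of the adjacency matrix.

encodeGraph : ∀ {n} → Graph (Fin n) → Val
encodeGraph {n} G =
  pair (nat n)
       (encodeList (tabulate λ u → encodeList (tabulate λ v → encodeBool (does (u ~? v)))))
  where open Graph G

encodeInstance : ∀ {n} → Graph (Fin n) → Subset n → ℕ → Val
encodeInstance G S l = pair (encodeGraph G) (pair (encodeSubset S) (nat l))

{-# OPTIONS --safe #-}

-- Let H = G − S. Put a vertex r of the cover T into S, so that S₁ = T ∩ S is not
-- empty, and guess S₁ and a ranking of its vertices. Then T is connected (for a
-- suitable ranking) iff every component of H[T] has a neighbour in S₁ and every
-- s ∈ S₁ except r is linked, by an edge or through a component of H[T], to some
-- vertex of S₁ of smaller rank. By Dirac's theorem H has a perfect elimination
-- order. A vertex cover omits at most one vertex o of a clique K, so the rest of K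
-- lies in one component of H[T]. Hence dynamic programming along the elimination
-- order has to remember, for the clique K of later neighbours of an eliminated
-- vertex, only o, a set A ⊆ S₁ of neighbours of the component of K, the set C ⊆ S₁
-- of vertices already linked to smaller rank, and the number of vertices used.
-- These are 2 ^ O(k) n ^ O(1) states for each of the k ^ O(k) guesses.
--
-- The time bound is obtained once and for all for a typed language without general
-- recursion: a term of it runs in time at most X ^ d, where d depends only on the
-- term and X = 32 (n + 1) (k + 2) ^ (k + 2).

module Submission where

open import Defs
open import Data.Bool using (Bool; true; false; if_then_else_)
open import Data.Bool.Properties using () renaming (_≟_ to _≟ᵇ_)
open import Data.Empty using (⊥; ⊥-elim)
open import Data.Fin using (Fin; zero; suc; toℕ; fromℕ; fromℕ<; splitAt; _↑ˡ_; _↑ʳ_; _≟_)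
open import Data.Fin.Patterns using (0F; 1F; 2F; 3F; 4F; 5F; 8F)
open import Data.Fin.Properties using (any?; toℕ-injective; toℕ-fromℕ; toℕ-fromℕ<; toℕ<n; splitAt-↑ˡ; splitAt-↑ʳ)
open import Data.Fin.Subset using (Subset; ∁; ∣_∣; inside; outside) renaming (_∈_ to _∈ˢ_)
open import Data.Fin.Subset.Properties using (nonempty?; x∉p⇒x∈∁p)
open import Data.List as List using (List; []; _∷_; _++_; length; foldr; concatMap)
open import Data.List.Membership.Propositional using (_∈_; lose)
open import Data.List.Membership.Propositional.Properties using (∈-concatMap⁺; ∈-tabulate⁺; ∈-map⁺; ∈-lookup)
open import Data.List.Properties using (length-++; length-map; length-tabulate; map-tabulate)
open import Data.List.Relation.Unary.All as All using (All; []; _∷_)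
import Data.List.Relation.Unary.All.Properties as All
open import Data.List.Relation.Unary.AllPairs using ([]; _∷_)
open import Data.List.Relation.Unary.Any as Any using (Any; here; there)
open import Data.List.Relation.Unary.Unique.Propositional using (Unique)
open import Data.List.Relation.Unary.Unique.Propositional.Properties using (tabulate⁺)
open import Data.Nat using (ℕ; zero; suc; _+_; _*_; _∸_; _^_; _≤_; _<_; z≤n; s≤s; _<?_; ⌈_/2⌉; ⌊_/2⌋; NonZero; >-nonZero; >-nonZero⁻¹)
open import Data.Nat.Induction using (<-wellFounded)
open import Data.Nat.Logarithm using (⌈log₂_⌉; ⌈log₂⌉-mono-≤; ⌈log₂⌈n/2⌉⌉≡⌈log₂n⌉∸1)
open import Data.Nat.Properties hiding (_≟_; _<?_)
open import Data.Nat.Tactic.RingSolver using (solve-∀)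
open import Data.Product using (∃-syntax; _×_; _,_; proj₁; proj₂)
open import Data.Sum as Sum using (_⊎_; inj₁; inj₂; [_,_]′; swap)
open import Data.Unit using (⊤; tt)
open import Data.Vec as Vec using (Vec; []; _∷_)
open import Data.Vec.Properties using (lookup∘tabulate; lookup⇒[]=; []=⇒lookup)
open import Data.Vec.Properties.WithK using ([]=-irrelevant)
open import Function using (_∘_; id)
open import Function.Bundles using (_⇔_; mk⇔)
open import Induction.WellFounded using (Acc; acc)
open import Relation.Binary.Construct.Closure.ReflexiveTransitive as Star using (Star; ε; _◅_; _◅◅_)
open import Relation.Binary.Definitions using (tri<; tri≈; tri>)
open import Relation.Binary.PropositionalEquality hiding ([_])
open import Relation.Nullary using (¬_; Dec; yes; no; does; contradiction)
open import Relation.Nullary.Decidable using (_×-dec_; _⊎-dec_; ¬?; dec-true; dec-false; decidable-stable; ¬¬-excluded-middle)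
open import Relation.Unary using (Decidable)

-- Connectivity is global: a partial solution would have to remember how it partitions `S₁`. The
-- ranking breaks it into one obligation for each vertex of `S₁` but the root, met by a single edge
-- or inside a single component of H[T], so that a set of vertices already done replaces the
-- partition; decreasing ranks exclude circular justifications. Having `r` in `S` pays twice more:
-- `r` lies in no clique, so the index `o = r` means that nothing is omitted, and as the result of a
-- vertex search `r` signals failure.
--
-- The algorithm exists twice, as a Boolean function, about which the graph theory is proved, and as
-- a term, which is compiled and timed. Both are written in the same shape and agree by `refl`.
--
-- Reachability is never decided. Dirac's theorem and the completeness proof assume it decidable
-- under a double negation, which can be removed because each final conclusion is a Boolean test.
--
-- The `k + 2` leaves room for the two truth values when `S` is empty; otherwise it bounds the
-- `k + 1` vertices of `S` with the root and the `k + 1` possible ranks.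

-- A typed language with bounded iteration

-- The type list s A consists of lists whose length is bounded in terms of the
-- instance: by k for tight, by k + 2 for loose and by X ^ d for pow d, where X
-- exceeds n and (k + 2) ^ (k + 2). An arr has one entry per vertex.

data Size : Set where
  tight loose : Size
  pow         : ℕ → Size

infixr 5 _⊗_

data Ty : Set where
  bool nat idx dim : Ty
  _⊗_  : Ty → Ty → Ty
  arr  : Ty → Ty
  list : Size → Ty → Ty

Ctx : Set
Ctx = List Ty

infix 4 _∋_

data _∋_ : Ctx → Ty → Set where
  here  : ∀ {Γ A} → A ∷ Γ ∋ A
  there : ∀ {Γ A B} → Γ ∋ A → B ∷ Γ ∋ A

data Op₀ : Ty → Set where
  trueᵒ falseᵒ : Op₀ bool
  zeroᵒ oneᵒ   : Op₀ nat
  nilᵒ        : ∀ {s A} → Op₀ (list s A)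
  boolsᵒ      : Op₀ (list loose bool)

data Op₁ : Ty → Ty → Set where
  fstᵒ    : ∀ {A B} → Op₁ (A ⊗ B) A
  sndᵒ    : ∀ {A B} → Op₁ (A ⊗ B) B
  toNatᵒ  : Op₁ idx nat
  sizeᵒ   : Op₁ dim nat
  toListᵒ : ∀ {A} → Op₁ (arr A) (list (pow 1) A)
  singleᵒ : ∀ {A} → Op₁ A (list (pow 0) A)

data Op₂ : Ty → Ty → Ty → Set where
  pairᵒ : ∀ {A B} → Op₂ A B (A ⊗ B)
  addᵒ  : Op₂ nat nat nat
  leqᵒ  : Op₂ nat nat bool
  eqiᵒ  : Op₂ idx idx bool
  consᵒ : ∀ {A} → Op₂ A (list tight A) (list loose A)

-- Loops run only over lists and arrays already computed, so every term terminates. The lengths of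
-- nested `forl` loops multiply and their exponents add. Exponential size comes from `grow` alone:
-- at most `k + 2` choices for each of at most `k + 2` keys. Its body also sees the list of choices,
-- because the compiled loops keep that list in their environment.
data Tm (Γ : Ctx) : Ty → Set where
  var  : ∀ {A} → Γ ∋ A → Tm Γ A
  op₀  : ∀ {A} → Op₀ A → Tm Γ A
  op₁  : ∀ {A B} → Op₁ A B → Tm Γ A → Tm Γ B
  op₂  : ∀ {A B C} → Op₂ A B C → Tm Γ A → Tm Γ B → Tm Γ C
  cond : ∀ {A} → Tm Γ bool → Tm Γ A → Tm Γ A → Tm Γ A
  lett : ∀ {A B} → Tm Γ A → Tm (A ∷ Γ) B → Tm Γ B
  fold : ∀ {p A B} → Tm Γ (list (pow p) A) → Tm Γ B → Tm (A ∷ B ∷ Γ) B → Tm Γ B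
  forl : ∀ {p q A B} → Tm Γ (list (pow p) A) → Tm (A ∷ Γ) (list (pow q) B) →
         Tm Γ (list (pow (p + q)) B)
  grow : ∀ {A B C} → Tm Γ (list loose A) → Tm Γ (list loose B) → Tm Γ C →
         Tm (B ∷ C ∷ A ∷ list loose B ∷ Γ) C → Tm Γ (list (pow 1) C)
  get  : ∀ {A} → Tm Γ (arr A) → Tm Γ idx → Tm Γ A
  mapi : ∀ {A B} → Tm Γ (arr A) → Tm (A ∷ idx ∷ Γ) B → Tm Γ (arr B)

⟦_⟧ : Ty → ℕ → Set
⟦ bool ⟧     n = Bool
⟦ nat ⟧      n = ℕ
⟦ idx ⟧      n = Fin n
⟦ dim ⟧      n = ⊤
⟦ A ⊗ B ⟧    n = ⟦ A ⟧ n × ⟦ B ⟧ n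
⟦ arr A ⟧    n = Fin n → ⟦ A ⟧ n
⟦ list s A ⟧ n = List (⟦ A ⟧ n)

Env : Ctx → ℕ → Set
Env []      n = ⊤
Env (A ∷ Γ) n = ⟦ A ⟧ n × Env Γ n

lookup : ∀ {Γ A n} → Γ ∋ A → Env Γ n → ⟦ A ⟧ n
lookup here      (v , γ) = v
lookup (there x) (v , γ) = lookup x γ

isZero : ℕ → Bool
isZero zero    = true
isZero (suc k) = false

sem₀ : ∀ {A n} → Op₀ A → ⟦ A ⟧ n
sem₀ trueᵒ  = true
sem₀ falseᵒ = false
sem₀ zeroᵒ  = 0
sem₀ oneᵒ   = 1
sem₀ nilᵒ   = []
sem₀ boolsᵒ = false ∷ true ∷ []

sem₁ : ∀ {A B n} → Op₁ A B → ⟦ A ⟧ n → ⟦ B ⟧ n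
sem₁ fstᵒ    (x , y) = x
sem₁ sndᵒ    (x , y) = y
sem₁ toNatᵒ  i       = toℕ i
sem₁ {n = n} sizeᵒ _ = n
sem₁ toListᵒ f       = List.tabulate f
sem₁ singleᵒ x       = x ∷ []

sem₂ : ∀ {A B C n} → Op₂ A B C → ⟦ A ⟧ n → ⟦ B ⟧ n → ⟦ C ⟧ n
sem₂ pairᵒ x y = x , y
sem₂ addᵒ  x y = x + y
sem₂ leqᵒ  x y = isZero (x ∸ y)
sem₂ eqiᵒ  i j = isZero ((toℕ i ∸ toℕ j) + (toℕ j ∸ toℕ i))
sem₂ consᵒ x y = x ∷ y

growStep : ∀ {A B C : Set} → (B → C → A → C) → List B → A → List C → List C
growStep f bs a = concatMap (λ c → List.map (λ b → f b c a) bs)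

growList : ∀ {A B C : Set} → (B → C → A → C) → List B → C → List A → List C
growList f bs c = foldr (growStep f bs) (c ∷ [])

sem : ∀ {Γ A n} → Tm Γ A → Env Γ n → ⟦ A ⟧ n
sem (var x)          γ = lookup x γ
sem (op₀ o)          γ = sem₀ o
sem (op₁ o a)        γ = sem₁ o (sem a γ)
sem (op₂ o a b)      γ = sem₂ o (sem a γ) (sem b γ)
sem (cond a b c)     γ = if sem a γ then sem b γ else sem c γ
sem (lett a b)       γ = sem b (sem a γ , γ)
sem (fold l z b)     γ = foldr (λ x acc → sem b (x , acc , γ)) (sem z γ) (sem l γ)
sem (forl l b)       γ = concatMap (λ x → sem b (x , γ)) (sem l γ)
sem (grow as bs c f) γ =
  growList (λ y z x → sem f (y , z , x , sem bs γ , γ)) (sem bs γ) (sem c γ) (sem as γ)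
sem (get a j)        γ = sem a γ (sem j γ)
sem (mapi a b)       γ = λ i → sem b (sem a γ i , i , γ)

enc : ∀ {n} A → ⟦ A ⟧ n → Val
enc     bool       b       = encodeBool b
enc     nat        k       = nat k
enc     idx        i       = nat (toℕ i)
enc {n} dim        _       = nat n
enc     (A ⊗ B)    (x , y) = pair (enc A x) (enc B y)
enc     (arr A)    f       = encodeList (List.tabulate (λ i → enc A (f i)))
enc     (list s A) xs      = encodeList (List.map (enc A) xs)

encEnv : ∀ {n} Γ → Env Γ n → Val
encEnv []      _       = nat 0
encEnv (A ∷ Γ) (v , γ) = pair (enc A v) (encEnv Γ γ)

-- Compilation

-- The number of functions in the code of a term.

arity : ∀ {Γ A} → Tm Γ A → ℕ
arity (var x)          = 0
arity (op₀ o)          = 0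
arity (op₁ o a)        = arity a
arity (op₂ o a b)      = arity a + arity b
arity (cond a b c)     = arity a + (arity b + arity c)
arity (lett a b)       = arity a + arity b
arity (fold l z b)     = 1 + (arity l + (arity z + arity b))
arity (forl l b)       = 2 + (arity l + arity b)
arity (grow as bs c f) = 4 + (arity as + (arity bs + (arity c + arity f)))
arity (get a j)        = 1 + (arity a + arity j)
arity (mapi a b)       = 1 + (arity a + arity b)

-- Environments are nested pairs. Every `case` needs all three branches; here and below, those that
-- the shape of the value makes unreachable are filled with `lit 0`.
compVar : ∀ {Γ A f m} → Γ ∋ A → Fin m → Exp f m
compVar here      i = case (var i) (lit 0) (lit 0) (var 0F)
compVar (there x) i = case (var i) (lit 0) (lit 0) (compVar x 1F)

code₀ : ∀ {A f m} → Op₀ A → Exp f m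
code₀ trueᵒ  = lit 1
code₀ falseᵒ = lit 0
code₀ zeroᵒ  = lit 0
code₀ oneᵒ   = lit 1
code₀ nilᵒ   = lit 0
code₀ boolsᵒ = cons (lit 0) (cons (lit 1) (lit 0))

code₁ : ∀ {A B f m} → Op₁ A B → Exp f (1 + m)
code₁ fstᵒ    = case (var 0F) (lit 0) (lit 0) (var 0F)
code₁ sndᵒ    = case (var 0F) (lit 0) (lit 0) (var 1F)
code₁ toNatᵒ  = var 0F
code₁ sizeᵒ   = var 0F
code₁ toListᵒ = var 0F
code₁ singleᵒ = cons (var 0F) (lit 0)

code₂ : ∀ {A B C f m} → Op₂ A B C → Exp f (2 + m)
code₂ pairᵒ = cons (var 1F) (var 0F)
code₂ addᵒ  = add (var 1F) (var 0F)
code₂ leqᵒ  = case (sub (var 1F) (var 0F)) (lit 1) (lit 0) (lit 0)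
code₂ eqiᵒ  = case (add (sub (var 1F) (var 0F)) (sub (var 0F) (var 1F))) (lit 1) (lit 0) (lit 0)
code₂ consᵒ = cons (var 1F) (var 0F)

-- The function g that, applied to a list and an environment, evaluates z in
-- (list, environment, …) if the list is empty and s in (result for the tail,
-- head, tail, list, environment, …) otherwise.

foldBody : ∀ {f} → Fin f → Exp f 3 → Exp f 6 → Exp f 1
foldBody g z s =
  case (var 0F) (lit 0) (lit 0)
    (case (var 0F) z (lit 0)
      (bind (call g (cons (var 1F) (var 3F))) s))

appendBody : ∀ {f} → Fin f → Exp f 1
appendBody g = foldBody g (var 1F) (cons (var 1F) (var 0F))

getBody : ∀ {f} → Fin f → Exp f 1
getBody g =
  case (var 0F) (lit 0) (lit 0)
    (case (var 0F) (lit 0) (lit 0)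
      (case (var 3F) (var 0F) (call g (cons (var 2F) (var 0F))) (lit 0)))

mapiBody : ∀ {f} → Fin f → (∀ {m} → Fin m → Exp f m) → Exp f 1
mapiBody g b =
  case (var 0F) (lit 0) (lit 0)
    (case (var 0F) (lit 0) (lit 0)
      (case (var 3F) (lit 0) (lit 0)
        (cons (bind (cons (var 2F) (cons (var 0F) (var 1F))) (b 0F))
              (call g (cons (var 3F) (cons (add (lit 1) (var 0F)) (var 1F)))))))

infixr 4 _⊕_

_⊕_ : ∀ {a b} {E : Set} → (Fin a → E) → (Fin b → E) → Fin (a + b) → E
_⊕_ {a} p q i = [ p , q ]′ (splitAt a i)

left : ∀ {a f} b → (Fin (a + b) → Fin f) → Fin a → Fin f
left b φ i = φ (i ↑ˡ b)

right : ∀ {b f} a → (Fin (a + b) → Fin f) → Fin b → Fin f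
right a φ i = φ (a ↑ʳ i)

tail : ∀ {a f} → (Fin (suc a) → Fin f) → Fin a → Fin f
tail φ i = φ (suc i)

-- The environment is the value of variable i; φ says where the functions are.

comp : ∀ {Γ A f m} (t : Tm Γ A) → (Fin (arity t) → Fin f) → Fin m → Exp f m
comp (var x)          φ i = compVar x i
comp (op₀ o)          φ i = code₀ o
comp (op₁ o a)        φ i = bind (comp a φ i) (code₁ o)
comp (op₂ o a b)      φ i =
  bind (comp a (left (arity b) φ) i)
    (bind (comp b (right (arity a) φ) (suc i)) (code₂ o))
comp (cond a b c)     φ i =
  case (comp a (left (arity b + arity c) φ) i)
    (comp c (right (arity b) (right (arity a) φ)) i)
    (comp b (left (arity c) (right (arity a) φ)) (suc i))
    (lit 0)
comp (lett a b)       φ i =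
  bind (cons (comp a (left (arity b) φ) i) (var i)) (comp b (right (arity a) φ) 0F)
comp (fold l z b)     φ i =
  call (φ 0F) (cons (comp l (left (arity z + arity b) (tail φ)) i) (var i))
comp (forl l b)       φ i =
  call (φ 0F) (cons (comp l (left (arity b) (tail (tail φ))) i) (var i))
comp (grow as bs c f) φ i =
  call (φ 0F)
    (cons (comp as (left (arity bs + (arity c + arity f)) φ′) i)
      (cons (comp bs (left (arity c + arity f) (right (arity as) φ′)) i) (var i)))
  where φ′ = tail (tail (tail (tail φ)))
comp (get a j)        φ i =
  call (φ 0F) (cons (comp a (left (arity j) (tail φ)) i) (comp j (right (arity a) (tail φ)) i))
comp (mapi a b)       φ i =
  call (φ 0F) (cons (comp a (left (arity b) (tail φ)) i) (cons (lit 0) (var i)))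

growZero : ∀ {f} → (∀ {m} → Fin m → Exp f m) → Exp f 3
growZero c = cons (case (var 1F) (lit 0) (lit 0) (c 1F)) (lit 0)

growOuter : ∀ {f} → Fin f → Exp f 6
growOuter g = call g (cons (var 0F) (cons (var 1F) (var 4F)))

-- The environment of this loop consists of the key, the list of choices and the environment of the
-- term. The list is unpacked to drive the inner loop, whose own environment is this one with the
-- element being extended in front.
growMiddle : ∀ {f} → Fin f → Fin f → Exp f 6
growMiddle g app =
  case (var 4F) (lit 0) (lit 0)
    (case (var 1F) (lit 0) (lit 0)
      (call app (cons (call g (cons (var 0F) (cons (var 5F) (var 8F)))) (var 4F))))

growInner : ∀ {f} → (∀ {m} → Fin m → Exp f m) → Exp f 6
growInner b = cons (bind (cons (var 1F) (var 4F)) (b 0F)) (var 0F)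

foldStep : ∀ {f} → (∀ {m} → Fin m → Exp f m) → Exp f 6
foldStep b = bind (cons (var 1F) (cons (var 0F) (var 4F))) (b 0F)

forlStep : ∀ {f} → Fin f → (∀ {m} → Fin m → Exp f m) → Exp f 6
forlStep app b = call app (cons (bind (cons (var 1F) (var 4F)) (b 0F)) (var 0F))

-- Every occurrence of a loop owns its functions: a term occupies a block of `arity t` function
-- indices, its own loops first and then the blocks of its subterms.
defs : ∀ {Γ A f} (t : Tm Γ A) → (Fin (arity t) → Fin f) → Fin (arity t) → Exp f 1
defs (op₁ o a)        φ   = defs a φ
defs (op₂ o a b)      φ   = defs a (left (arity b) φ) ⊕ defs b (right (arity a) φ)
defs (cond a b c)     φ   =
    defs a (left (arity b + arity c) φ)
  ⊕ defs b (left (arity c) (right (arity a) φ))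
  ⊕ defs c (right (arity b) (right (arity a) φ))
defs (lett a b)       φ   = defs a (left (arity b) φ) ⊕ defs b (right (arity a) φ)
defs (fold l z b)     φ 0F =
  foldBody (φ 0F) (comp z (left (arity b) (right (arity l) (tail φ))) 1F)
    (foldStep (comp b (right (arity z) (right (arity l) (tail φ)))))
defs (fold l z b)     φ (suc i) =
  (defs l (left (arity z + arity b) (tail φ))
  ⊕ defs z (left (arity b) (right (arity l) (tail φ)))
  ⊕ defs b (right (arity z) (right (arity l) (tail φ)))) i
defs (forl l b)       φ 0F =
  foldBody (φ 0F) (lit 0) (forlStep (φ 1F) (comp b (right (arity l) (tail (tail φ)))))
defs (forl l b)       φ 1F = appendBody (φ 1F)
defs (forl l b)       φ (suc (suc i)) =
  (defs l (left (arity b) (tail (tail φ))) ⊕ defs b (right (arity l) (tail (tail φ)))) i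
defs (grow as bs c f) φ 0F =
  foldBody (φ 0F)
    (growZero (comp c (left (arity f) (right (arity bs) (right (arity as)
      (tail (tail (tail (tail φ)))))))))
    (growOuter (φ 1F))
defs (grow as bs c f) φ 1F = foldBody (φ 1F) (lit 0) (growMiddle (φ 2F) (φ 3F))
defs (grow as bs c f) φ 2F =
  foldBody (φ 2F) (lit 0)
    (growInner (comp f (right (arity c) (right (arity bs) (right (arity as)
      (tail (tail (tail (tail φ)))))))))
defs (grow as bs c f) φ 3F = appendBody (φ 3F)
defs (grow as bs c f) φ (suc (suc (suc (suc i)))) =
  (defs as (left (arity bs + (arity c + arity f)) φ′)
  ⊕ defs bs (left (arity c + arity f) (right (arity as) φ′))
  ⊕ defs c (left (arity f) (right (arity bs) (right (arity as) φ′)))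
  ⊕ defs f (right (arity c) (right (arity bs) (right (arity as) φ′)))) i
  where φ′ = tail (tail (tail (tail φ)))
defs (get a j)        φ 0F = getBody (φ 0F)
defs (get a j)        φ (suc i) =
  (defs a (left (arity j) (tail φ)) ⊕ defs j (right (arity a) (tail φ))) i
defs (mapi a b)       φ 0F = mapiBody (φ 0F) (comp b (right (arity a) (tail φ)))
defs (mapi a b)       φ (suc i) =
  (defs a (left (arity b) (tail φ)) ⊕ defs b (right (arity a) (tail φ))) i

-- Powers of X as bounds on sizes and times

record Params : Set where
  field
    n k X : ℕ
    const≤ : 32 ≤ X
    n≤     : n ≤ X
    k≤     : (2 + k) ^ (2 + k) ≤ X

  bound : Size → ℕ
  bound tight   = k
  bound loose   = 2 + k
  bound (pow d) = X ^ d

  Fits : (A : Ty) → ⟦ A ⟧ n → Set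
  Fits (A ⊗ B)    (x , y) = Fits A x × Fits B y
  Fits (arr A)    f       = ∀ i → Fits A (f i)
  Fits (list s A) xs      = length xs ≤ bound s × All (Fits A) xs
  Fits _          _       = ⊤

  FitsEnv : (Γ : Ctx) → Env Γ n → Set
  FitsEnv []      _       = ⊤
  FitsEnv (A ∷ Γ) (v , γ) = Fits A v × FitsEnv Γ γ

  fitsLookup : ∀ {Γ A} (x : Γ ∋ A) {γ} → FitsEnv Γ γ → Fits A (lookup x γ)
  fitsLookup here      (p , ps) = p
  fitsLookup (there x) (p , ps) = fitsLookup x ps

  1≤X : 1 ≤ X
  1≤X = ≤-trans (s≤s z≤n) const≤

  instance
    X≢0 : NonZero X
    X≢0 = >-nonZero 1≤X

  1≤X^ : ∀ d → 1 ≤ X ^ d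
  1≤X^ d = m^n>0 X d

  X^-mono : ∀ {d e} → d ≤ e → X ^ d ≤ X ^ e
  X^-mono = ^-monoʳ-≤ X

  -- X dominates the constant 30, so one more factor X pays for the sum.
  sum≤ : ∀ {a b p q} → a ≤ X ^ p → b ≤ X ^ q → 30 + (a + b) ≤ X ^ suc (p + q)
  sum≤ {a} {b} {p} {q} a≤ b≤ = begin
    30 + (a + b)                ≤⟨ +-mono-≤ (*-monoʳ-≤ 30 (1≤X^ (p + q))) (+-mono-≤ a≤′ b≤′) ⟩
    30 * Y + (Y + Y)            ≡⟨ cong (λ y → 30 * Y + (Y + y)) (+-identityʳ Y) ⟨
    30 * Y + 2 * Y              ≡⟨ *-distribʳ-+ Y 30 2 ⟨
    32 * Y                      ≤⟨ *-monoˡ-≤ Y const≤ ⟩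
    X ^ suc (p + q)             ∎
    where
    open ≤-Reasoning
    Y = X ^ (p + q)
    a≤′ : a ≤ Y
    a≤′ = ≤-trans a≤ (X^-mono (m≤m+n p q))
    b≤′ : b ≤ Y
    b≤′ = ≤-trans b≤ (X^-mono (m≤n+m q p))

  suc-sum≤ : ∀ {a b p q} → a ≤ X ^ p → b ≤ X ^ q → suc (a + b) ≤ X ^ suc (p + q)
  suc-sum≤ {p = p} {q} a≤ b≤ = ≤-trans (s≤s (m≤n+m _ 29)) (sum≤ {p = p} {q} a≤ b≤)

  suc-len≤ : ∀ {a p} → a ≤ X ^ p → suc a ≤ X ^ suc p
  suc-len≤ {a} {p} a≤ = subst (λ e → suc a ≤ X ^ suc e) (+-identityʳ p)
    (≤-trans (s≤s (m≤m+n a 0)) (suc-sum≤ {a} {0} {p} {0} a≤ z≤n))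

module Runtime {f : ℕ} (body : Fin f → Exp f 1) (par : Params) where
  open Params par
  open Semantics body

  -- Only an exponent of X is kept of the running time. Exponents compose by the same formula in
  -- every instance, so the proofs below can leave them to unification.
  record Runs {m} (ρ : Vec Val m) (e : Exp f m) (v : Val) (d : ℕ) : Set where
    constructor run
    field
      {time}     : ℕ
      derivation : ρ ⊢ e ⇓ v / time
      time≤      : time ≤ X ^ d

  private variable
    m d d′ p q x y : ℕ
    ρ : Vec Val m
    v w : Val

  slower : ∀ {e : Exp f m} → d ≤ d′ → Runs ρ e v d → Runs ρ e v d′
  slower le (run r t≤) = run r (≤-trans t≤ (X^-mono le))

  runVar : ∀ i → Runs ρ (var i) (Vec.lookup ρ i) 0
  runVar i = run (⇓var i) ≤-refl

  runVar≡ : ∀ i → Vec.lookup ρ i ≡ v → Runs ρ (var i) v 0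
  runVar≡ i refl = runVar i

  runLit : ∀ {x} → Runs ρ (lit x) (nat x) 0
  runLit {x = x} = run (⇓lit x) ≤-refl

  runAdd : ∀ {a b : Exp f m} → Runs ρ a (nat x) p → Runs ρ b (nat y) q →
           Runs ρ (add a b) (nat (x + y)) (suc (p + q))
  runAdd {p = p} {q = q} (run r r≤) (run s s≤) = run (⇓add r s) (suc-sum≤ {p = p} {q} r≤ s≤)

  runSub : ∀ {a b : Exp f m} → Runs ρ a (nat x) p → Runs ρ b (nat y) q →
           Runs ρ (sub a b) (nat (x ∸ y)) (suc (p + q))
  runSub {p = p} {q = q} (run r r≤) (run s s≤) = run (⇓sub r s) (suc-sum≤ {p = p} {q} r≤ s≤)

  runCons : ∀ {a b : Exp f m} → Runs ρ a v p → Runs ρ b w q →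
            Runs ρ (cons a b) (pair v w) (suc (p + q))
  runCons {p = p} {q = q} (run r r≤) (run s s≤) = run (⇓cons r s) (suc-sum≤ {p = p} {q} r≤ s≤)

  runCase0 : ∀ {a b : Exp f m} {c c′} → Runs ρ a (nat 0) p → Runs ρ b w q →
             Runs ρ (case a b c c′) w (suc (p + q))
  runCase0 {p = p} {q = q} (run r r≤) (run s s≤) = run (⇓case-zero r s) (suc-sum≤ {p = p} {q} r≤ s≤)

  runCaseS : ∀ {a b : Exp f m} {c c′} → Runs ρ a (nat (suc x)) p → Runs (nat x ∷ ρ) c w q →
             Runs ρ (case a b c c′) w (suc (p + q))
  runCaseS {p = p} {q = q} (run r r≤) (run s s≤) = run (⇓case-suc r s) (suc-sum≤ {p = p} {q} r≤ s≤)

  runCaseP : ∀ {a b : Exp f m} {c c′ u} → Runs ρ a (pair u v) p → Runs (u ∷ v ∷ ρ) c′ w q →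
             Runs ρ (case a b c c′) w (suc (p + q))
  runCaseP {p = p} {q = q} (run r r≤) (run s s≤) = run (⇓case-pair r s) (suc-sum≤ {p = p} {q} r≤ s≤)

  runBind : ∀ {a : Exp f m} {b} → Runs ρ a v p → Runs (v ∷ ρ) b w q →
            Runs ρ (bind a b) w (suc (p + q))
  runBind {p = p} {q = q} (run r r≤) (run s s≤) = run (⇓bind r s) (suc-sum≤ {p = p} {q} r≤ s≤)

  runCall : ∀ {a : Exp f m} {g c} → body g ≡ c → Runs ρ a v p → Runs (v ∷ []) c w q →
            Runs ρ (call g a) w (suc (p + q))
  runCall {p = p} {q = q} refl (run r r≤) (run s s≤) = run (⇓call r s) (suc-sum≤ {p = p} {q} r≤ s≤)

  -- Each of the `length xs + 1` calls is charged `X ^ suc (p + q)`, which pays for the base case as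
  -- well as for a step. `P` passes to tails, so that a step may use what is known of the rest of
  -- the list, such as the size of the result for it.
  runFold : ∀ {A : Set} {l} (enc : A → Val) (F : List A → Val) (P : List A → Set) {g z s e} →
    body g ≡ foldBody g z s →
    (∀ {x xs} → P (x ∷ xs) → P xs) →
    (P [] → Runs (nat 0 ∷ e ∷ pair (nat 0) e ∷ []) z (F []) p) →
    (∀ x xs → P (x ∷ xs) → ∀ {v w u} →
      Runs (F xs ∷ enc x ∷ v ∷ w ∷ e ∷ u ∷ []) s (F (x ∷ xs)) q) →
    ∀ xs → P xs → length xs ≤ X ^ l →
    Runs (pair (encodeList (List.map enc xs)) e ∷ []) (foldBody g z s) (F xs)
         (suc l + suc (p + q))
  runFold {p} {q} {A} {l} enc F P {g} {z} {s} {e} eq P-tail z-ok s-ok = λ xs ok len →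
    let t , r , t≤ = go xs ok in run r (begin
      t                                   ≤⟨ t≤ ⟩
      suc (length xs) * X ^ suc (p + q)   ≤⟨ *-monoˡ-≤ (X ^ suc (p + q)) (suc-len≤ {p = l} len) ⟩
      X ^ suc l * X ^ suc (p + q)         ≡⟨ ^-distribˡ-+-* X (suc l) (suc (p + q)) ⟨
      X ^ (suc l + suc (p + q))           ∎)
    where
    open ≤-Reasoning
    go : ∀ xs → P xs → ∃[ t ] ((pair (encodeList (List.map enc xs)) e ∷ []) ⊢ foldBody g z s ⇓ F xs / t)
                            × t ≤ suc (length xs) * X ^ suc (p + q)
    go [] ok with run {t} r t≤ ← z-ok ok =
      _ , ⇓case-pair (⇓var _) (⇓case-zero (⇓var _) r) ,
      (begin
        4 + t                       ≡⟨ cong (4 +_) (+-identityʳ t) ⟨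
        4 + (t + 0)                 ≤⟨ +-monoˡ-≤ (t + 0) (m≤m+n 4 26) ⟩
        30 + (t + 0)                ≤⟨ sum≤ {p = p} {q} t≤ z≤n ⟩
        X ^ suc (p + q)             ≡⟨ +-identityʳ (X ^ suc (p + q)) ⟨
        1 * X ^ suc (p + q)         ∎)
    go (x ∷ xs) ok with t , r , t≤ ← go xs (P-tail ok) | run {t′} r′ t′≤ ← s-ok x xs ok
      with c ← ⇓call {g = g} (⇓cons (⇓var {ρ = _ ∷ _ ∷ _ ∷ e ∷ _ ∷ []} 1F) (⇓var 3F)) (subst (λ b → _ ⊢ b ⇓ _ / _) (sym eq) r) =
      _ , ⇓case-pair (⇓var _) (⇓case-pair (⇓var _) (⇓bind c r′)) ,
      (begin
        9 + (t + t′)                ≡⟨ cong (9 +_) (+-comm t t′) ⟩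
        9 + (t′ + t)                ≡⟨ +-assoc 9 t′ t ⟨
        (9 + t′) + t                ≤⟨ +-mono-≤ (+-monoˡ-≤ t′ (m≤m+n 9 21)) t≤ ⟩
        (30 + t′) + suc (length xs) * X ^ suc (p + q)
                                    ≤⟨ +-monoˡ-≤ _ (sum≤ {a = 0} {p = p} {q} z≤n t′≤) ⟩
        suc (suc (length xs)) * X ^ suc (p + q) ∎)

  runAppend : ∀ {A : Set} {l} (enc : A → Val) {g} (xs ys : List A) →
    body g ≡ appendBody g → length xs ≤ X ^ l →
    Runs (pair (encodeList (List.map enc xs)) (encodeList (List.map enc ys)) ∷ []) (appendBody g)
         (encodeList (List.map enc (xs ++ ys))) (suc l + 2)
  runAppend enc xs ys eq len = runFold enc (λ xs → encodeList (List.map enc (xs ++ ys))) (λ _ → ⊤)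
    eq (λ _ → tt) (λ _ → runVar 1F) (λ x xs _ → runCons (runVar 1F) (runVar 0F)) xs tt len

  runConcatMap : ∀ {A B : Set} {l} (encA : A → Val) (encB : B → Val) (h : A → List B) (P : List A → Set)
    {g s e b} →
    body g ≡ foldBody g (lit 0) s →
    (∀ {x xs} → P (x ∷ xs) → P xs) →
    (∀ x xs → P (x ∷ xs) → ∀ {v w u} →
      Runs (encodeList (List.map encB (concatMap h xs)) ∷ encA x ∷ v ∷ w ∷ e ∷ u ∷ []) s
           (encodeList (List.map encB (h x ++ concatMap h xs))) b) →
    ∀ xs → P xs → length xs ≤ X ^ l →
    Runs (pair (encodeList (List.map encA xs)) e ∷ []) (foldBody g (lit 0) s)
         (encodeList (List.map encB (concatMap h xs))) (suc l + suc b)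
  runConcatMap encA encB h P eq tl s-ok =
    runFold encA (λ xs → encodeList (List.map encB (concatMap h xs))) P eq tl (λ _ → runLit) s-ok

-- Sizes of computed values

length-concatMap : ∀ {A B : Set} (h : A → List B) {m} xs → All (λ x → length (h x) ≤ m) xs →
                   length (concatMap h xs) ≤ length xs * m
length-concatMap h []       []       = z≤n
length-concatMap h (x ∷ xs) (p ∷ ps) = begin
  length (h x ++ concatMap h xs)         ≡⟨ length-++ (h x) ⟩
  length (h x) + length (concatMap h xs) ≤⟨ +-mono-≤ p (length-concatMap h xs ps) ⟩
  _                                      ∎
  where open ≤-Reasoning

All-concatMap : ∀ {A B : Set} {P : B → Set} (h : A → List B) {xs} →
                All (λ x → All P (h x)) xs → All P (concatMap h xs)
All-concatMap h []       = []
All-concatMap h (p ∷ ps) = All.++⁺ p (All-concatMap h ps)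

foldr-All : ∀ {A B : Set} {P : A → Set} {Q : B → Set} (h : A → B → B) {z} →
            (∀ x y → P x → Q y → Q (h x y)) → Q z → ∀ {xs} → All P xs → Q (foldr h z xs)
foldr-All h step base []       = base
foldr-All h step base (p ∷ ps) = step _ _ p (foldr-All h step base ps)

module _ (par : Params) where
  open Params par

  length-growList : ∀ {A B C : Set} (h : B → C → A → C) bs c as →
                    length bs ≤ 2 + k → length as ≤ 2 + k → length (growList h bs c as) ≤ X ^ 1
  length-growList h bs c as bs≤ as≤ = begin
    length (growList h bs c as)  ≤⟨ go as ⟩
    (2 + k) ^ length as          ≤⟨ ^-monoʳ-≤ (2 + k) as≤ ⟩
    (2 + k) ^ (2 + k)            ≤⟨ k≤ ⟩
    X                            ≡⟨ ^-identityʳ X ⟨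
    X ^ 1                        ∎
    where
    open ≤-Reasoning
    go : ∀ as → length (growList h bs c as) ≤ (2 + k) ^ length as
    go []       = s≤s z≤n
    go (a ∷ as) = begin
      length (growStep h bs a (growList h bs c as))
        ≤⟨ length-concatMap _ (growList h bs c as)
             (All.tabulate λ _ → ≤-trans (≤-reflexive (length-map _ bs)) bs≤) ⟩
      length (growList h bs c as) * (2 + k)  ≤⟨ *-monoˡ-≤ (2 + k) (go as) ⟩
      (2 + k) ^ length as * (2 + k)          ≡⟨ *-comm ((2 + k) ^ length as) (2 + k) ⟩
      (2 + k) ^ length (a ∷ as)              ∎

  All-growList : ∀ {A B C : Set} {P : A → Set} {Q : B → Set} {R : C → Set} (h : B → C → A → C) {bs c} →
                 (∀ b c a → Q b → R c → P a → R (h b c a)) → All Q bs → R c →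
                 ∀ {as} → All P as → All R (growList h bs c as)
  All-growList {R = R} h step qs r = foldr-All {Q = All R} (growStep h _)
    (λ a cs p rs → All-concatMap _ (All.map (λ r → All.map⁺ (All.map (λ q → step _ _ _ q r p) qs)) rs)) (r ∷ [])

  fits₀ : ∀ {A} (o : Op₀ A) → Fits A (sem₀ o)
  fits₀ trueᵒ  = tt
  fits₀ falseᵒ = tt
  fits₀ zeroᵒ  = tt
  fits₀ oneᵒ   = tt
  fits₀ nilᵒ   = z≤n , []
  fits₀ boolsᵒ = s≤s (s≤s z≤n) , tt ∷ tt ∷ []

  fits₁ : ∀ {A B} (o : Op₁ A B) x → Fits A x → Fits B (sem₁ o x)
  fits₁ fstᵒ    x p = proj₁ p
  fits₁ sndᵒ    x p = proj₂ p
  fits₁ toNatᵒ  x p = tt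
  fits₁ sizeᵒ   x p = tt
  fits₁ toListᵒ x p =
    ≤-trans (≤-reflexive (length-tabulate x)) (≤-trans n≤ (≤-reflexive (sym (^-identityʳ X)))) ,
    All.tabulate⁺ p
  fits₁ singleᵒ x p = s≤s z≤n , p ∷ []

  fits₂ : ∀ {A B C} (o : Op₂ A B C) x y → Fits A x → Fits B y → Fits C (sem₂ o x y)
  fits₂ pairᵒ x y p q = p , q
  fits₂ addᵒ  x y p q = tt
  fits₂ leqᵒ  x y p q = tt
  fits₂ eqiᵒ  x y p q = tt
  fits₂ consᵒ x y p (len , q) = s≤s (≤-trans len (n≤1+n k)) , p ∷ q

  -- This is what turns types into loop bounds: the length of any list met during a run can be read
  -- off its type.
  fits : ∀ {Γ A} (t : Tm Γ A) γ → FitsEnv Γ γ → Fits A (sem t γ)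
  fits (var x)          γ p = fitsLookup x p
  fits (op₀ o)          γ p = fits₀ o
  fits (op₁ o a)        γ p = fits₁ o (sem a γ) (fits a γ p)
  fits (op₂ o a b)      γ p = fits₂ o (sem a γ) (sem b γ) (fits a γ p) (fits b γ p)
  fits (cond a b c)     γ p with sem a γ
  ... | true  = fits b γ p
  ... | false = fits c γ p
  fits (lett a b)       γ p = fits b _ (fits a γ p , p)
  fits (fold l z b)     γ p =
    foldr-All _ (λ x y q r → fits b (x , y , γ) (q , r , p)) (fits z γ p) (proj₂ (fits l γ p))
  fits (forl {p = d} {q = e} l b) γ p with len , qs ← fits l γ p =
    (begin
      length (concatMap (λ x → sem b (x , γ)) (sem l γ))
        ≤⟨ length-concatMap _ (sem l γ) (All.map (λ q → proj₁ (fits b _ (q , p))) qs) ⟩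
      length (sem l γ) * X ^ e  ≤⟨ *-monoˡ-≤ (X ^ e) len ⟩
      X ^ d * X ^ e             ≡⟨ ^-distribˡ-+-* X d e ⟨
      X ^ (d + e)               ∎) ,
    All-concatMap _ (All.map (λ q → proj₂ (fits b _ (q , p))) qs)
    where open ≤-Reasoning
  fits (grow as bs c f) γ p with fits as γ p | fits bs γ p
  ... | as≤ , qs | bs≤ , rs =
    length-growList _ (sem bs γ) (sem c γ) (sem as γ) bs≤ as≤ ,
    All-growList _ (λ y z x r s q → fits f (y , z , x , sem bs γ , γ) (r , s , q , (bs≤ , rs) , p)) rs (fits c γ p) qs
  fits (get a j)        γ p = fits a γ p (sem j γ)
  fits (mapi a b)       γ p = λ i → fits b _ (fits a γ p i , tt , p)

-- Correctness and running time of compiled terms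

agreeˡ : ∀ {a b} {E : Set} {ψ : Fin (a + b) → E} {p : Fin a → E} {q : Fin b → E} →
         (∀ i → ψ i ≡ (p ⊕ q) i) → ∀ i → ψ (i ↑ˡ b) ≡ p i
agreeˡ {a} {b} {p = p} {q} eq i =
  trans (eq (i ↑ˡ b)) (cong ([ p , q ]′) (splitAt-↑ˡ a i b))

agreeʳ : ∀ a {b} {E : Set} {ψ : Fin (a + b) → E} {p : Fin a → E} {q : Fin b → E} →
         (∀ i → ψ i ≡ (p ⊕ q) i) → ∀ i → ψ (a ↑ʳ i) ≡ q i
agreeʳ a {b} {p = p} {q} eq i =
  trans (eq (a ↑ʳ i)) (cong ([ p , q ]′) (splitAt-↑ʳ a b i))

module Correctness {f : ℕ} (body : Fin f → Exp f 1) where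
  open Runtime body

  Linked : ∀ {Γ A} (t : Tm Γ A) → (Fin (arity t) → Fin f) → Set
  Linked t φ = ∀ i → body (φ i) ≡ defs t φ i

  -- The exponent comes before the instance, which makes it a property of the term. The environment
  -- may sit at any variable `i`, because the binders around the code shift it.
  Timed : ∀ {Γ A} (t : Tm Γ A) (e : ∀ {m} → Fin m → Exp f m) → ℕ → Set
  Timed {Γ} {A} t e d =
    ∀ (par : Params) {m} (ρ : Vec Val m) i (γ : Env Γ (Params.n par)) →
    Vec.lookup ρ i ≡ encEnv Γ γ → Params.FitsEnv par Γ γ →
    Runs par ρ (e i) (enc A (sem t γ)) d

  runLookup : ∀ {Γ A} (x : Γ ∋ A) → ∃[ d ] Timed (var x) (compVar x) d
  runLookup here      = _ , λ par ρ i (v , γ) eq p →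
    runCaseP par (runVar≡ par i eq) (runVar par 0F)
  runLookup (there x) with d , r ← runLookup x = _ , λ par ρ i (v , γ) eq p →
    runCaseP par (runVar≡ par i eq) (r par _ 1F γ refl (proj₂ p))

  run₀ : ∀ {A} (o : Op₀ A) → ∃[ d ] ∀ par {m} (ρ : Vec Val m) →
         Runs par ρ (code₀ o) (enc {Params.n par} A (sem₀ o)) d
  run₀ trueᵒ  = _ , λ par ρ → runLit par
  run₀ falseᵒ = _ , λ par ρ → runLit par
  run₀ zeroᵒ  = _ , λ par ρ → runLit par
  run₀ oneᵒ   = _ , λ par ρ → runLit par
  run₀ nilᵒ   = _ , λ par ρ → runLit par
  run₀ boolsᵒ = _ , λ par ρ → runCons par (runLit par) (runCons par (runLit par) (runLit par))

  run₁ : ∀ {A B} (o : Op₁ A B) → ∃[ d ] ∀ par {m} (ρ : Vec Val m) x →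
         Runs par (enc {Params.n par} A x ∷ ρ) (code₁ o) (enc B (sem₁ o x)) d
  run₁ fstᵒ    = _ , λ par ρ x → runCaseP par (runVar par 0F) (runVar par 0F)
  run₁ sndᵒ    = _ , λ par ρ x → runCaseP par (runVar par 0F) (runVar par 1F)
  run₁ toNatᵒ  = _ , λ par ρ x → runVar par 0F
  run₁ sizeᵒ   = _ , λ par ρ x → runVar par 0F
  run₁ (toListᵒ {A}) = _ , λ par ρ x →
    runVar≡ par 0F (cong encodeList (sym (map-tabulate x (enc A))))
  run₁ singleᵒ = _ , λ par ρ x → runCons par (runVar par 0F) (runLit par)

  runIsZero : ∀ par {m} {ρ : Vec Val m} {e : Exp f m} {x p} → Runs par ρ e (nat x) p →
              Runs par ρ (case e (lit 1) (lit 0) (lit 0)) (encodeBool (isZero x)) (suc (p + 0))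
  runIsZero par {x = zero}  r = runCase0 par r (runLit par)
  runIsZero par {x = suc _} r = runCaseS par r (runLit par)

  run₂ : ∀ {A B C} (o : Op₂ A B C) → ∃[ d ] ∀ par {m} (ρ : Vec Val m) x y →
         Runs par (enc {Params.n par} B y ∷ enc A x ∷ ρ) (code₂ o) (enc C (sem₂ o x y)) d
  run₂ pairᵒ = _ , λ par ρ x y → runCons par (runVar par 1F) (runVar par 0F)
  run₂ addᵒ  = _ , λ par ρ x y → runAdd par (runVar par 1F) (runVar par 0F)
  run₂ leqᵒ  = _ , λ par ρ x y → runIsZero par (runSub par (runVar par 1F) (runVar par 0F))
  run₂ eqiᵒ  = _ , λ par ρ x y → runIsZero par
    (runAdd par (runSub par (runVar par 1F) (runVar par 0F)) (runSub par (runVar par 0F) (runVar par 1F)))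
  run₂ consᵒ = _ , λ par ρ x y → runCons par (runVar par 1F) (runVar par 0F)

  module _ where
    open Semantics body

    getTime : ∀ {g} → body g ≡ getBody g → ∀ {n} (f : Fin n → Val) j →
      ∃[ t ] ((pair (encodeList (List.tabulate f)) (nat (toℕ j)) ∷ []) ⊢ getBody g ⇓ f j / t) × t ≤ n * 30
    getTime eq {suc n} f zero =
      _ , ⇓case-pair (⇓var _) (⇓case-pair (⇓var _) (⇓case-zero (⇓var _) (⇓var _))) , m≤m+n 7 (23 + n * 30)
    getTime {g} eq {suc n} f (suc j) with t , r , t≤ ← getTime {g} eq (λ i → f (suc i)) j
      with c ← ⇓call {g = g} (⇓cons (⇓var {ρ = _ ∷ _ ∷ _ ∷ _ ∷ _ ∷ _ ∷ []} 2F) (⇓var 0F))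
                 (subst (λ b → _ ⊢ b ⇓ _ / _) (sym eq) r) =
      _ , ⇓case-pair (⇓var _) (⇓case-pair (⇓var _) (⇓case-suc (⇓var _) c)) , +-mono-≤ (m≤m+n 10 20) t≤

  runGet : ∀ {g} → body g ≡ getBody g → ∃[ d ] ∀ par (f : Fin (Params.n par) → Val) j →
           Runs par (pair (encodeList (List.tabulate f)) (nat (toℕ j)) ∷ []) (getBody g) (f j) d
  runGet eq = 2 , λ par f j →
    let open Params par
        open ≤-Reasoning
        t , r , t≤ = getTime eq f j
    in run r (begin
      t          ≤⟨ t≤ ⟩
      n * 30     ≤⟨ *-mono-≤ n≤ (≤-trans (m≤m+n 30 2) const≤) ⟩
      X * X      ≡⟨ cong (X *_) (*-identityʳ X) ⟨
      X ^ 2      ∎)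

  module _ {Γ A B} {b : Tm (A ∷ idx ∷ Γ) B} (e : ∀ {m} → Fin m → Exp f m) {d} (b-ok : Timed b e d)
           (par : Params) where
    open Params par
    open Semantics body
    open ≤-Reasoning

    -- The recursion sees a suffix of the array only. `emb` places that suffix in the whole array,
    -- starting at the counter `j`, so that the counter encodes the index which the body expects.
    mapiTime : ∀ {g} → body g ≡ mapiBody g e → ∀ γ → FitsEnv Γ γ →
      ∀ {l} (h : Fin l → ⟦ A ⟧ n) → (∀ i → Fits A (h i)) →
      ∀ j (emb : Fin l → Fin n) → (∀ i → toℕ (emb i) ≡ j + toℕ i) →
      ∃[ t ] ((pair (encodeList (List.tabulate λ i → enc A (h i))) (pair (nat j) (encEnv Γ γ)) ∷ [])
                ⊢ mapiBody g e ⇓ encodeList (List.tabulate λ i → enc B (sem b (h i , emb i , γ))) / t)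
           × t ≤ suc l * X ^ suc (d + 0)
    mapiTime eq γ ps {zero} h qs j emb emb≡ =
      _ , ⇓case-pair (⇓var _) (⇓case-zero (⇓var _) (⇓lit 0)) ,
      (begin
        5                     ≤⟨ m≤m+n 5 25 ⟩
        30 + (0 + 0)          ≤⟨ sum≤ {p = d} {0} z≤n z≤n ⟩
        X ^ suc (d + 0)       ≡⟨ +-identityʳ (X ^ suc (d + 0)) ⟨
        1 * X ^ suc (d + 0)   ∎)
    mapiTime {g} eq γ ps {suc l} h qs j emb emb≡
      with t , r , t≤ ← mapiTime {g} eq γ ps (λ i → h (suc i)) (λ i → qs (suc i)) (suc j) (λ i → emb (suc i))
                          (λ i → trans (emb≡ (suc i)) (+-suc j (toℕ i)))
         | run {t′} r′ t′≤ ← b-ok par (pair (enc A (h zero)) (pair (nat j) (encEnv Γ γ)) ∷ nat j ∷ encEnv Γ γ ∷ enc A (h zero) ∷ encodeList (List.tabulate λ i → enc A (h (suc i))) ∷ encodeList (List.tabulate λ i → enc A (h i)) ∷ pair (nat j) (encEnv Γ γ) ∷ _ ∷ []) 0F (h zero , emb zero , γ)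
             (cong (λ i → pair (enc A (h zero)) (pair (nat i) (encEnv Γ γ)))
                   (sym (trans (emb≡ zero) (+-identityʳ j))))
             (qs zero , tt , ps)
      with c ← ⇓call {g = g} (⇓cons (⇓var {ρ = nat j ∷ encEnv Γ γ ∷ enc A (h zero) ∷ encodeList (List.tabulate λ i → enc A (h (suc i))) ∷ encodeList (List.tabulate λ i → enc A (h i)) ∷ pair (nat j) (encEnv Γ γ) ∷ _ ∷ []} 3F)
                               (⇓cons (⇓add (⇓lit 1) (⇓var 0F)) (⇓var 1F)))
                 (subst (λ b → _ ⊢ b ⇓ _ / _) (sym eq) r) =
      _ , ⇓case-pair (⇓var _) (⇓case-pair (⇓var _) (⇓case-pair (⇓var _)
            (⇓cons (⇓bind (⇓cons (⇓var _) (⇓cons (⇓var _) (⇓var _))) r′) c))) ,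
      (begin
        13 + (t′ + (8 + t))               ≡⟨ cong (13 +_) (+-assoc t′ 8 t) ⟨
        13 + ((t′ + 8) + t)               ≡⟨ cong (λ x → 13 + (x + t)) (+-comm t′ 8) ⟩
        21 + (t′ + t)                     ≡⟨ cong (λ x → 21 + (x + t)) (+-identityʳ t′) ⟨
        21 + (t′ + 0) + t                 ≤⟨ +-mono-≤ (+-monoˡ-≤ (t′ + 0) (m≤m+n 21 9)) t≤ ⟩
        30 + (t′ + 0) + suc l * X ^ suc (d + 0)
                                          ≤⟨ +-monoˡ-≤ _ (sum≤ {p = d} {0} t′≤ z≤n) ⟩
        suc (suc l) * X ^ suc (d + 0)     ∎)

    runMapi : ∀ {g} → body g ≡ mapiBody g e → ∀ γ → FitsEnv Γ γ → ∀ h → Fits (arr A) h →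
      Runs par (pair (enc (arr A) h) (pair (nat 0) (encEnv Γ γ)) ∷ []) (mapiBody g e)
               (enc (arr B) λ i → sem b (h i , i , γ)) (2 + suc (d + 0))
    runMapi eq γ ps h qs =
      let t , r , t≤ = mapiTime eq γ ps h qs 0 (λ i → i) (λ i → refl) in
      run r (begin
        t                                  ≤⟨ t≤ ⟩
        suc n * X ^ suc (d + 0)            ≤⟨ *-monoˡ-≤ (X ^ suc (d + 0))
                                                (suc-len≤ {p = 1} (≤-trans n≤ (≤-reflexive (sym (^-identityʳ X))))) ⟩
        X ^ 2 * X ^ suc (d + 0)            ≡⟨ ^-distribˡ-+-* X 2 (suc (d + 0)) ⟨
        X ^ (2 + suc (d + 0))              ∎)

  correct : ∀ {Γ A} (t : Tm Γ A) φ → Linked t φ → ∃[ d ] Timed t (comp t φ) d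
  correct (var x)      φ eq = runLookup x
  correct (op₀ o)      φ eq with d , r ← run₀ o = d , λ par ρ i γ _ _ → r par ρ
  correct (op₁ o a)    φ eq with _ , r ← correct a φ eq | _ , s ← run₁ o =
    _ , λ par ρ i γ i≡ ps → runBind par (r par ρ i γ i≡ ps) (s par ρ (sem a γ))
  correct (op₂ o a b)  φ eq
    with _ , r ← correct a (left (arity b) φ) (agreeˡ eq)
       | _ , r′ ← correct b (right (arity a) φ) (agreeʳ (arity a) eq)
       | _ , s ← run₂ o =
    _ , λ par ρ i γ i≡ ps →
      runBind par (r par ρ i γ i≡ ps)
        (runBind par (r′ par _ (suc i) γ i≡ ps) (s par ρ (sem a γ) (sem b γ)))
  correct (cond a b c) φ eq
    with _ , r ← correct a (left (arity b + arity c) φ) (agreeˡ eq)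
       | d , s ← correct b (left (arity c) (right (arity a) φ)) (agreeˡ (agreeʳ (arity a) eq))
       | d′ , s′ ← correct c (right (arity b) (right (arity a) φ))
                     (agreeʳ (arity b) (agreeʳ (arity a) eq)) =
    -- The exponent must not depend on the outcome of the test, so both branches are granted the sum
    -- of their exponents.
    _ , λ par ρ i γ i≡ ps → branch par ρ i γ i≡ ps (r par ρ i γ i≡ ps)
      (λ {x} → s par (x ∷ ρ) (suc i) γ i≡ ps) (s′ par ρ i γ i≡ ps)
    where
    branch : ∀ {d d′ p} par {m} (ρ : Vec Val m) i γ → Vec.lookup ρ i ≡ encEnv _ γ → Params.FitsEnv par _ γ →
      ∀ {e e₀ e₁} →
      Runs par ρ e (encodeBool (sem a γ)) p →
      (∀ {x} → Runs par (x ∷ ρ) e₁ (enc _ (sem b γ)) d) → Runs par ρ e₀ (enc _ (sem c γ)) d′ →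
      Runs par ρ (case e e₀ e₁ (lit 0)) (enc _ (if sem a γ then sem b γ else sem c γ)) (suc (p + (d + d′)))
    branch {d} {d′} par ρ i γ i≡ ps r s s′ with sem a γ
    ... | true  = runCaseS par r (slower par (m≤m+n d d′) s)
    ... | false = runCase0 par r (slower par (m≤n+m d′ d) s′)
  correct (lett a b)   φ eq
    with _ , r ← correct a (left (arity b) φ) (agreeˡ eq)
       | _ , s ← correct b (right (arity a) φ) (agreeʳ (arity a) eq) =
    _ , λ par ρ i γ i≡ ps →
      runBind par (runCons par (r par ρ i γ i≡ ps) (runVar≡ par i i≡))
        (s par _ 0F (sem a γ , γ) refl (fits par a γ ps , ps))
  correct (get {A} a j) φ eq
    with _ , r ← correct a (left (arity j) (tail φ)) (agreeˡ (eq ∘ suc))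
       | _ , s ← correct j (right (arity a) (tail φ)) (agreeʳ (arity a) (eq ∘ suc))
       | _ , q ← runGet (eq 0F) =
    _ , λ par ρ i γ i≡ ps →
      runCall par (eq 0F) (runCons par (r par ρ i γ i≡ ps) (s par ρ i γ i≡ ps))
        (q par (λ v → enc A (sem a γ v)) (sem j γ))
  correct (mapi a b)   φ eq
    with _ , r ← correct a (left (arity b) (tail φ)) (agreeˡ (eq ∘ suc))
       | _ , s ← correct b (right (arity a) (tail φ)) (agreeʳ (arity a) (eq ∘ suc)) =
    _ , λ par ρ i γ i≡ ps →
      runCall par (eq 0F)
        (runCons par (r par ρ i γ i≡ ps) (runCons par (runLit par) (runVar≡ par i i≡)))
        (runMapi {b = b} (comp b (right (arity a) (tail φ))) s par (eq 0F) γ ps (sem a γ) (fits par a γ ps))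
  correct (fold {p = p} {A = A} {B} l z b) φ eq
    with _ , r ← correct l (left (arity z + arity b) (tail φ)) (agreeˡ (eq ∘ suc))
       | _ , s ← correct z (left (arity b) (right (arity l) (tail φ)))
                   (agreeˡ (agreeʳ (arity l) (eq ∘ suc)))
       | _ , q ← correct b (right (arity z) (right (arity l) (tail φ)))
                   (agreeʳ (arity z) (agreeʳ (arity l) (eq ∘ suc))) =
    _ , λ par ρ i γ i≡ ps →
      let open Params par
          z-ok = fits par z γ ps
          step-ok = λ x acc x-ok acc-ok → fits par b (x , acc , γ) (x-ok , acc-ok , ps)
      in runCall par (eq 0F) (runCons par (r par ρ i γ i≡ ps) (runVar≡ par i i≡))
        (runFold par {l = p} (enc A)
          (λ xs → enc B (foldr (λ x acc → sem b (x , acc , γ)) (sem z γ) xs))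
          (All (Fits A)) (eq 0F) All.tail (λ _ → s par _ 1F γ refl ps)
          (λ x xs x-ok → runBind par
            (runCons par (runVar par 1F) (runCons par (runVar par 0F) (runVar par 4F)))
            (q par _ 0F _ refl
              (All.head x-ok , foldr-All {Q = Fits B} _ step-ok z-ok (All.tail x-ok) , ps)))
          (sem l γ) (proj₂ (fits par l γ ps)) (proj₁ (fits par l γ ps)))
  correct (forl {p = p} {q = q′} {A = A} {B = B} l b) φ eq
    with _ , r ← correct l (left (arity b) (tail (tail φ))) (agreeˡ (λ i → eq (suc (suc i))))
       | _ , q ← correct b (right (arity l) (tail (tail φ)))
                   (agreeʳ (arity l) (λ i → eq (suc (suc i)))) =
    _ , λ par ρ i γ i≡ ps →
      let open Params par
          len , qs = fits par l γ ps
      in runCall par (eq 0F) (runCons par (r par ρ i γ i≡ ps) (runVar≡ par i i≡))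
        (runConcatMap par {l = p} (enc A) (enc B) (λ x → sem b (x , γ)) (All (Fits A)) (eq 0F) All.tail
          (λ x xs x-ok → runCall par (eq 1F)
            (runCons par
              (runBind par (runCons par (runVar par 1F) (runVar par 4F))
                (q par _ 0F (x , γ) refl (All.head x-ok , ps)))
              (runVar par 0F))
            (runAppend par {l = q′} (enc B) (sem b (x , γ)) (concatMap (λ x → sem b (x , γ)) xs) (eq 1F) (proj₁ (fits par b (x , γ) (All.head x-ok , ps)))))
          (sem l γ) qs len)
  correct (grow {A} {B} {C} as bs c f) φ eq
    with _ , r₁ ← correct as (left (arity bs + (arity c + arity f)) (λ i → φ (suc (suc (suc (suc i))))))
                    (agreeˡ (λ i → eq (suc (suc (suc (suc i))))))
       | _ , r₂ ← correct bs (left (arity c + arity f) (right (arity as) (λ i → φ (suc (suc (suc (suc i)))))))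
                    (agreeˡ (agreeʳ (arity as) (λ i → eq (suc (suc (suc (suc i)))))))
       | _ , r₃ ← correct c (left (arity f) (right (arity bs) (right (arity as) (λ i → φ (suc (suc (suc (suc i))))))))
                    (agreeˡ (agreeʳ (arity bs) (agreeʳ (arity as) (λ i → eq (suc (suc (suc (suc i))))))))
       | _ , r₄ ← correct f (right (arity c) (right (arity bs) (right (arity as) (λ i → φ (suc (suc (suc (suc i))))))))
                    (agreeʳ (arity c) (agreeʳ (arity bs) (agreeʳ (arity as) (λ i → eq (suc (suc (suc (suc i)))))))) =
    _ , λ par ρ i γ i≡ ps →
      let open Params par
          as≤ , as-ok = fits par as γ ps
          bs≤ , bs-ok = fits par bs γ ps
          small≤ : ∀ {l} → l ≤ 2 + k → l ≤ X ^ 1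
          small≤ le = ≤-trans le (≤-trans (k+2≤ k) (≤-trans k≤ (≤-reflexive (sym (^-identityʳ X)))))
          h = λ y z x → sem f (y , z , x , sem bs γ , γ)
      in runCall par (eq 0F)
           (runCons par (r₁ par ρ i γ i≡ ps) (runCons par (r₂ par ρ i γ i≡ ps) (runVar≡ par i i≡)))
           (runFold par {l = 1} (enc A) (λ as → enc (list (pow 1) C) (growList h (sem bs γ) (sem c γ) as))
             (λ as → All (Fits A) as × length as ≤ 2 + k) (eq 0F)
             (λ (qs , le) → All.tail qs , ≤-trans (n≤1+n _) le)
             (λ _ → runCons par (runCaseP par (runVar par 1F) (r₃ par _ 1F γ refl ps)) (runLit par))
             (λ a as (a-ok , le) →
               let acc = growList h (sem bs γ) (sem c γ) as
                   acc-ok : All (Fits C) acc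
                   acc-ok = All-growList par h (λ y z x q s p → fits par f _ (q , s , p , (bs≤ , bs-ok) , ps))
                              bs-ok (fits par c γ ps) (All.tail a-ok)
               in runCall par (eq 1F)
                    (runCons par (runVar par 0F) (runCons par (runVar par 1F) (runVar par 4F)))
                    (runConcatMap par {l = 1} (enc C) (enc C) (λ c → List.map (λ b → h b c a) (sem bs γ)) (All (Fits C))
                      (eq 1F) All.tail
                      (λ z zs z-ok →
                        runCaseP par (runVar par 4F)
                          (runCaseP par (runVar par 1F)
                            (runCall par (eq 3F)
                              (runCons par
                                (runCall par (eq 2F)
                                  (runCons par (runVar par 0F) (runCons par (runVar par 5F) (runVar par 8F)))
                                  (runFold par {l = 1} (enc B) (λ bs → enc (list loose C) (List.map (λ b → h b z a) bs))
                                    (All (Fits B)) (eq 2F) All.tail (λ _ → runLit par)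
                                    (λ y ys y-ok → runCons par
                                      (runBind par (runCons par (runVar par 1F) (runVar par 4F))
                                        (r₄ par _ 0F (y , z , a , sem bs γ , γ) refl
                                          (All.head y-ok , All.head z-ok , All.head a-ok , (bs≤ , bs-ok) , ps)))
                                      (runVar par 0F))
                                    (sem bs γ) bs-ok (small≤ bs≤)))
                                (runVar par 4F))
                              (runAppend par {l = 1} (enc C) (List.map (λ b → h b z a) (sem bs γ))
                                (concatMap (λ c → List.map (λ b → h b c a) (sem bs γ)) zs) (eq 3F)
                                (≤-trans (≤-reflexive (length-map _ (sem bs γ))) (small≤ bs≤))))))
                      acc acc-ok
                      (length-growList par h (sem bs γ) (sem c γ) as bs≤ (≤-trans (n≤1+n _) le))))
             (sem as γ) (as-ok , as≤) (small≤ as≤))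
    where
    k+2≤ : ∀ k → 2 + k ≤ (2 + k) ^ (2 + k)
    k+2≤ k = ≤-trans (≤-reflexive (sym (^-identityʳ (2 + k)))) (^-monoʳ-≤ (2 + k) {1} {2 + k} (s≤s z≤n))

-- The algorithm as a Boolean function

infixr 6 _&&_
infixr 5 _||_
infixr 4 _⇒_

-- These connectives, like the comparisons and list functions after them, are spelled out exactly as
-- the corresponding terms compute them; this is why `decide-sem` holds by `refl`.
_&&_ _||_ _⇒_ : Bool → Bool → Bool
a && b = if a then b else false
a || b = if a then true else b
a ⇒ b  = if a then b else true

neg : Bool → Bool
neg a = if a then false else true

_≤ᵇ_ _<ᵇ_ : ℕ → ℕ → Bool
a ≤ᵇ b = isZero (a ∸ b)
a <ᵇ b = (1 + a) ≤ᵇ b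

_==_ : ∀ {n} → Fin n → Fin n → Bool
i == j = isZero ((toℕ i ∸ toℕ j) + (toℕ j ∸ toℕ i))

any all : ∀ {A : Set} → List A → (A → Bool) → Bool
any xs p = foldr (λ x acc → if p x then true else acc) false xs
all xs p = foldr (λ x acc → if p x then acc else false) true xs

filt : ∀ {A : Set} → List A → (A → Bool) → List A
filt xs p = concatMap (λ x → if p x then x ∷ [] else []) xs

vertices : ∀ n → List (Fin n)
vertices n = List.tabulate (λ i → i)

count : ∀ {n} → (Fin n → Bool) → ℕ
count {n} p = foldr (λ v acc → if p v then 1 + acc else acc) 0 (vertices n)

update : ∀ {n} {A : Set} → A → (Fin n → A) → Fin n → Fin n → A
update y f x v = if v == x then y else f v

-- An entry (A , C , q) of the table for an eliminated vertex c and a vertex o stands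
-- for the partial solutions that omit o, and nothing else, from the clique K of later
-- neighbours of c (nothing at all if o ∉ K). The sets A and C may be smaller, and q
-- larger, than what the partial solution achieves.

Entry Table : ℕ → Set
Entry n = (Fin n → Bool) × (Fin n → Bool) × ℕ
Table n = Fin n → List (Entry n)

subsets : ∀ {n} → List (Fin n) → List (Fin n → Bool)
subsets = growList update (false ∷ true ∷ []) (λ _ → false)

rankings : ∀ {n} → List ℕ → List (Fin n) → List (Fin n → ℕ)
rankings ks = growList update ks (λ _ → 0)

entries : ∀ {n} → List (Fin n → Bool) → List (Entry n)
entries {n} Us = concatMap (λ A → concatMap (λ C → concatMap (λ i → (A , C , toℕ i) ∷ []) (vertices n)) Us) Us

-- S contains the root r, S₁ is the guess for its intersection with the cover.
module Guess {n} (adj : Fin n → Fin n → Bool) (S S₁ : Fin n → Bool) (rank : Fin n → ℕ)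
             (es : List (Entry n)) (r : Fin n) (l : ℕ) where

  vs : List (Fin n)
  vs = vertices n

  simplicial : (Fin n → Bool) → Fin n → Bool
  simplicial alive v = all vs λ u → all vs λ w →
    alive u && alive w && adj v u && adj v w && neg (u == w) ⇒ adj u w

  -- The default `r` lies in `S` and is therefore never alive, so it can only mean that no vertex
  -- was found.
  pick : (Fin n → Bool) → Fin n
  pick alive = foldr (λ v acc → if alive v && simplicial alive v then v else acc) r vs

  start : Table n
  start o = filt es λ (A , C , q) → all vs λ v → neg (A v) && neg (C v)

  -- Inclusions suffice because entries may understate. No link is added: finished components of
  -- different classes are separate, and links through an unfinished one are collected when a vertex
  -- of its clique is taken.
  joins : Entry n → Entry n → Entry n → Bool
  joins (A , C , q) (A₁ , C₁ , q₁) (A₂ , C₂ , q₂) =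
    (all vs λ v → (A v ⇒ (A₁ v || A₂ v)) && (C v ⇒ (C₁ v || C₂ v))) && (q₁ + q₂) ≤ᵇ q

  merge : Table n → Table n → Table n
  merge X Y o = filt es λ e → any (X o) λ e₁ → any (Y o) λ e₂ → joins e e₁ e₂

  pull : (Fin n → Bool) → (Fin n → Table n) → Table n
  pull ch W = foldr (λ c acc → if ch c then merge acc (W c) else acc) start vs

  -- Without `x`, all its neighbours must be in the cover. Hence `o` cannot be one of its later
  -- neighbours, none of its neighbours may lie in `S` outside `S₁`, and the merged table of the
  -- children is read with `x` as the omitted vertex.
  omits : (Fin n → Bool) → Fin n → Fin n → Table n → Entry n → Bool
  omits alive x o T (A , C , q) =
    (all vs λ v → S v && neg (S₁ v) ⇒ neg (adj x v))
    && neg (alive o && adj x o)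
    && any (T x) λ (A₁ , C₁ , q₁) →
         (all vs λ v → (A v ⇒ A₁ v) && (C v ⇒ C₁ v)) && q₁ ≤ᵇ q

  linkable : (Fin n → Bool) → Fin n → Bool
  linkable A v = A v && any vs λ u → A u && rank u <ᵇ rank v

  -- Once `x` is taken, all that reaches the clique forms one component with neighbours `A⁺`, so
  -- every link within `A⁺` is available. This component either lives on through a later neighbour
  -- `y`, or it is finished: then it must be attached to `S₁` by now and leaves nothing in `A`.
  extends : (Fin n → Bool) → Fin n → Fin n → Entry n → (Fin n → Bool) → Entry n → Bool
  extends alive x o (A , C , q) A⁺ (A₁ , C₁ , q₁) =
    (all vs λ v → C v ⇒ (C₁ v || linkable A⁺ v))
    && (1 + q₁) ≤ᵇ q
    && (((any vs λ y → alive y && adj x y && neg (y == o)) && (all vs λ v → A v ⇒ A⁺ v))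
        || (any vs A⁺ && (all vs λ v → neg (A v))))

  takes : (Fin n → Bool) → Fin n → Fin n → Table n → Entry n → Bool
  takes alive x o T e = any (T o) λ e₁ →
    extends alive x o e (λ v → proj₁ e₁ v || (S₁ v && adj x v)) e₁

  forget : (Fin n → Bool) → Fin n → Table n → Table n
  forget alive x T o = filt es λ e → omits alive x o T e || takes alive x o T e

  -- The vertices still to be eliminated, the roots of the elimination forest, whose tables no later
  -- vertex has absorbed yet, and the tables.
  Progress : Set
  Progress = (Fin n → Bool) × (Fin n → Bool) × (Fin n → Table n)

  eliminate : Fin n → Progress → Progress
  eliminate x (alive , top , W) =
    (λ v → alive v && neg (v == x)) ,
    (λ c → (c == x) || (top c && neg (adj c x))) ,
    (λ c → if c == x then forget alive x (pull (λ c → top c && adj c x) W) else W c)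

  step : Progress → Progress
  step p = if pick (proj₁ p) == r then p else eliminate (pick (proj₁ p)) p

  finish : Progress
  finish = foldr (λ _ p → step p) ((λ v → neg (S v)) , (λ _ → false) , (λ _ _ → [])) vs

  plausible : Bool
  plausible = S₁ r && (all vs λ v → S₁ v ⇒ S v)
    && (all vs λ u → all vs λ v → (S u && neg (S₁ u)) && (S v && neg (S₁ v)) ⇒ neg (adj u v))

  accepts : Entry n → Bool
  accepts (A , C , q) =
    (all vs λ v → S₁ v ⇒ ((v == r) || C v || any vs λ u → S₁ u && adj v u && rank u <ᵇ rank v))
    && (q + count S₁) ≤ᵇ l

  opaque
    -- Opaque, so that the correctness proofs never unfold the algorithm by accident; only the
    -- comparison with the term looks inside.
    succeeds : Bool
    succeeds = plausible && any (pull (proj₁ (proj₂ finish)) (proj₂ (proj₂ finish)) r) accepts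

    succeeds-def : succeeds ≡ plausible && any (pull (proj₁ (proj₂ finish)) (proj₂ (proj₂ finish)) r) accepts
    succeeds-def = refl

module Decide {n} (adj : Fin n → Fin n → Bool) (S : Fin n → Bool) (l : ℕ) (ks : List ℕ) (xs : List (Fin n)) where

  withRanking : Fin n → (Fin n → Bool) → (Fin n → ℕ) → Bool
  withRanking r S₁ rank =
    Guess.succeeds adj (λ v → S v || (v == r)) S₁ rank (entries (subsets (r ∷ xs))) r l

  withSet : Fin n → (Fin n → Bool) → Bool
  withSet r S₁ = any (rankings ks (r ∷ xs)) (withRanking r S₁)

  accepted : Fin n → Bool
  accepted r = any (subsets (r ∷ xs)) (withSet r)

-- Without vertices there is no root to try, although the empty cover is connected.
decide : ∀ {n} → (Fin n → Fin n → Bool) → (Fin n → Bool) → ℕ → List ℕ → List (Fin n) → Bool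
decide {n} adj S l ks xs = if n ≤ᵇ 0 then true else any (vertices n) (Decide.accepted adj S l ks xs)

members : ∀ {n} → (Fin n → Bool) → List (Fin n)
members S = filt (vertices _) S

-- The language enumerates numbers only as indices of vertices. Nothing is lost, as the ranks needed
-- are below `n` anyway.
smallNumbers : ∀ n → ℕ → List ℕ
smallNumbers n k = concatMap (λ i → if toℕ i ≤ᵇ k then toℕ i ∷ [] else []) (vertices n)

-- The algorithm as a term

private variable
  Γ : Ctx
  σ τ : Ty
  p q : ℕ

pattern #0 = here
pattern #1 = there here
pattern #2 = there (there here)
pattern #3 = there (there (there here))
pattern #4 = there (there (there (there here)))
pattern #5 = there (there (there (there (there here))))
pattern #6 = there (there (there (there (there (there here)))))
pattern #7 = there (there (there (there (there (there (there here))))))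
pattern #8 = there (there (there (there (there (there (there (there here)))))))
pattern #9 = there (there (there (there (there (there (there (there (there here))))))))
pattern #10 = there #9
pattern #12 = there (there #10)
pattern #13 = there #12
pattern #14 = there #13
pattern #15 = there #14

infixr 6 _andᵗ_
infixr 5 _orᵗ_
infixr 4 _impᵗ_

_andᵗ_ _orᵗ_ _impᵗ_ : Tm Γ bool → Tm Γ bool → Tm Γ bool
a andᵗ b = cond a b (op₀ falseᵒ)
a orᵗ b  = cond a (op₀ trueᵒ) b
a impᵗ b = cond a b (op₀ trueᵒ)

notᵗ : Tm Γ bool → Tm Γ bool
notᵗ a = cond a (op₀ falseᵒ) (op₀ trueᵒ)

sucᵗ : Tm Γ nat → Tm Γ nat
sucᵗ a = op₂ addᵒ (op₀ oneᵒ) a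

anyᵗ allᵗ : Tm Γ (list (pow p) σ) → Tm (σ ∷ bool ∷ Γ) bool → Tm Γ bool
anyᵗ l b = fold l (op₀ falseᵒ) (cond b (op₀ trueᵒ) (var #1))
allᵗ l b = fold l (op₀ trueᵒ) (cond b (var #1) (op₀ falseᵒ))

filtᵗ : Tm Γ (list (pow p) σ) → Tm (σ ∷ Γ) bool → Tm Γ (list (pow (p + 0)) σ)
filtᵗ l b = forl l (cond b (op₁ singleᵒ (var #0)) (op₀ nilᵒ))

set entry table : Ty
set   = arr bool
entry = set ⊗ set ⊗ nat
table = arr (list (pow 3) entry)

infix 9 _at_ _at₂_

_at_ : Γ ∋ arr σ → Γ ∋ idx → Tm Γ σ
f at v = get (var f) (var v)

_at₂_ : Γ ∋ arr (arr σ) → (Γ ∋ idx) × (Γ ∋ idx) → Tm Γ σ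
f at₂ (u , v) = get (get (var f) (var u)) (var v)

_==ᵗ_ : Γ ∋ idx → Γ ∋ idx → Tm Γ bool
u ==ᵗ v = op₂ eqiᵒ (var u) (var v)

-- Holding variables instead of terms reduces weakening to `there`. `rng` is meant to be the
-- identity array: since `mapi` only transforms a given array, it is the source of the list of
-- vertices and of everything built by `tabᵗ`.
record Scope (Γ : Ctx) : Set where
  field
    rng      : Γ ∋ arr idx
    adj      : Γ ∋ arr (arr bool)
    S S₁     : Γ ∋ set
    rank     : Γ ∋ arr nat
    es       : Γ ∋ list (pow 3) entry
    root     : Γ ∋ idx
    lim      : Γ ∋ nat

↑ : Scope Γ → Scope (σ ∷ Γ)
↑ s = record { rng = there rng ; adj = there adj ; S = there S ; S₁ = there S₁ ; rank = there rank
             ; es = there es ; root = there root ; lim = there lim }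
  where open Scope s

↑₂ : Scope Γ → Scope (σ ∷ τ ∷ Γ)
↑₂ s = ↑ (↑ s)

vsᵗ : Scope Γ → Tm Γ (list (pow 1) idx)
vsᵗ s = op₁ toListᵒ (var (Scope.rng s))

tabᵗ : Scope Γ → Tm (idx ∷ idx ∷ Γ) σ → Tm Γ (arr σ)
tabᵗ s b = mapi (var (Scope.rng s)) b

there₂ : ∀ {C} → Γ ∋ σ → τ ∷ C ∷ Γ ∋ σ
there₂ x = there (there x)

there₄ : ∀ {C D E} → Γ ∋ σ → τ ∷ C ∷ D ∷ E ∷ Γ ∋ σ
there₄ x = there₂ (there₂ x)

simplicialᵗ : Scope Γ → Γ ∋ set → Γ ∋ idx → Tm Γ bool
simplicialᵗ s alive v = allᵗ (vsᵗ s) (allᵗ (vsᵗ (↑₂ s))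
  ((there₄ alive at #2) andᵗ (there₄ alive at #0) andᵗ (Scope.adj (↑₂ (↑₂ s)) at₂ (there₄ v , #2))
   andᵗ (Scope.adj (↑₂ (↑₂ s)) at₂ (there₄ v , #0)) andᵗ notᵗ (#2 ==ᵗ #0)
   impᵗ (Scope.adj (↑₂ (↑₂ s)) at₂ (#2 , #0))))

pickᵗ : Scope Γ → Γ ∋ set → Tm Γ idx
pickᵗ s alive = fold (vsᵗ s) (var (Scope.root s))
  (cond ((there₂ alive at #0) andᵗ simplicialᵗ (↑₂ s) (there₂ alive) #0) (var #0) (var #1))

setA setC : Γ ∋ entry → Tm Γ idx → Tm Γ bool
setA e v = get (op₁ fstᵒ (var e)) v
setC e v = get (op₁ fstᵒ (op₁ sndᵒ (var e))) v

cost : Γ ∋ entry → Tm Γ nat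
cost e = op₁ sndᵒ (op₁ sndᵒ (var e))

startᵗ : Scope Γ → Tm Γ table
startᵗ s = tabᵗ s (filtᵗ (var (Scope.es (↑₂ s))) (allᵗ (vsᵗ (↑ (↑₂ s)))
  (notᵗ (setA #2 (var #0)) andᵗ notᵗ (setC #2 (var #0)))))

joinsᵗ : Scope Γ → Γ ∋ entry → Γ ∋ entry → Γ ∋ entry → Tm Γ bool
joinsᵗ s e e₁ e₂ =
  allᵗ (vsᵗ s)
    ((setA (there₂ e) (var #0) impᵗ (setA (there₂ e₁) (var #0) orᵗ setA (there₂ e₂) (var #0)))
     andᵗ (setC (there₂ e) (var #0) impᵗ (setC (there₂ e₁) (var #0) orᵗ setC (there₂ e₂) (var #0))))
  andᵗ op₂ leqᵒ (op₂ addᵒ (cost e₁) (cost e₂)) (cost e)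

mergeᵗ : Scope Γ → Γ ∋ table → Tm Γ table → Tm Γ table
mergeᵗ {Γ} s X Y = lett Y (tabᵗ (↑ s) (filtᵗ (var (Scope.es (↑₂ (↑ s))))
  (anyᵗ (there (there₂ (there X)) at #2)
    (anyᵗ (there₂ (there (there₂ #0)) at #4)
      (joinsᵗ (↑₂ (↑₂ (↑ (↑₂ (↑ s))))) #4 #2 #0)))))

pullᵗ : Scope Γ → Tm Γ set → Γ ∋ arr table → Tm Γ table
pullᵗ s ch W = lett ch (fold (vsᵗ (↑ s)) (startᵗ (↑ s))
  (cond (#2 at #0) (mergeᵗ (↑₂ (↑ s)) #1 (there₂ (there W) at #0)) (var #1)))

omitsᵗ : Scope Γ → Γ ∋ set → Γ ∋ idx → Γ ∋ idx → Γ ∋ table → Γ ∋ entry → Tm Γ bool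
omitsᵗ s alive x o T e =
  allᵗ (vsᵗ s) ((Scope.S (↑₂ s) at #0) andᵗ notᵗ (Scope.S₁ (↑₂ s) at #0)
                impᵗ notᵗ (Scope.adj (↑₂ s) at₂ (there₂ x , #0)))
  andᵗ notᵗ ((alive at o) andᵗ (Scope.adj s at₂ (x , o)))
  andᵗ anyᵗ (T at x)
    (allᵗ (vsᵗ (↑₂ s)) ((setA (there₄ e) (var #0) impᵗ setA #2 (var #0))
                        andᵗ (setC (there₄ e) (var #0) impᵗ setC #2 (var #0)))
     andᵗ op₂ leqᵒ (cost #0) (cost (there₂ e)))

ltᵗ : Scope Γ → Γ ∋ idx → Γ ∋ idx → Tm Γ bool
ltᵗ s u v = op₂ leqᵒ (sucᵗ (Scope.rank s at u)) (Scope.rank s at v)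

linkableᵗ : Scope Γ → Γ ∋ set → Γ ∋ idx → Tm Γ bool
linkableᵗ s A v = (A at v) andᵗ anyᵗ (vsᵗ s) ((there₂ A at #0) andᵗ ltᵗ (↑₂ s) #0 (there₂ v))

extendsᵗ : Scope Γ → Γ ∋ set → Γ ∋ idx → Γ ∋ idx → Γ ∋ entry → Γ ∋ set → Γ ∋ entry → Tm Γ bool
extendsᵗ s alive x o e A⁺ e₁ =
  allᵗ (vsᵗ s) (setC (there₂ e) (var #0)
                impᵗ (setC (there₂ e₁) (var #0) orᵗ linkableᵗ (↑₂ s) (there₂ A⁺) #0))
  andᵗ op₂ leqᵒ (sucᵗ (cost e₁)) (cost e)
  andᵗ ((anyᵗ (vsᵗ s) ((there₂ alive at #0) andᵗ (Scope.adj (↑₂ s) at₂ (there₂ x , #0))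
                       andᵗ notᵗ (#0 ==ᵗ there₂ o))
         andᵗ allᵗ (vsᵗ s) (setA (there₂ e) (var #0) impᵗ (there₂ A⁺ at #0)))
        orᵗ (anyᵗ (vsᵗ s) (there₂ A⁺ at #0) andᵗ allᵗ (vsᵗ s) (notᵗ (setA (there₂ e) (var #0)))))

takesᵗ : Scope Γ → Γ ∋ set → Γ ∋ idx → Γ ∋ idx → Γ ∋ table → Γ ∋ entry → Tm Γ bool
takesᵗ s alive x o T e = anyᵗ (T at o)
  (lett (tabᵗ (↑₂ s) (setA #2 (var #1)
                      orᵗ ((Scope.S₁ (↑₂ (↑₂ s)) at #1) andᵗ (Scope.adj (↑₂ (↑₂ s)) at₂ (there₄ x , #1)))))
    (extendsᵗ (↑ (↑₂ s)) (there (there₂ alive)) (there (there₂ x)) (there (there₂ o)) (there (there₂ e)) #0 #1))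

forgetᵗ : Scope Γ → Γ ∋ set → Γ ∋ idx → Γ ∋ table → Tm Γ table
forgetᵗ s alive x T = tabᵗ s (filtᵗ (var (Scope.es (↑₂ s)))
  (omitsᵗ (↑ (↑₂ s)) (there (there₂ alive)) (there (there₂ x)) #2 (there (there₂ T)) #0
   orᵗ takesᵗ (↑ (↑₂ s)) (there (there₂ alive)) (there (there₂ x)) #2 (there (there₂ T)) #0))

progress : Ty
progress = set ⊗ set ⊗ arr table

eliminateᵗ : Scope Γ → Γ ∋ idx → Γ ∋ progress → Tm Γ progress
eliminateᵗ s x p =
  lett (op₁ fstᵒ (var p)) (lett (op₁ fstᵒ (op₁ sndᵒ (var (there p)))) (lett (op₁ sndᵒ (op₁ sndᵒ (var (there₂ p))))
  (lett (pullᵗ s₃ (tabᵗ s₃ ((#3 at #1) andᵗ (Scope.adj (↑₂ s₃) at₂ (#1 , there₂ x₃)))) #0)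
    (op₂ pairᵒ (tabᵗ s₄ ((#5 at #1) andᵗ notᵗ (#1 ==ᵗ there₂ x₄)))
    (op₂ pairᵒ (tabᵗ s₄ ((#1 ==ᵗ there₂ x₄) orᵗ (#4 at #1) andᵗ notᵗ (Scope.adj (↑₂ s₄) at₂ (#1 , there₂ x₄))))
              (tabᵗ s₄ (cond (#1 ==ᵗ there₂ x₄) (forgetᵗ (↑₂ s₄) #5 (there₂ x₄) #2) (#3 at #1))))))))
  where
  s₃ : Scope _
  s₃ = ↑ (↑₂ s)
  s₄ : Scope _
  s₄ = ↑ s₃
  x₃ : _ ∋ _
  x₃ = there (there₂ x)
  x₄ : _ ∋ _
  x₄ = there x₃

stepᵗ : Scope Γ → Γ ∋ progress → Tm Γ progress
stepᵗ s p = lett (op₁ fstᵒ (var p)) (lett (pickᵗ (↑ s) #0)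
  (cond (#0 ==ᵗ Scope.root (↑₂ s)) (var (there₂ p)) (eliminateᵗ (↑₂ s) #0 (there₂ p))))

finishᵗ : Scope Γ → Tm Γ progress
finishᵗ s = fold (vsᵗ s)
  (op₂ pairᵒ (tabᵗ s (notᵗ (Scope.S (↑₂ s) at #1)))
    (op₂ pairᵒ (tabᵗ s (op₀ falseᵒ)) (tabᵗ s (tabᵗ (↑₂ s) (op₀ nilᵒ)))))
  (stepᵗ (↑₂ s) #1)

plausibleᵗ : Scope Γ → Tm Γ bool
plausibleᵗ s =
  (Scope.S₁ s at Scope.root s)
  andᵗ allᵗ (vsᵗ s) ((Scope.S₁ (↑₂ s) at #0) impᵗ (Scope.S (↑₂ s) at #0))
  andᵗ allᵗ (vsᵗ s) (allᵗ (vsᵗ (↑₂ s))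
    (((Scope.S s₄ at #2) andᵗ notᵗ (Scope.S₁ s₄ at #2)) andᵗ ((Scope.S s₄ at #0) andᵗ notᵗ (Scope.S₁ s₄ at #0))
     impᵗ notᵗ (Scope.adj s₄ at₂ (#2 , #0))))
  where
  s₄ : Scope _
  s₄ = ↑₂ (↑₂ s)

countᵗ : Scope Γ → Γ ∋ set → Tm Γ nat
countᵗ s U = fold (vsᵗ s) (op₀ zeroᵒ) (cond (there₂ U at #0) (sucᵗ (var #1)) (var #1))

acceptsᵗ : Scope Γ → Γ ∋ entry → Tm Γ bool
acceptsᵗ s e =
  allᵗ (vsᵗ s) ((Scope.S₁ (↑₂ s) at #0)
    impᵗ ((#0 ==ᵗ Scope.root (↑₂ s)) orᵗ setC (there₂ e) (var #0)
      orᵗ anyᵗ (vsᵗ (↑₂ s)) ((Scope.S₁ s₄ at #0) andᵗ (Scope.adj s₄ at₂ (#2 , #0)) andᵗ ltᵗ s₄ #0 #2)))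
  andᵗ op₂ leqᵒ (op₂ addᵒ (cost e) (countᵗ s (Scope.S₁ s))) (var (Scope.lim s))
  where
  s₄ : Scope _
  s₄ = ↑₂ (↑₂ s)

succeedsᵗ : Scope Γ → Tm Γ bool
succeedsᵗ s = plausibleᵗ s andᵗ
  lett (finishᵗ s) (lett (op₁ sndᵒ (op₁ sndᵒ (var #0)))
    (anyᵗ (get (pullᵗ (↑₂ s) (op₁ fstᵒ (op₁ sndᵒ (var #1))) #0) (var (Scope.root (↑₂ s))))
      (acceptsᵗ (↑₂ (↑₂ s)) #0)))

context : Ctx
context = list loose nat ∷ list tight idx ∷ arr idx ∷ arr (arr bool) ∷ set ∷ nat ∷ dim ∷ []

updateᵗ : Γ ∋ arr idx → Γ ∋ σ → Γ ∋ arr σ → Γ ∋ idx → Tm Γ (arr σ)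
updateᵗ rng y f x = mapi (var rng) (cond (#1 ==ᵗ there₂ x) (var (there₂ y)) (there₂ f at #1))

decideᵗ : Tm context bool
decideᵗ = cond (op₂ leqᵒ (op₁ sizeᵒ (var #6)) (op₀ zeroᵒ)) (op₀ trueᵒ)
  (anyᵗ (op₁ toListᵒ (var #2))
    (lett (op₂ consᵒ (var #0) (var #3))
    (lett (grow (var #0) (op₀ boolsᵒ) (mapi (var #5) (op₀ falseᵒ)) (updateᵗ #9 #0 #1 #2))
    (lett (mapi (var #6) ((#10 at #1) orᵗ (#1 ==ᵗ #4)))
    (lett (forl (var #1) (forl (var #2) (forl (op₁ toListᵒ (var #9))
            (op₁ singleᵒ (op₂ pairᵒ (var #2) (op₂ pairᵒ (var #1) (op₁ toNatᵒ (var #0))))))))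
    (anyᵗ (var #2)
    (anyᵗ (grow (var #5) (var #8) (mapi (var #10) (op₀ zeroᵒ)) (updateᵗ #14 #0 #1 #2))
      (succeedsᵗ (record { rng = #12 ; adj = #13 ; S = #5 ; S₁ = #2 ; rank = #0
                         ; es = #4 ; root = #8 ; lim = #15 })))))))))

opaque
  unfolding Guess.succeeds

  decide-sem : ∀ {n} adj S l ks xs →
               sem {n = n} decideᵗ (ks , xs , (λ i → i) , adj , S , l , tt , tt) ≡ decide adj S l ks xs
  decide-sem adj S l ks xs = refl

-- Counting and Boolean reflection

does⇒ : ∀ {P : Set} (d : Dec P) → does d ≡ true → P
does⇒ (yes p) _ = p

true≢false : ∀ {A : Set} {b : Bool} → b ≡ true → b ≡ false → A
true≢false refl ()

toℕ₂ : Bool → ℕ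
toℕ₂ b = if b then 1 else 0

-- The tail of `vertices (suc n)` is not of the form `vertices n`; moving the shift from the list
-- into the predicate is what permits induction on `n`.
count-fold : ∀ {n m} (f : Fin m → Bool) (g : Fin n → Fin m) →
             foldr (λ v acc → if f v then 1 + acc else acc) 0 (List.tabulate g) ≡ count (f ∘ g)
count-fold {zero}  f g = refl
count-fold {suc n} f g =
  cong₂ (λ x y → if f (g zero) then suc x else y) eq eq
  where eq = trans (count-fold f (g ∘ suc)) (sym (count-fold (f ∘ g) suc))

count-suc : ∀ {n} (f : Fin (suc n) → Bool) → count f ≡ toℕ₂ (f zero) + count (f ∘ suc)
count-suc f with f zero
... | true  = cong suc (count-fold f suc)
... | false = count-fold f suc

count-≤ : ∀ {n} {f g : Fin n → Bool} → (∀ v → f v ≡ true → g v ≡ true) → count f ≤ count g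
count-≤ {zero} imp = z≤n
count-≤ {suc n} {f} {g} imp rewrite count-suc f | count-suc g =
  +-mono-≤ (go (f zero) (g zero) (imp zero)) (count-≤ (λ v → imp (suc v)))
  where
  go : ∀ a b → (a ≡ true → b ≡ true) → toℕ₂ a ≤ toℕ₂ b
  go false b p = z≤n
  go true  b p rewrite p refl = ≤-refl

count-cong : ∀ {n} {f g : Fin n → Bool} → (∀ v → f v ≡ g v) → count f ≡ count g
count-cong eq = ≤-antisym (count-≤ λ v p → trans (sym (eq v)) p) (count-≤ λ v p → trans (eq v) p)

count-disjoint : ∀ {n} {f g h : Fin n → Bool} → (∀ v → toℕ₂ (h v) ≡ toℕ₂ (f v) + toℕ₂ (g v)) →
                 count h ≡ count f + count g
count-disjoint {zero} eq = refl
count-disjoint {suc n} {f} {g} {h} eq rewrite count-suc f | count-suc g | count-suc h = begin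
  toℕ₂ (h zero) + count (h ∘ suc)      ≡⟨ cong₂ _+_ (eq zero) (count-disjoint {f = f ∘ suc} {g ∘ suc} (λ v → eq (suc v))) ⟩
  (a + b) + (c + d)                    ≡⟨ +-assoc a b (c + d) ⟩
  a + (b + (c + d))                    ≡⟨ cong (a +_) (+-assoc b c d) ⟨
  a + ((b + c) + d)                    ≡⟨ cong (λ x → a + (x + d)) (+-comm b c) ⟩
  a + ((c + b) + d)                    ≡⟨ cong (a +_) (+-assoc c b d) ⟩
  a + (c + (b + d))                    ≡⟨ +-assoc a c (b + d) ⟨
  (a + c) + (b + d)                    ∎
  where
  open ≡-Reasoning
  a = toℕ₂ (f zero)
  b = toℕ₂ (g zero)
  c = count (f ∘ suc)
  d = count (g ∘ suc)

count-none : ∀ {n} {f : Fin n → Bool} → (∀ v → f v ≡ false) → count f ≡ 0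
count-none {zero} eq = refl
count-none {suc n} {f} eq rewrite count-suc f | eq zero = count-none (λ v → eq (suc v))

count-all : ∀ n → count {n} (λ _ → true) ≡ n
count-all zero    = refl
count-all (suc n) = trans (count-suc {n} (λ _ → true)) (cong suc (count-all n))

count-< : ∀ {n} {f g : Fin n → Bool} → (∀ v → f v ≡ true → g v ≡ true) →
          ∀ {x} → f x ≡ false → g x ≡ true → count f < count g
count-< {suc n} {f} {g} imp {zero} fx gx rewrite count-suc f | count-suc g | fx | gx =
  s≤s (count-≤ (λ v → imp (suc v)))
count-< {suc n} {f} {g} imp {suc x} fx gx rewrite count-suc f | count-suc g =
  ≤-trans (≤-reflexive (sym (+-suc (toℕ₂ (f zero)) _)))
    (+-mono-≤ (go (f zero) (g zero) (imp zero)) (count-< (λ v → imp (suc v)) fx gx))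
  where
  go : ∀ a b → (a ≡ true → b ≡ true) → toℕ₂ a ≤ toℕ₂ b
  go false b p = z≤n
  go true  b p rewrite p refl = ≤-refl

count-single : ∀ {n} {f : Fin n → Bool} x → f x ≡ true → (∀ v → f v ≡ true → v ≡ x) → count f ≡ 1
count-single {suc n} {f} zero fx only rewrite count-suc f | fx = cong suc (count-none go)
  where
  go : ∀ v → f (suc v) ≡ false
  go v with f (suc v) in eq
  ... | false = refl
  ... | true  with () ← only (suc v) eq
count-single {suc n} {f} (suc x) fx only with f zero in eq
... | true  with () ← only zero eq
... | false = trans (count-fold f suc) (count-single x fx λ v p → go (only (suc v) p))
  where
  go : ∀ {a b : Fin n} → suc a ≡ suc b → a ≡ b
  go refl = refl

count-∣∣ : ∀ {n} (T : Subset n) → count (Vec.lookup T) ≡ ∣ T ∣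
count-∣∣ []            = refl
count-∣∣ (inside  ∷ T) = trans (count-suc (Vec.lookup (inside ∷ T))) (cong suc (count-∣∣ T))
count-∣∣ (outside ∷ T) = trans (count-suc (Vec.lookup (outside ∷ T))) (count-∣∣ T)

infix 3 Is
Is : Bool → Set
Is b = b ≡ true

&&⁻ : ∀ {a b} → Is (a && b) → Is a × Is b
&&⁻ {true} p = refl , p

&&⁺ : ∀ {a b} → Is a → Is b → Is (a && b)
&&⁺ refl q = q

||⁻ : ∀ {a b} → Is (a || b) → Is a ⊎ Is b
||⁻ {true}  p = inj₁ refl
||⁻ {false} p = inj₂ p

||⁺ˡ : ∀ {a b} → Is a → Is (a || b)
||⁺ˡ refl = refl

||⁺ʳ : ∀ {a b} → Is b → Is (a || b)
||⁺ʳ {true}  q = refl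
||⁺ʳ {false} q = q

⇒⁻ : ∀ {a b} → Is (a ⇒ b) → Is a → Is b
⇒⁻ p refl = p

⇒⁺ : ∀ {a b} → (Is a → Is b) → Is (a ⇒ b)
⇒⁺ {true}  p = p refl
⇒⁺ {false} p = refl

neg⁻ : ∀ {a} → Is (neg a) → a ≡ false
neg⁻ {false} p = refl

neg⁺ : ∀ {a} → a ≡ false → Is (neg a)
neg⁺ refl = refl

¬Is⇒false : ∀ {a} → ¬ Is a → a ≡ false
¬Is⇒false {true}  p = contradiction refl p
¬Is⇒false {false} p = refl

false⇒¬Is : ∀ {a} → a ≡ false → ¬ Is a
false⇒¬Is refl ()

bool-ext : ∀ {a b} → (Is a → Is b) → (Is b → Is a) → a ≡ b
bool-ext {true}          p q = sym (p refl)
bool-ext {false} {true}  p q = q refl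
bool-ext {false} {false} p q = refl

isZero⁻ : ∀ {k} → Is (isZero k) → k ≡ 0
isZero⁻ {zero} p = refl

isZero⁺ : ∀ {k} → k ≡ 0 → Is (isZero k)
isZero⁺ refl = refl

≤ᵇ⁻ : ∀ {a b} → Is (a ≤ᵇ b) → a ≤ b
≤ᵇ⁻ p = m∸n≡0⇒m≤n (isZero⁻ p)

≤ᵇ⁺ : ∀ {a b} → a ≤ b → Is (a ≤ᵇ b)
≤ᵇ⁺ p = isZero⁺ (m≤n⇒m∸n≡0 p)

==⁻ : ∀ {n} {i j : Fin n} → Is (i == j) → i ≡ j
==⁻ {i = i} {j} p = toℕ-injective (≤-antisym
  (m∸n≡0⇒m≤n (m+n≡0⇒m≡0 _ (isZero⁻ p)))
  (m∸n≡0⇒m≤n (m+n≡0⇒n≡0 (toℕ i ∸ toℕ j) (isZero⁻ p))))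

==⁺ : ∀ {n} {i j : Fin n} → i ≡ j → Is (i == j)
==⁺ {i = i} refl = isZero⁺ (cong₂ _+_ {v = 0} (m≤n⇒m∸n≡0 (≤-refl {toℕ i})) (m≤n⇒m∸n≡0 (≤-refl {toℕ i})))

≠⁻ : ∀ {n} {i j : Fin n} → (i == j) ≡ false → i ≢ j
≠⁻ p eq = true≢false (==⁺ eq) p

≠⁺ : ∀ {n} {i j : Fin n} → i ≢ j → (i == j) ≡ false
≠⁺ p = ¬Is⇒false λ q → p (==⁻ q)

any⁻ : ∀ {A : Set} (xs : List A) {p} → Is (any xs p) → ∃[ x ] x ∈ xs × Is (p x)
any⁻ (x ∷ xs) {p} q with p x in eq
... | true  = x , here refl , eq
... | false = let y , y∈ , py = any⁻ xs q in y , there y∈ , py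

any⁺ : ∀ {A : Set} {xs : List A} {p x} → x ∈ xs → Is (p x) → Is (any xs p)
any⁺ (here refl) px rewrite px = refl
any⁺ {xs = y ∷ _} {p} (there x∈) px with p y
... | true  = refl
... | false = any⁺ x∈ px

all⁻ : ∀ {A : Set} {xs : List A} {p} → Is (all xs p) → ∀ {x} → x ∈ xs → Is (p x)
all⁻ {xs = y ∷ _} {p} q x∈ with p y in eq
all⁻ q (here refl) | true = eq
all⁻ q (there x∈)  | true = all⁻ q x∈

all⁺ : ∀ {A : Set} (xs : List A) {p} → (∀ x → Is (p x)) → Is (all xs p)
all⁺ []       q = refl
all⁺ (x ∷ xs) q rewrite q x = all⁺ xs q

∈-vertices : ∀ {n} (v : Fin n) → v ∈ vertices n
∈-vertices v = ∈-tabulate⁺ v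

anyV⁻ : ∀ {n} {p : Fin n → Bool} → Is (any (vertices n) p) → ∃[ v ] Is (p v)
anyV⁻ {n} q = let v , _ , pv = any⁻ (vertices n) q in v , pv

anyV⁺ : ∀ {n} {p : Fin n → Bool} v → Is (p v) → Is (any (vertices n) p)
anyV⁺ v = any⁺ (∈-vertices v)

allV⁻ : ∀ {n} {p : Fin n → Bool} → Is (all (vertices n) p) → ∀ v → Is (p v)
allV⁻ q v = all⁻ q (∈-vertices v)

allV⁺ : ∀ {n} {p : Fin n → Bool} → (∀ v → Is (p v)) → Is (all (vertices n) p)
allV⁺ {n} = all⁺ (vertices n)

filt⁻ : ∀ {A : Set} (xs : List A) {p x} → x ∈ filt xs p → x ∈ xs × Is (p x)
filt⁻ (y ∷ xs) {p} x∈ with p y in eq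
filt⁻ (y ∷ xs) (here refl) | true  = here refl , eq
filt⁻ (y ∷ xs) (there x∈)  | true  = let x∈′ , px = filt⁻ xs x∈ in there x∈′ , px
filt⁻ (y ∷ xs) x∈          | false = let x∈′ , px = filt⁻ xs x∈ in there x∈′ , px

filt⁺ : ∀ {A : Set} {xs : List A} {p x} → x ∈ xs → Is (p x) → x ∈ filt xs p
filt⁺ {xs = y ∷ _} (here refl) px rewrite px = here refl
filt⁺ {xs = y ∷ _} {p} (there x∈) px with p y
... | true  = there (filt⁺ x∈ px)
... | false = filt⁺ x∈ px

-- The function sought occurs in the list only up to pointwise agreement. For this reason all later
-- statements compare sets and rankings pointwise.
growList-complete : ∀ {n} {A : Set} (ks : List A) (z : A) (f : Fin n → A) (xs : List (Fin n)) →
  (∀ {v} → v ∈ xs → f v ∈ ks) →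
  ∃[ g ] g ∈ growList update ks (λ _ → z) xs × (∀ v → (v ∈ xs × g v ≡ f v) ⊎ (¬ v ∈ xs × g v ≡ z))
growList-complete ks z f [] f∈ = (λ _ → z) , here refl , λ v → inj₂ ((λ ()) , refl)
growList-complete ks z f (x ∷ xs) f∈ with growList-complete ks z f xs (λ v∈ → f∈ (there v∈))
... | g , g∈ , g≡ = update (f x) g x ,
  ∈-concatMap⁺ (λ c → List.map (λ b → update b c x) ks)
    (lose g∈ (∈-map⁺ (λ b → update b g x) (f∈ (here refl)))) , agree
  where
  agree : ∀ v → (v ∈ x ∷ xs × update (f x) g x v ≡ f v) ⊎ (¬ v ∈ x ∷ xs × update (f x) g x v ≡ z)
  agree v with v == x in eq
  ... | true  with refl ← ==⁻ {i = v} {x} eq = inj₁ (here refl , refl)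
  ... | false with g≡ v
  ...   | inj₁ (v∈ , e) = inj₁ (there v∈ , e)
  ...   | inj₂ (v∉ , e) = inj₂ ((λ { (here v≡x) → ≠⁻ eq v≡x ; (there v∈) → v∉ v∈ }) , e)

subsets-complete : ∀ {n} (f : Fin n → Bool) (xs : List (Fin n)) → (∀ v → Is (f v) → v ∈ xs) →
                   ∃[ g ] g ∈ subsets xs × (∀ v → g v ≡ f v)
subsets-complete f xs f⊆ with growList-complete (false ∷ true ∷ []) false f xs (λ {v} _ → bool∈ (f v))
  where
  bool∈ : ∀ b → b ∈ false ∷ true ∷ []
  bool∈ false = here refl
  bool∈ true  = there (here refl)
... | g , g∈ , g≡ = g , g∈ , λ v → go v (g≡ v)
  where
  go : ∀ v → (v ∈ xs × g v ≡ f v) ⊎ (¬ v ∈ xs × g v ≡ false) → g v ≡ f v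
  go v (inj₁ (_ , eq)) = eq
  go v (inj₂ (v∉ , eq)) = trans eq (sym (¬Is⇒false λ fv → v∉ (f⊆ v fv)))

entries-complete : ∀ {n} {Us : List (Fin n → Bool)} {A C} → A ∈ Us → C ∈ Us → ∀ (i : Fin n) →
                   (A , C , toℕ i) ∈ entries Us
entries-complete A∈ C∈ i =
  ∈-concatMap⁺ _ (lose A∈ (∈-concatMap⁺ _ (lose C∈ (∈-concatMap⁺ _ (lose (∈-vertices i) (here refl))))))

-- Simplicial vertices of chordal graphs

module InducedPaths {n} (G : Graph (Fin n)) where
  open Graph G

  irrefl : ∀ {x} → ¬ x ~ x
  irrefl = ~-irrefl refl

  -- The path is x ∷ xs, and t is its last vertex.
  data InducedPath : Fin n → List (Fin n) → Fin n → Set where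
    end  : ∀ {t} → InducedPath t [] t
    step : ∀ {x y zs t} → x ~ y → All (λ z → ¬ x ~ z × x ≢ z) zs →
           InducedPath y zs t → InducedPath x (y ∷ zs) t

  -- Used contrapositively in `prepend`: a vertex other than `t` without neighbours among `zs`
  -- cannot lie on the path itself.
  successor : ∀ {x y zs t} → InducedPath y zs t → x ∈ y ∷ zs → x ≢ t → Any (x ~_) zs
  successor end            (here refl) x≢t = contradiction refl x≢t
  successor (step y~ _ p)  (here refl) x≢t = here y~
  successor (step _ _ p)   (there x∈)  x≢t = there (successor p x∈ x≢t)

  -- Shortcutting at the last neighbour of x keeps the path induced.
  prepend : ∀ {x y zs t} {P : Fin n → Set} → x ≢ t → InducedPath y zs t → All P (y ∷ zs) →
            Any (x ~_) (y ∷ zs) → ∃[ zs′ ] InducedPath x zs′ t × All P zs′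
  prepend {x} {zs = zs} x≢t p ps a with Any.any? (x ~?_) zs
  prepend x≢t (step _ _ p) (_ ∷ ps) _ | yes a = prepend x≢t p ps a
  prepend {x} {zs = zs} x≢t p ps (here x~y) | no ¬a =
    _ , step x~y (All.tabulate λ {z} z∈ →
      (λ x~z → ¬a (Any.map (λ { refl → x~z }) z∈)) ,
      (λ { refl → ¬a (successor p (there z∈) x≢t) })) p , ps
  prepend x≢t p ps (there a) | no ¬a = contradiction a ¬a

  consecutive : ∀ {x xs t} → InducedPath x xs t → let l = List.lookup (x ∷ xs) in
                ∀ i j → suc (toℕ i) ≡ toℕ j → l i ~ l j
  consecutive (step x~y _ p) zero    (suc zero) eq = x~y
  consecutive (step x~y _ p) (suc i) (suc j)    eq = consecutive p i j (suc-injective eq)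

  chordless : ∀ {x xs t} → InducedPath x xs t → let l = List.lookup (x ∷ xs) in
              ∀ i j → toℕ i < toℕ j → l i ~ l j → suc (toℕ i) ≡ toℕ j
  chordless (step _ _ p)  zero    (suc zero)    _       _  = refl
  chordless (step _ as p) zero    (suc (suc j)) _       e  =
    contradiction e (proj₁ (All.lookup as (∈-lookup j)))
  chordless (step _ _ p)  (suc i) (suc j)       (s≤s le) e = cong suc (chordless p i j le e)

  distinct : ∀ {x xs t} → InducedPath x xs t → let l = List.lookup (x ∷ xs) in
             ∀ i j → toℕ i < toℕ j → l i ≢ l j
  distinct (step x~y _ p) zero    (suc zero)    _        refl = irrefl x~y
  distinct (step _ as p)  zero    (suc (suc j)) _        eq   = proj₂ (All.lookup as (∈-lookup j)) eq
  distinct (step _ _ p)   (suc i) (suc j)       (s≤s le) eq   = distinct p i j le eq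

  last-≡ : ∀ {x xs t} → InducedPath x xs t → ∀ i → toℕ i ≡ length xs → List.lookup (x ∷ xs) i ≡ t
  last-≡ end          zero    eq = refl
  last-≡ (step _ _ p) (suc i) eq = last-≡ p i (suc-injective eq)

  last-only : ∀ {x xs t} → InducedPath x xs t → ∀ i → List.lookup (x ∷ xs) i ≡ t → toℕ i ≡ length xs
  last-only end          zero    eq = refl
  last-only {xs = _ ∷ zs} (step a b p) zero eq =
    contradiction (trans eq (sym (last-≡ p (fromℕ (length zs)) (toℕ-fromℕ (length zs)))))
                  (distinct (step a b p) zero (suc (fromℕ (length zs))) (s≤s z≤n))
  last-only (step _ _ p) (suc i) eq = cong suc (last-only p i eq)

  module _ {S : Subset n} (chordal : ChordalDeletionSet G S) where

    -- The path closes through `v` into a cycle. Its length is at least 4, since `s` and `t` are not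
    -- adjacent and so have a vertex between them. It has no chord, since the path is induced and
    -- `v` sees only its two ends.
    no-hole : ∀ {v s x xs t} → InducedPath s (x ∷ xs) t → v ∈ˢ ∁ S → s ∈ˢ ∁ S → All (_∈ˢ ∁ S) (x ∷ xs) →
              ¬ s ~ t → v ~ s → v ~ t → All (λ z → (v ≢ z × ¬ v ~ z) ⊎ z ≡ t) (x ∷ xs) → ⊥
    no-hole (step s~x _ end) _ _ _ s≁t _ _ _ = s≁t s~x
    no-hole {v} {s} {x} {y ∷ xs} {t} p@(step _ _ (step _ _ _)) v∈ s∈ zs∈ s≁t v~s v~t far =
      let i , j , ¬ij , ¬ji , e = chordal {k} (s≤s (s≤s (s≤s (s≤s z≤n)))) cycle in go i j ¬ij ¬ji e
      where
      path = s ∷ x ∷ y ∷ xs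
      l    = List.lookup (v ∷ path)
      k    = length (v ∷ path)
      v≢   : ∀ i → v ≢ List.lookup path i
      v≢ zero    refl = irrefl v~s
      v≢ (suc i) eq with All.lookup far (∈-lookup i)
      ... | inj₁ (v≢z , _) = v≢z eq
      ... | inj₂ z≡t       = irrefl (subst (v ~_) (sym (trans eq z≡t)) v~t)
      v~⇒ : ∀ i → v ~ List.lookup path i → i ≡ zero ⊎ suc (toℕ i) ≡ length path
      v~⇒ zero    e = inj₁ refl
      v~⇒ (suc i) e with All.lookup far (∈-lookup i)
      ... | inj₁ (_ , v≁z) = contradiction e v≁z
      ... | inj₂ z≡t       = inj₂ (cong suc (last-only p (suc i) z≡t))
      inj : ∀ i j → l i ≡ l j → i ≡ j
      inj zero    zero    eq = refl
      inj zero    (suc j) eq = contradiction eq (v≢ j)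
      inj (suc i) zero    eq = contradiction (sym eq) (v≢ i)
      inj (suc i) (suc j) eq with <-cmp (toℕ i) (toℕ j)
      ... | tri< lt _ _ = contradiction eq (distinct p i j lt)
      ... | tri≈ _ e _  = cong suc (toℕ-injective e)
      ... | tri> _ _ lt = contradiction (sym eq) (distinct p j i lt)
      edge : ∀ i j → Next i j → l i ~ l j
      edge zero    (suc zero) (inj₁ eq) = v~s
      edge (suc i) (suc j)    (inj₁ eq) = consecutive p i j (suc-injective eq)
      edge (suc i) zero       (inj₂ (eq , _)) =
        subst (_~ v) (sym (last-≡ p i (suc-injective (suc-injective eq)))) (~-sym v~t)
      cycle : Cycle (G ─ S) k
      cycle = record
        { vertex    = λ i → l i , All.lookup (v∈ ∷ s∈ ∷ zs∈) (∈-lookup i)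
        ; injective = λ {i} {j} eq → inj i j (cong proj₁ eq)
        ; edge      = λ {i} {j} → edge i j
        }
      go : ∀ i j → ¬ Next i j → ¬ Next j i → l i ~ l j → ⊥
      go zero    zero    _ _ e = irrefl e
      go zero    (suc j) ¬ij ¬ji e with v~⇒ j e
      ... | inj₁ refl = ¬ij (inj₁ refl)
      ... | inj₂ eq   = ¬ji (inj₂ (cong suc eq , refl))
      go (suc i) zero    ¬ij ¬ji e with v~⇒ i (~-sym e)
      ... | inj₁ refl = ¬ji (inj₁ refl)
      ... | inj₂ eq   = ¬ij (inj₂ (cong suc eq , refl))
      go (suc i) (suc j) ¬ij ¬ji e with <-cmp (toℕ i) (toℕ j)
      ... | tri< lt _ _ = ¬ij (inj₁ (cong suc (chordless p i j lt e)))
      ... | tri> _ _ lt = ¬ji (inj₁ (cong suc (chordless p j i lt (~-sym e))))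
      ... | tri≈ _ e′ _ with refl ← toℕ-injective e′ = irrefl e

¬¬-all : ∀ {n} {P : Fin n → Set} → (∀ v → ¬ ¬ P v) → ¬ ¬ (∀ v → P v)
¬¬-all {zero}  f k = k λ ()
¬¬-all {suc n} f k = f zero λ p → ¬¬-all (λ v → f (suc v)) λ ps → k λ { zero → p ; (suc v) → ps v }

-- Lets a proof of a negation branch on reachability at all vertices at once without an algorithm
-- for it.
¬¬-decide : ∀ {n} (P : Fin n → Set) → ¬ ¬ (∀ v → Dec (P v))
¬¬-decide P = ¬¬-all λ v → ¬¬-excluded-middle

module Simplicial {n} (G : Graph (Fin n)) {S : Subset n} (chordal : ChordalDeletionSet G S) where
  open Graph G
  open InducedPaths G

  Clique : (X : Fin n → Set) → Fin n → Set
  Clique X y = ∀ {a b} → X a → X b → y ~ a → y ~ b → a ≢ b → a ~ b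

  -- Dirac: with C the component of u in X minus the closed neighbourhood of v,
  -- the neighbours of C form a clique N, and a vertex of C that is simplicial
  -- in C ∪ N is simplicial in X.
  simplicial-far-from : ∀ m (X : Fin n → Set) (X? : Decidable X) → (∀ {v} → X v → v ∈ˢ ∁ S) →
    count (λ v → does (X? v)) < m → ∀ {v u} → X v → X u → u ≢ v → ¬ v ~ u →
    ¬ ¬ (∃[ y ] X y × y ≢ v × ¬ v ~ y × Clique X y)
  simplicial-far-from (suc m) X X? X⊆ (s≤s size) {v} {u} Xv Xu u≢v v≁u fail =
    ¬¬-decide (Star E u) λ C? → main C?
    where
    Far : Fin n → Set
    Far w = X w × w ≢ v × ¬ v ~ w
    E : Fin n → Fin n → Set
    E a b = Far a × a ~ b × Far b
    E-sym : ∀ {a b} → E a b → E b a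
    E-sym (p , e , q) = q , ~-sym e , p
    C N Y : Fin n → Set
    C = Star E u
    far : ∀ {a b} → Far a → Star E a b → Far b
    far Fa ε = Fa
    far _ ((_ , _ , Fc) ◅ p) = far Fc p
    C⇒Far : ∀ {w} → C w → Far w
    C⇒Far = far (Xu , u≢v , v≁u)
    N w = X w × ¬ C w × ∃[ c ] C c × w ~ c
    Y w = C w ⊎ N w

    N~v : ∀ {w} → N w → v ~ w
    N~v {w} (Xw , ¬Cw , c , Cc , w~c) with v ~? w | w ≟ v
    ... | yes e | _ = e
    ... | no ¬e | yes refl = contradiction w~c (proj₂ (proj₂ (C⇒Far Cc)))
    ... | no ¬e | no w≢v =
      contradiction (Cc ◅◅ ((C⇒Far Cc , ~-sym w~c , (Xw , w≢v , ¬e)) ◅ ε)) ¬Cw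

    pathTo : ∀ {c₁ c₂ t} → C c₁ → Star E c₁ c₂ → c₂ ~ t → ¬ C t →
             ∃[ zs ] InducedPath c₁ zs t × All (λ z → Far z ⊎ z ≡ t) zs
    pathTo Cc ε e ¬Ct = _ , step e [] end , inj₂ refl ∷ []
    pathTo {c₁} Cc (s@(_ , e , Fd) ◅ p) e′ ¬Ct =
      let zs , q , qs = pathTo (Cc ▻▻ s) p e′ ¬Ct
      in prepend (λ { refl → ¬Ct Cc }) q (inj₁ Fd ∷ qs) (here e)
      where
      _▻▻_ : ∀ {a b} → C a → E a b → C b
      Ca ▻▻ s = Ca ◅◅ (s ◅ ε)

    -- Both vertices are adjacent to `v` and have a neighbour in the component `C`. Were they not
    -- adjacent, an induced path between them through `C` would form a hole with `v`, because `C`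
    -- contains no neighbour of `v`.
    N-clique : ∀ {s t} → N s → N t → s ≢ t → s ~ t
    N-clique {s} {t} Ns@(Xs , ¬Cs , c₁ , Cc₁ , s~c₁) Nt@(Xt , ¬Ct , c₂ , Cc₂ , t~c₂) s≢t with s ~? t
    ... | yes e  = e
    ... | no s≁t with pathTo Cc₁ (Star.reverse E-sym Cc₁ ◅◅ Cc₂) (~-sym t~c₂) ¬Ct
    ...   | zs , p , ps with prepend s≢t p (inj₁ (C⇒Far Cc₁) ∷ ps) (here s~c₁)
    ...   | _ , end , _ = contradiction refl s≢t
    ...   | _ ∷ _ , q@(step _ _ _) , qs =
      ⊥-elim (no-hole chordal q (X⊆ Xv) (X⊆ Xs)
        (All.map (λ { (inj₁ (Xz , _)) → X⊆ Xz ; (inj₂ refl) → X⊆ Xt }) qs) s≁t (N~v Ns) (N~v Nt)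
        (All.map (λ { (inj₁ (_ , z≢v , v≁z)) → inj₁ ((λ eq → z≢v (sym eq)) , v≁z) ; (inj₂ eq) → inj₂ eq }) qs))

    Y⊆X : ∀ {w} → Y w → X w
    Y⊆X (inj₁ Cw)       = proj₁ (C⇒Far Cw)
    Y⊆X (inj₂ (Xw , _)) = Xw

    v∉Y : ¬ Y v
    v∉Y (inj₁ Cv) = proj₁ (proj₂ (C⇒Far Cv)) refl
    v∉Y (inj₂ Nv) = irrefl (N~v Nv)

    main : Decidable C → ⊥
    main C? = cases
      where
      N? : Decidable N
      N? w = X? w ×-dec ¬? (C? w) ×-dec any? λ c → C? c ×-dec (w ~? c)
      Y? : Decidable Y
      Y? w = C? w ⊎-dec N? w

      lift : ∀ {y} → C y → Clique Y y → ⊥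
      lift {y} Cy cl = fail (y , proj₁ Fy , proj₁ (proj₂ Fy) , proj₂ (proj₂ Fy) ,
        λ Xa Xb e e′ → cl (nbr Xa e) (nbr Xb e′) e e′)
        where
        Fy = C⇒Far Cy
        nbr : ∀ {a} → X a → y ~ a → Y a
        nbr {a} Xa e with C? a
        ... | yes Ca = inj₁ Ca
        ... | no ¬Ca = inj₂ (Xa , ¬Ca , y , Cy , ~-sym e)

      recurse : ∀ {a b} → Y a → C b → b ≢ a → ¬ a ~ b →
                (∀ {y} → N y → y ≢ a → ¬ a ~ y → ⊥) → ⊥
      recurse {a} Ya Cb b≢a a≁b ¬N =
        simplicial-far-from m Y Y? (λ Yw → X⊆ (Y⊆X Yw)) smaller Ya (inj₁ Cb) b≢a a≁b λ where
          (y , inj₁ Cy , _   , _   , cl) → lift Cy cl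
          (y , inj₂ Ny , y≢a , a≁y , _)  → ¬N Ny y≢a a≁y
        where
        smaller : count (λ w → does (Y? w)) < m
        smaller = ≤-trans (count-<
          (λ w eq → dec-true (X? w) (Y⊆X (does⇒ (Y? w) eq)))
          (dec-false (Y? v) v∉Y) (dec-true (X? v) Xv)) size

      -- If some `a` in `N` misses some vertex of `C`, a simplicial vertex of `Y` far from `a`
      -- cannot be in the clique `N`. Otherwise `N` is complete to `C`, and a non-adjacent pair
      -- inside `C` excludes `N` in the same way. Otherwise `Y` is a clique and `u` itself is
      -- simplicial. The induction applies because `v` is not in `Y`.
      cases : ⊥
      cases with any? (λ a → any? λ b → N? a ×-dec C? b ×-dec ¬? (b ≟ a) ×-dec ¬? (a ~? b))
      ... | yes (a , b , Na , Cb , b≢a , a≁b) =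
        recurse (inj₂ Na) Cb b≢a a≁b λ Ny y≢a a≁y → a≁y (N-clique Na Ny (λ eq → y≢a (sym eq)))
      ... | no universal with any? (λ a → any? λ b → C? a ×-dec C? b ×-dec ¬? (b ≟ a) ×-dec ¬? (a ~? b))
      ...   | yes (a , b , Ca , Cb , b≢a , a≁b) =
        recurse (inj₁ Ca) Cb b≢a a≁b λ {y} Ny y≢a a≁y →
          universal (y , a , Ny , Ca , (λ eq → y≢a (sym eq)) , λ e → a≁y (~-sym e))
      ...   | no complete = lift ε λ {a} {b} → adjacent a b
        where
        adjacent : ∀ a b → Y a → Y b → u ~ a → u ~ b → a ≢ b → a ~ b
        adjacent a b Ya Yb _ _ a≢b with a ~? b
        ... | yes e = e
        adjacent a b (inj₁ Ca) (inj₁ Cb) _ _ a≢b | no ¬e =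
          contradiction (a , b , Ca , Cb , (λ eq → a≢b (sym eq)) , ¬e) complete
        adjacent a b (inj₁ Ca) (inj₂ Nb) _ _ a≢b | no ¬e =
          contradiction (b , a , Nb , Ca , a≢b , λ e → ¬e (~-sym e)) universal
        adjacent a b (inj₂ Na) (inj₁ Cb) _ _ a≢b | no ¬e =
          contradiction (a , b , Na , Cb , (λ eq → a≢b (sym eq)) , ¬e) universal
        adjacent a b (inj₂ Na) (inj₂ Nb) _ _ a≢b | no ¬e = N-clique Na Nb a≢b

  simplicial-exists : (X : Fin n → Set) → Decidable X → (∀ {v} → X v → v ∈ˢ ∁ S) →
                      ∀ {v} → X v → ¬ ¬ (∃[ y ] X y × Clique X y)
  simplicial-exists X X? X⊆ {v} Xv fail
    with any? (λ a → any? λ b → X? a ×-dec X? b ×-dec ¬? (b ≟ a) ×-dec ¬? (a ~? b))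
  ... | yes (a , b , Xa , Xb , b≢a , a≁b) =
    simplicial-far-from _ X X? X⊆ ≤-refl Xa Xb b≢a a≁b λ (y , Xy , _ , _ , cl) → fail (y , Xy , cl)
  ... | no complete = fail (v , Xv , λ {a} {b} Xa Xb _ _ a≢b → decidable-stable (a ~? b) λ ¬e →
    complete (a , b , Xa , Xb , (λ eq → a≢b (sym eq)) , ¬e))

matrix : ∀ {n} → Graph (Fin n) → Fin n → Fin n → Bool
matrix G u v = does (u ~? v)
  where open Graph G

find-spec : ∀ {A : Set} (p : A → Bool) xs z → let y = foldr (λ v acc → if p v then v else acc) z xs in
            (y ≡ z × (∀ {v} → v ∈ xs → ¬ Is (p v))) ⊎ Is (p y)
find-spec p []       z = inj₁ (refl , λ ())
find-spec p (x ∷ xs) z with p x in eq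
... | true  = inj₂ eq
... | false with find-spec p xs z
...   | inj₁ (e , none) = inj₁ (e , λ { (here refl) q → true≢false q eq ; (there v∈) → none v∈ })
...   | inj₂ q          = inj₂ q

-- Dynamic programming along the elimination order

module Solve {n} (G : Graph (Fin n)) (S S₁ : Fin n → Bool) (rank : Fin n → ℕ)
          (es : List (Entry n)) (r : Fin n) (l : ℕ) where
  open Graph G
  open Guess (matrix G) S S₁ rank es r l

  adj : Fin n → Fin n → Bool
  adj = matrix G

  adj⁻ : ∀ {u v} → Is (adj u v) → u ~ v
  adj⁻ {u} {v} = does⇒ (u ~? v)

  adj⁺ : ∀ {u v} → u ~ v → Is (adj u v)
  adj⁺ {u} {v} = dec-true (u ~? v)

  Dead : (Fin n → Bool) → Fin n → Set
  Dead alive w = S w ≡ false × alive w ≡ false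

  abstract
    dom : (Fin n → Bool) → (Fin n → Fin n) → Fin n → Fin n → Bool
    dom alive own c w = neg (S w) && neg (alive w) && (own w == c)

    dom⁻ : ∀ {alive own c w} → Is (dom alive own c w) → Dead alive w × own w ≡ c
    dom⁻ {alive} {own} {c} {w} p =
      let a , q = &&⁻ {neg (S w)} p
          b , q′ = &&⁻ {neg (alive w)} q
      in (neg⁻ a , neg⁻ b) , ==⁻ q′

    dom⁺ : ∀ {alive own c w} → Dead alive w → own w ≡ c → Is (dom alive own c w)
    dom⁺ (p , q) eq = &&⁺ (neg⁺ p) (&&⁺ (neg⁺ q) (==⁺ eq))

  Nbr : (Fin n → Bool) → Fin n → Fin n → Set
  Nbr alive c y = Is (alive y) × c ~ y

  -- The dead vertices fall into classes without edges between them, each with a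
  -- representative own w whose living neighbours form a clique and include
  -- those of the whole class.
  record Inv (alive top : Fin n → Bool) (own : Fin n → Fin n) : Set where
    field
      alive⇒  : ∀ {v} → Is (alive v) → S v ≡ false
      own-top : ∀ {w} → Dead alive w → Is (top (own w))
      top-dead : ∀ {c} → Is (top c) → Dead alive c
      top-own : ∀ {c} → Is (top c) → own c ≡ c
      same    : ∀ {w w′} → Dead alive w → Dead alive w′ → w ~ w′ → own w ≡ own w′
      near    : ∀ {w y} → Dead alive w → Is (alive y) → w ~ y → own w ~ y
      clique  : ∀ {c a b} → Is (top c) → Nbr alive c a → Nbr alive c b → a ≢ b → a ~ b

  -- Follows the recursion of `pull`, so that the region covered by a partial merge is available for
  -- induction over the same list.
  union : (Fin n → Bool) → (Fin n → Fin n → Bool) → List (Fin n) → Fin n → Bool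
  union ch D []       v = false
  union ch D (c ∷ cs) v = if ch c then union ch D cs v || D c v else union ch D cs v

  union⁻ : ∀ {ch D} cs {v} → Is (union ch D cs v) → ∃[ c ] c ∈ cs × Is (ch c) × Is (D c v)
  union⁻ {ch} {D} (c ∷ cs) {v} p with ch c in eq
  union⁻ {ch} {D} (c ∷ cs) {v} p | false =
    let d , d∈ , q = union⁻ cs p in d , there d∈ , q
  union⁻ {ch} {D} (c ∷ cs) {v} p | true with ||⁻ {union ch D cs v} p
  ... | inj₁ q = let d , d∈ , q = union⁻ cs q in d , there d∈ , q
  ... | inj₂ q = c , here refl , eq , q

  union⁺ : ∀ {ch D cs c v} → c ∈ cs → Is (ch c) → Is (D c v) → Is (union ch D cs v)
  union⁺ {ch} {D} {c ∷ cs} {v = v} (here refl) p q rewrite p = ||⁺ʳ {union ch D cs v} q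
  union⁺ {ch} {cs = d ∷ cs} (there c∈) p q with ch d
  ... | true  = ||⁺ˡ (union⁺ c∈ p q)
  ... | false = union⁺ c∈ p q

  module Eliminate {alive top own} (inv : Inv alive top own) {x} (x-alive : Is (alive x))
                   (simp : ∀ {a b} → Nbr alive x a → Nbr alive x b → a ≢ b → a ~ b) where
    open Inv inv

    alive′ top′ ch : Fin n → Bool
    alive′ v = alive v && neg (v == x)
    top′ c   = (c == x) || (top c && neg (adj c x))
    ch c     = top c && adj c x

    own′ : Fin n → Fin n
    own′ w = if (w == x) || adj (own w) x then x else own w

    own′-cases : ∀ w → (own′ w ≡ x × (w ≡ x ⊎ own w ~ x)) ⊎ (own′ w ≡ own w × w ≢ x × ¬ own w ~ x)
    own′-cases w with w == x in eq | adj (own w) x in eq′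
    ... | true  | _     = inj₁ (refl , inj₁ (==⁻ eq))
    ... | false | true  = inj₁ (refl , inj₂ (adj⁻ eq′))
    ... | false | false = inj₂ (refl , ≠⁻ eq , λ e → true≢false (adj⁺ e) eq′)

    alive′⁻ : ∀ {v} → Is (alive′ v) → Is (alive v) × v ≢ x
    alive′⁻ {v} p = let a , b = &&⁻ {alive v} p in a , ≠⁻ (neg⁻ b)

    alive′⁺ : ∀ {v} → Is (alive v) → v ≢ x → Is (alive′ v)
    alive′⁺ p q = &&⁺ p (neg⁺ (≠⁺ q))

    dead′⁻ : ∀ {w} → Dead alive′ w → w ≡ x ⊎ Dead alive w
    dead′⁻ {w} (p , q) with alive w in eq | w ≟ x
    ... | false | _      = inj₂ (p , refl)
    ... | true  | yes eq = inj₁ eq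
    ... | true  | no w≢x = contradiction (neg⁺ (≠⁺ w≢x)) (false⇒¬Is q)

    dead′⁺ : ∀ {w} → w ≡ x ⊎ Dead alive w → Dead alive′ w
    dead′⁺ (inj₁ refl) = alive⇒ x-alive , ¬Is⇒false λ p → proj₂ (alive′⁻ p) refl
    dead′⁺ (inj₂ (p , q)) = p , ¬Is⇒false λ p → true≢false (proj₁ (alive′⁻ p)) q

    top′⁻ : ∀ {c} → Is (top′ c) → c ≡ x ⊎ (Is (top c) × ¬ c ~ x × c ≢ x)
    top′⁻ {c} p with ||⁻ {c == x} p
    ... | inj₁ q = inj₁ (==⁻ q)
    ... | inj₂ q = let a , b = &&⁻ {top c} q in
      inj₂ (a , (λ e → true≢false (adj⁺ e) (neg⁻ b)) ,
            λ { refl → true≢false x-alive (proj₂ (top-dead a)) })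

    top′-x : Is (top′ x)
    top′-x = ||⁺ˡ (==⁺ {i = x} refl)

    top′⁺ : ∀ {c} → Is (top c) → ¬ c ~ x → Is (top′ c)
    top′⁺ {c} p q = ||⁺ʳ {c == x} (&&⁺ p (neg⁺ (¬Is⇒false λ e → q (adj⁻ e))))

    own′-x : own′ x ≡ x
    own′-x with own′-cases x
    ... | inj₁ (eq , _)      = eq
    ... | inj₂ (_ , x≢x , _) = contradiction refl x≢x

    inv′ : Inv alive′ top′ own′
    inv′ = record
      { alive⇒   = λ p → alive⇒ (proj₁ (alive′⁻ p))
      ; own-top  = own-top′
      ; top-dead = top-dead′
      ; top-own  = top-own′
      ; same     = same′
      ; near     = near′
      ; clique   = clique′
      }
      where
      own-top′ : ∀ {w} → Dead alive′ w → Is (top′ (own′ w))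
      own-top′ {w} d with own′-cases w | dead′⁻ d
      ... | inj₁ (eq , _) | _ rewrite eq = top′-x
      ... | inj₂ (eq , w≢x , _) | inj₁ w≡x = contradiction w≡x w≢x
      ... | inj₂ (eq , _ , ≁x)  | inj₂ d′ rewrite eq = top′⁺ (own-top d′) ≁x
      top-dead′ : ∀ {c} → Is (top′ c) → Dead alive′ c
      top-dead′ p with top′⁻ p
      ... | inj₁ refl    = dead′⁺ (inj₁ refl)
      ... | inj₂ (q , _) = dead′⁺ (inj₂ (top-dead q))
      top-own′ : ∀ {c} → Is (top′ c) → own′ c ≡ c
      top-own′ {c} p with top′⁻ p | own′-cases c
      ... | inj₁ refl          | _ = own′-x
      ... | inj₂ (q , ≁x , ≢x) | inj₁ (_ , inj₁ eq) = contradiction eq ≢x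
      ... | inj₂ (q , ≁x , ≢x) | inj₁ (_ , inj₂ e)  = contradiction (subst (_~ x) (top-own q) e) ≁x
      ... | inj₂ (q , ≁x , ≢x) | inj₂ (eq , _)      = trans eq (top-own q)
      ~x⇒ : ∀ {w} → Dead alive w → w ~ x → own′ w ≡ x
      ~x⇒ {w} d e with own′-cases w
      ... | inj₁ (eq , _)     = eq
      ... | inj₂ (_ , _ , ≁x) = contradiction (near d x-alive e) ≁x
      same-old : ∀ {w w′} → Dead alive w → Dead alive w′ → own w ≡ own w′ → own′ w ≡ own′ w′
      same-old {w} {w′} d d′ eq with own′-cases w | own′-cases w′
      ... | inj₁ (_ , inj₁ refl) | _ = contradiction (proj₂ d) λ q → true≢false x-alive q
      ... | _ | inj₁ (_ , inj₁ refl) = contradiction (proj₂ d′) λ q → true≢false x-alive q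
      ... | inj₁ (p , _) | inj₁ (q , _) = trans p (sym q)
      ... | inj₁ (_ , inj₂ e) | inj₂ (_ , _ , ¬e) = contradiction (subst (_~ x) eq e) ¬e
      ... | inj₂ (_ , _ , ¬e) | inj₁ (_ , inj₂ e) = contradiction (subst (_~ x) (sym eq) e) ¬e
      ... | inj₂ (p , _) | inj₂ (q , _) = trans p (trans eq (sym q))
      same′ : ∀ {w w′} → Dead alive′ w → Dead alive′ w′ → w ~ w′ → own′ w ≡ own′ w′
      same′ d d′ e with dead′⁻ d | dead′⁻ d′
      ... | inj₁ refl | inj₁ refl = refl
      ... | inj₁ refl | inj₂ q    = trans own′-x (sym (~x⇒ q (~-sym e)))
      ... | inj₂ p    | inj₁ refl = trans (~x⇒ p e) (sym own′-x)
      ... | inj₂ p    | inj₂ q    = same-old p q (same p q e)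
      near′ : ∀ {w y} → Dead alive′ w → Is (alive′ y) → w ~ y → own′ w ~ y
      near′ {w} d p e with own′-cases w | dead′⁻ d | alive′⁻ p
      ... | inj₁ (eq , inj₁ refl) | _ | _ rewrite eq = e
      ... | inj₁ (eq , inj₂ _)    | inj₁ refl | _ rewrite eq = e
      -- The old representative is adjacent to both `x` and `y`, and its living neighbours form a
      -- clique; hence `x ~ y`.
      ... | inj₁ (eq , inj₂ o~x)  | inj₂ d′ | y-alive , y≢x rewrite eq =
        clique (own-top d′) (x-alive , o~x) (y-alive , near d′ y-alive e) (λ eq → y≢x (sym eq))
      ... | inj₂ (eq , w≢x , _)   | inj₁ w≡x | _ = contradiction w≡x w≢x
      ... | inj₂ (eq , _ , _)     | inj₂ d′ | y-alive , _ rewrite eq = near d′ y-alive e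
      clique′ : ∀ {c a b} → Is (top′ c) → Nbr alive′ c a → Nbr alive′ c b → a ≢ b → a ~ b
      clique′ p (a-alive , e) (b-alive , e′) with top′⁻ p
      ... | inj₁ refl    = simp (proj₁ (alive′⁻ a-alive) , e) (proj₁ (alive′⁻ b-alive) , e′)
      ... | inj₂ (q , _) = clique q (proj₁ (alive′⁻ a-alive) , e) (proj₁ (alive′⁻ b-alive) , e′)

    children : Fin n → Bool
    children = union ch (dom alive own) vs

    children⁻ : ∀ {w} → Is (children w) → Dead alive w × own w ~ x
    children⁻ {w} p with union⁻ vs p
    ... | c , _ , q , q′ with dom⁻ q′
    ...   | d , refl = d , adj⁻ (proj₂ (&&⁻ {top (own w)} q))

    children⁺ : ∀ {w} → Dead alive w → own w ~ x → Is (children w)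
    children⁺ {w} d e = union⁺ (∈-vertices (own w)) (&&⁺ (own-top d) (adj⁺ e)) (dom⁺ d refl)

    dom′-x⁻ : ∀ {w} → Is (dom alive′ own′ x w) → w ≡ x ⊎ Is (children w)
    dom′-x⁻ {w} p with dom⁻ p
    ... | d , eq with dead′⁻ d | own′-cases w
    ...   | inj₁ w≡x | _ = inj₁ w≡x
    ...   | inj₂ d′  | inj₁ (_ , inj₁ w≡x) = inj₁ w≡x
    ...   | inj₂ d′  | inj₁ (_ , inj₂ e)   = inj₂ (children⁺ d′ e)
    ...   | inj₂ d′  | inj₂ (eq′ , _) =
      contradiction (proj₂ (top-dead (subst (Is ∘ top) (trans (sym eq′) eq) (own-top d′))))
                    λ q → true≢false x-alive q

    dom′-x⁺ : ∀ {w} → w ≡ x ⊎ Is (children w) → Is (dom alive′ own′ x w)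
    dom′-x⁺ (inj₁ refl) = dom⁺ (dead′⁺ (inj₁ refl)) own′-x
    dom′-x⁺ {w} (inj₂ p) with children⁻ p
    ... | d , e with own′-cases w
    ...   | inj₁ (eq , _)     = dom⁺ (dead′⁺ (inj₂ d)) eq
    ...   | inj₂ (_ , _ , ¬e) = contradiction e ¬e

    dom′-old : ∀ {c} → Is (top c) → ¬ c ~ x → c ≢ x → ∀ w → dom alive own c w ≡ dom alive′ own′ c w
    dom′-old {c} p ≁x ≢x w = bool-ext to from
      where
      to : Is (dom alive own c w) → Is (dom alive′ own′ c w)
      to q with dom⁻ q
      ... | d , refl with own′-cases w
      ...   | inj₁ (_ , inj₁ refl) = contradiction (proj₂ d) λ q → true≢false x-alive q
      ...   | inj₁ (_ , inj₂ e)    = contradiction e ≁x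
      ...   | inj₂ (eq , _)        = dom⁺ (dead′⁺ (inj₂ d)) eq
      from : Is (dom alive′ own′ c w) → Is (dom alive own c w)
      from q with dom⁻ q
      ... | d , refl with dead′⁻ d | own′-cases w
      ...   | _         | inj₁ (eq , _)       = contradiction eq ≢x
      ...   | inj₁ refl | inj₂ (_ , w≢x , _)  = contradiction refl w≢x
      ...   | inj₂ d′   | inj₂ (eq , _)       = dom⁺ d′ (sym eq)

  -- Soundness of the tables

  HT : (Fin n → Bool) → Fin n → Set
  HT T w = S w ≡ false × Is (T w)

  Conn : (Fin n → Bool) → Fin n → Fin n → Set
  Conn T = Star λ u w → HT T u × u ~ w × HT T w

  reverse : ∀ {T u w} → Conn T u w → Conn T w u
  reverse = Star.reverse λ (p , e , q) → q , ~-sym e , p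

  edge : ∀ {T u w} → HT T u → u ~ w → HT T w → Conn T u w
  edge p e q = (p , e , q) ◅ ε

  Linked : (Fin n → Bool) → Fin n → Set
  Linked T s = ∃[ s′ ] Is (S₁ s′) × rank s′ < rank s ×
    ∃[ w ] ∃[ w′ ] (HT T w × w ~ s) × (HT T w′ × w′ ~ s′) × Conn T w w′

  -- Since the cover contains `K` except for `o`, a component that meets the rest of `K` is
  -- unfinished and can still be attached later. A component that does not must already have a
  -- neighbour in `S₁`.
  Grounded Touched : (Fin n → Set) → Fin n → (Fin n → Bool) → Fin n → Set
  Grounded K o T w = (∃[ y ] K y × y ≢ o × Conn T w y) ⊎
                     (∃[ w′ ] ∃[ s ] (HT T w′ × w′ ~ s) × Is (S₁ s) × Conn T w w′)
  Touched K o T s = Is (S₁ s) × ∃[ y ] K y × y ≢ o × ∃[ w ] (HT T w × w ~ s) × Conn T w y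

  -- The claims are about every T that agrees with T₀ on D, so that partial solutions
  -- on different classes can be united.
  record Sound (D : Fin n → Bool) (K : Fin n → Set) (o : Fin n) (e : Entry n) : Set where
    field
      T₀      : Fin n → Bool
      T₀⊆     : ∀ {v} → Is (T₀ v) → Is (D v)
      size    : count T₀ ≤ proj₂ (proj₂ e)
      cover   : ∀ {u w} → Is (D u) → Is (D w) → u ~ w → Is (T₀ u) ⊎ Is (T₀ w)
      cover-o : ∀ {u} → K o → Is (D u) → u ~ o → Is (T₀ u)
      cover-S : ∀ {u s} → Is (D u) → Is (S s) → S₁ s ≡ false → u ~ s → Is (T₀ u)

    Extends : (Fin n → Bool) → Set
    Extends T = (∀ {v} → Is (D v) → T v ≡ T₀ v) × (∀ {y} → K y → y ≢ o → Is (T y))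

    field
      grounded : ∀ {T} → Extends T → ∀ {w} → Is (T₀ w) → Grounded K o T w
      touched  : ∀ {T} → Extends T → ∀ {s} → Is (proj₁ e s) → Touched K o T s
      linked   : ∀ {T} → Extends T → ∀ {s} → Is (proj₁ (proj₂ e) s) → Linked T s

  sound-≈ : ∀ {D D′ K K′ o e} → (∀ v → D v ≡ D′ v) → (∀ {y} → K y → K′ y) → (∀ {y} → K′ y → K y) →
            Sound D K o e → Sound D′ K′ o e
  sound-≈ {D} {D′} {K} {K′} {o} eq K⇒ K⇐ s = record
    { T₀       = T₀
    ; T₀⊆      = λ {v} p → to v (T₀⊆ p)
    ; size     = size
    ; cover    = λ p q → cover (from _ p) (from _ q)
    ; cover-o  = λ k p → cover-o (K⇐ k) (from _ p)
    ; cover-S  = λ p → cover-S (from _ p)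
    ; grounded = λ ext p → map-grounded (grounded (ext⇐ ext) p)
    ; touched  = λ ext p → let a , y , k , rest = touched (ext⇐ ext) p in a , y , K⇒ k , rest
    ; linked   = λ ext → linked (ext⇐ ext)
    }
    where
    open Sound s
    to : ∀ v → Is (D v) → Is (D′ v)
    to v p = trans (sym (eq v)) p
    from : ∀ v → Is (D′ v) → Is (D v)
    from v p = trans (eq v) p
    ext⇐ : ∀ {T} → (∀ {v} → Is (D′ v) → T v ≡ T₀ v) × (∀ {y} → K′ y → y ≢ o → Is (T y)) → Extends T
    ext⇐ (p , q) = (λ d → p (to _ d)) , λ k → q (K⇒ k)
    map-grounded : ∀ {A : Set} {T w} → (∃[ y ] K y × y ≢ o × Conn T w y) ⊎ A →
                   (∃[ y ] K′ y × y ≢ o × Conn T w y) ⊎ A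
    map-grounded (inj₁ (y , k , rest)) = inj₁ (y , K⇒ k , rest)
    map-grounded (inj₂ a)              = inj₂ a

  sound-start : ∀ {K o e} → e ∈ start o → Sound (λ _ → false) K o e
  sound-start {e = A , C , q} e∈ = record
    { T₀       = λ _ → false
    ; T₀⊆      = λ ()
    ; size     = ≤-trans (≤-reflexive (count-none {n} λ _ → refl)) z≤n
    ; cover    = λ ()
    ; cover-o  = λ _ ()
    ; cover-S  = λ ()
    ; grounded = λ _ ()
    ; touched  = λ _ {s} p → contradiction p (false⇒¬Is (neg⁻ (proj₁ (&&⁻ {neg (A s)} (none s)))))
    ; linked   = λ _ {s} p → contradiction p (false⇒¬Is (neg⁻ (proj₂ (&&⁻ {neg (A s)} (none s)))))
    }
    where
    none : ∀ v → Is (neg (A v) && neg (C v))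
    none = allV⁻ (proj₂ (filt⁻ es e∈))

  module _ {D₁ D₂ : Fin n → Bool} {K₁ K₂ : Fin n → Set} {o e e₁ e₂}
           (disjoint : ∀ {v} → Is (D₁ v) → Is (D₂ v) → ⊥)
           (apart : ∀ {u w} → Is (D₁ u) → Is (D₂ w) → ¬ u ~ w)
           (K₂⊆K₁ : ∀ {y} → K₂ y → K₁ y)
           (near : ∀ {u} → K₁ o → Is (D₂ u) → u ~ o → K₂ o)
           (s₁ : Sound D₁ K₁ o e₁) (s₂ : Sound D₂ K₂ o e₂) (ok : Is (joins e e₁ e₂)) where

    -- As the regions are disjoint, a cover that agrees with the union of the two partial solutions
    -- agrees with each on its own region, so both sets of claims apply to it. No edge between the
    -- regions is left to cover. By `near`, edges from `D₂` to `o` occur only if `o` is in `K₂`,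
    -- where the second entry deals with them.
    sound-join : Sound (λ v → D₁ v || D₂ v) K₁ o e
    sound-join = record
      { T₀       = T₀
      ; T₀⊆      = T₀⊆
      ; size     = ≤-trans (≤-reflexive (count-disjoint {f = M₁.T₀} {M₂.T₀} {T₀} T₀-split))
                     (≤-trans (+-mono-≤ M₁.size M₂.size) (≤ᵇ⁻ (proj₂ ok′)))
      ; cover    = cover
      ; cover-o  = cover-o
      ; cover-S  = cover-S
      ; grounded = grounded
      ; touched  = touched
      ; linked   = linked
      }
      where
      module M₁ = Sound s₁
      module M₂ = Sound s₂
      A C A₁ C₁ A₂ C₂ : Fin n → Bool
      A  = proj₁ e
      C  = proj₁ (proj₂ e)
      A₁ = proj₁ e₁
      C₁ = proj₁ (proj₂ e₁)
      A₂ = proj₁ e₂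
      C₂ = proj₁ (proj₂ e₂)
      ok′ = &&⁻ {all vs λ v → (A v ⇒ (A₁ v || A₂ v)) && (C v ⇒ (C₁ v || C₂ v))} ok
      claims : ∀ v → Is ((A v ⇒ (A₁ v || A₂ v)) && (C v ⇒ (C₁ v || C₂ v)))
      claims = allV⁻ (proj₁ ok′)
      T₀ D : Fin n → Bool
      T₀ v = M₁.T₀ v || M₂.T₀ v
      D v  = D₁ v || D₂ v
      T₀-split : ∀ v → toℕ₂ (T₀ v) ≡ toℕ₂ (M₁.T₀ v) + toℕ₂ (M₂.T₀ v)
      T₀-split v with M₁.T₀ v in eq₁ | M₂.T₀ v in eq₂
      ... | true  | true  = ⊥-elim (disjoint (M₁.T₀⊆ eq₁) (M₂.T₀⊆ eq₂))
      ... | true  | false = refl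
      ... | false | _     = refl
      T₀⊆ : ∀ {v} → Is (T₀ v) → Is (D v)
      T₀⊆ {v} p with ||⁻ {M₁.T₀ v} p
      ... | inj₁ q = ||⁺ˡ (M₁.T₀⊆ q)
      ... | inj₂ q = ||⁺ʳ {D₁ v} (M₂.T₀⊆ q)
      ∈₁ : ∀ {v} → Is (M₁.T₀ v) → Is (T₀ v)
      ∈₁ = ||⁺ˡ
      ∈₂ : ∀ {v} → Is (M₂.T₀ v) → Is (T₀ v)
      ∈₂ {v} = ||⁺ʳ {M₁.T₀ v}
      cover : ∀ {u w} → Is (D u) → Is (D w) → u ~ w → Is (T₀ u) ⊎ Is (T₀ w)
      cover {u} {w} p q e with ||⁻ {D₁ u} p | ||⁻ {D₁ w} q
      ... | inj₁ p | inj₂ q = contradiction e (apart p q)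
      ... | inj₂ p | inj₁ q = contradiction (~-sym e) (apart q p)
      ... | inj₁ p | inj₁ q with M₁.cover p q e
      ...   | inj₁ t = inj₁ (∈₁ t)
      ...   | inj₂ t = inj₂ (∈₁ t)
      cover {u} {w} p q e | inj₂ p′ | inj₂ q′ with M₂.cover p′ q′ e
      ...   | inj₁ t = inj₁ (∈₂ t)
      ...   | inj₂ t = inj₂ (∈₂ t)
      cover-o : ∀ {u} → K₁ o → Is (D u) → u ~ o → Is (T₀ u)
      cover-o {u} k p e with ||⁻ {D₁ u} p
      ... | inj₁ p = ∈₁ (M₁.cover-o k p e)
      ... | inj₂ p = ∈₂ (M₂.cover-o (near k p e) p e)
      cover-S : ∀ {u s} → Is (D u) → Is (S s) → S₁ s ≡ false → u ~ s → Is (T₀ u)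
      cover-S {u} p a b e with ||⁻ {D₁ u} p
      ... | inj₁ p = ∈₁ (M₁.cover-S p a b e)
      ... | inj₂ p = ∈₂ (M₂.cover-S p a b e)
      Ext : (Fin n → Bool) → Set
      Ext T = (∀ {v} → Is (D v) → T v ≡ T₀ v) × (∀ {y} → K₁ y → y ≢ o → Is (T y))
      ext₁ : ∀ {T} → Ext T → M₁.Extends T
      ext₁ (p , k) = (λ {v} d → trans (p (||⁺ˡ d)) (bool-ext (from v d) ∈₁)) , k
        where
        from : ∀ v → Is (D₁ v) → Is (T₀ v) → Is (M₁.T₀ v)
        from v d t with ||⁻ {M₁.T₀ v} t
        ... | inj₁ q = q
        ... | inj₂ q = ⊥-elim (disjoint d (M₂.T₀⊆ q))
      ext₂ : ∀ {T} → Ext T → M₂.Extends T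
      ext₂ (p , k) = (λ {v} d → trans (p (||⁺ʳ {D₁ v} d)) (bool-ext (from v d) ∈₂)) , λ y∈ → k (K₂⊆K₁ y∈)
        where
        from : ∀ v → Is (D₂ v) → Is (T₀ v) → Is (M₂.T₀ v)
        from v d t with ||⁻ {M₁.T₀ v} t
        ... | inj₁ q = ⊥-elim (disjoint (M₁.T₀⊆ q) d)
        ... | inj₂ q = q
      grounded : ∀ {T} → Ext T → ∀ {w} → Is (T₀ w) → Grounded K₁ o T w
      grounded ext {w} p with ||⁻ {M₁.T₀ w} p
      ... | inj₁ p = M₁.grounded (ext₁ ext) p
      ... | inj₂ p with M₂.grounded (ext₂ ext) p
      ...   | inj₁ (y , k , rest) = inj₁ (y , K₂⊆K₁ k , rest)
      ...   | inj₂ rest           = inj₂ rest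
      touched : ∀ {T} → Ext T → ∀ {s} → Is (A s) → Touched K₁ o T s
      touched ext {s} p with ||⁻ {A₁ s} (⇒⁻ (proj₁ (&&⁻ (claims s))) p)
      ... | inj₁ p = M₁.touched (ext₁ ext) p
      ... | inj₂ p = let a , y , k , rest = M₂.touched (ext₂ ext) p in a , y , K₂⊆K₁ k , rest
      linked : ∀ {T} → Ext T → ∀ {s} → Is (C s) → Linked T s
      linked ext {s} p with ||⁻ {C₁ s} (⇒⁻ (proj₂ (&&⁻ {A s ⇒ (A₁ s || A₂ s)} (claims s))) p)
      ... | inj₁ p = M₁.linked (ext₁ ext) p
      ... | inj₂ p = M₂.linked (ext₂ ext) p

  merge⁻ : ∀ {X Y o e} → e ∈ merge X Y o → ∃[ e₁ ] ∃[ e₂ ] e₁ ∈ X o × e₂ ∈ Y o × Is (joins e e₁ e₂)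
  merge⁻ {X} {Y} {o} e∈ =
    let e₁ , e₁∈ , p = any⁻ (X o) (proj₂ (filt⁻ es e∈))
        e₂ , e₂∈ , q = any⁻ (Y o) p
    in e₁ , e₂ , e₁∈ , e₂∈ , q

  -- `B` is the clique through which the merged classes can still be reached: `x` with its living
  -- neighbours during an elimination, and empty at the end.
  module Pull {alive top own} (inv : Inv alive top own) (ch : Fin n → Bool)
              (ch⇒top : ∀ {c} → Is (ch c) → Is (top c)) (B : Fin n → Set)
              (B⊇ : ∀ {c y} → Is (ch c) → Nbr alive c y → B y) (B-alive : ∀ {y} → B y → Is (alive y))
              (W : Fin n → Table n) where
    open Inv inv

    merged : List (Fin n) → Table n
    merged = foldr (λ c acc → if ch c then merge acc (W c) else acc) start

    U : List (Fin n) → Fin n → Bool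
    U = union ch (dom alive own)

    U-own : ∀ {cs v} → Is (U cs v) → Dead alive v × own v ∈ cs
    U-own {cs} p with union⁻ cs p
    ... | c , c∈ , _ , q with dom⁻ q
    ...   | d , refl = d , c∈

    U-disjoint : ∀ {c cs} → All (c ≢_) cs → ∀ {v} → Is (U cs v) → Is (dom alive own c v) → ⊥
    U-disjoint {c} {cs} ∉ p q with dom⁻ q
    ... | _ , refl = All.lookup ∉ (proj₂ (U-own {cs} p)) refl

    U-apart : ∀ {c cs} → All (c ≢_) cs → ∀ {u w} → Is (U cs u) → Is (dom alive own c w) → ¬ u ~ w
    U-apart {c} {cs} ∉ p q e with dom⁻ q
    ... | d , refl = let d′ , c∈ = U-own {cs} p in All.lookup ∉ c∈ (sym (same d′ d e))

    dom-near : ∀ {c o u} → Is (alive o) → Is (dom alive own c u) → u ~ o → Nbr alive c o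
    dom-near {c} o-alive q e with dom⁻ q
    ... | d , refl = o-alive , near d o-alive e

    pull-sound : (∀ {c o e} → Is (top c) → e ∈ W c o → Sound (dom alive own c) (Nbr alive c) o e) →
                 ∀ {o} cs → Unique cs → ∀ {e} → e ∈ merged cs o → Sound (U cs) B o e
    pull-sound W-sound [] _ e∈ = sound-start e∈
    pull-sound W-sound {o} (c ∷ cs) (∉ ∷ uniq) e∈ with ch c in eq
    ... | false = pull-sound W-sound cs uniq e∈
    ... | true  with merge⁻ {merged cs} {W c} e∈
    ...   | e₁ , e₂ , e₁∈ , e₂∈ , ok =
      sound-join (U-disjoint ∉) (U-apart ∉) (B⊇ eq) (λ b → dom-near (B-alive b))
        (pull-sound W-sound cs uniq e₁∈) (W-sound (ch⇒top eq) e₂∈) ok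

  module Forget (alive D : Fin n → Bool) (x : Fin n) (x-H : S x ≡ false) (x∉D : ¬ Is (D x))
                (alive⇒ : ∀ {v} → Is (alive v) → S v ≡ false) (X : Table n) where

    K B : Fin n → Set
    K   = Nbr alive x
    B y = y ≡ x ⊎ K y

    D⁺ : Fin n → Bool
    D⁺ v = (v == x) || D v

    D⁺⁻ : ∀ {v} → Is (D⁺ v) → v ≡ x ⊎ Is (D v)
    D⁺⁻ {v} p with ||⁻ {v == x} p
    ... | inj₁ q = inj₁ (==⁻ q)
    ... | inj₂ q = inj₂ q

    x∈D⁺ : Is (D⁺ x)
    x∈D⁺ = ||⁺ˡ (==⁺ {i = x} refl)

    D⊆D⁺ : ∀ {v} → Is (D v) → Is (D⁺ v)
    D⊆D⁺ {v} = ||⁺ʳ {v == x}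

    -- The test excludes `o` from `K`, so all of `K` is in the cover and `x` is the only vertex that
    -- `B` omits. The entry found at index `x` therefore speaks about the same covers.
    sound-omit : ∀ {o e} → (∀ {e₁} → e₁ ∈ X x → Sound D B x e₁) →
                 Is (omits alive x o X e) → Sound D⁺ K o e
    sound-omit {o} {e} X-sound ok = record
      { T₀       = T₀
      ; T₀⊆      = λ p → D⊆D⁺ (T₀⊆ p)
      ; size     = ≤-trans size (≤ᵇ⁻ (proj₂ ok″))
      ; cover    = cover′
      ; cover-o  = λ k → contradiction k ¬K-o
      ; cover-S  = cover-S′
      ; grounded = λ ext p → grounded′ ext (grounded (ext₁ ext) p)
      ; touched  = λ ext {s} p → touched′ ext
          (touched (ext₁ ext) (⇒⁻ (proj₁ (&&⁻ {A s ⇒ A₁ s} (claims s))) p))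
      ; linked   = λ ext {s} p → linked (ext₁ ext) (⇒⁻ (proj₂ (&&⁻ {A s ⇒ A₁ s} (claims s))) p)
      }
      where
      A  = proj₁ e
      C  = proj₁ (proj₂ e)
      ok₁ = &&⁻ {all vs λ v → S v && neg (S₁ v) ⇒ neg (adj x v)} ok
      ok₂ = &&⁻ {neg (alive o && adj x o)} (proj₂ ok₁)
      witness = any⁻ (X x) (proj₂ ok₂)
      e₁ = proj₁ witness
      A₁ = proj₁ e₁
      C₁ = proj₁ (proj₂ e₁)
      ok″ = &&⁻ {all vs λ v → (A v ⇒ A₁ v) && (C v ⇒ C₁ v)} (proj₂ (proj₂ witness))
      claims : ∀ v → Is ((A v ⇒ A₁ v) && (C v ⇒ C₁ v))
      claims = allV⁻ (proj₁ ok″)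
      open Sound (X-sound (proj₁ (proj₂ witness)))
      ¬K-o : ¬ K o
      ¬K-o (p , q) = false⇒¬Is (neg⁻ (proj₁ ok₂)) (&&⁺ p (adj⁺ q))
      cover′ : ∀ {u w} → Is (D⁺ u) → Is (D⁺ w) → u ~ w → Is (T₀ u) ⊎ Is (T₀ w)
      cover′ p q e with D⁺⁻ p | D⁺⁻ q
      ... | inj₁ refl | inj₁ refl = contradiction e (~-irrefl refl)
      ... | inj₁ refl | inj₂ q    = inj₂ (cover-o (inj₁ refl) q (~-sym e))
      ... | inj₂ p    | inj₁ refl = inj₁ (cover-o (inj₁ refl) p e)
      ... | inj₂ p    | inj₂ q    = cover p q e
      cover-S′ : ∀ {u s} → Is (D⁺ u) → Is (S s) → S₁ s ≡ false → u ~ s → Is (T₀ u)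
      cover-S′ {s = s} p a b e with D⁺⁻ p
      ... | inj₁ refl = contradiction (adj⁺ e)
        (false⇒¬Is (neg⁻ (⇒⁻ (allV⁻ (proj₁ ok₁) s) (&&⁺ a (neg⁺ b)))))
      ... | inj₂ p    = cover-S p a b e
      Ext : (Fin n → Bool) → Set
      Ext T = (∀ {v} → Is (D⁺ v) → T v ≡ T₀ v) × (∀ {y} → K y → y ≢ o → Is (T y))
      K≢o : ∀ {y} → K y → y ≢ o
      K≢o k refl = ¬K-o k
      ext₁ : ∀ {T} → Ext T → Extends T
      ext₁ (p , k) = (λ d → p (D⊆D⁺ d)) , λ where
        (inj₁ refl) x≢x → contradiction refl x≢x
        (inj₂ y∈)   _   → k y∈ (K≢o y∈)
      grounded′ : ∀ {T w} {R : Set} → Ext T → (∃[ y ] B y × y ≢ x × Conn T w y) ⊎ R →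
                  (∃[ y ] K y × y ≢ o × Conn T w y) ⊎ R
      grounded′ _ (inj₁ (y , inj₁ refl , x≢x , _)) = contradiction refl x≢x
      grounded′ _ (inj₁ (y , inj₂ k , _ , c))      = inj₁ (y , k , K≢o k , c)
      grounded′ _ (inj₂ r)                         = inj₂ r
      touched′ : ∀ {T s} {R : Fin n → Set} → Ext T → Is (S₁ s) × ∃[ y ] B y × y ≢ x × R y →
                 Is (S₁ s) × ∃[ y ] K y × y ≢ o × R y
      touched′ _ (a , y , inj₁ refl , x≢x , _) = contradiction refl x≢x
      touched′ _ (a , y , inj₂ k , _ , c)      = a , y , k , K≢o k , c

    -- Every vertex of `B` other than `o` is in the cover and equal or adjacent to `x`. So all
    -- vertices of `A⁺` are neighbours of the component of `x`, which justifies the new links, and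
    -- whatever was grounded by reaching `B` is now grounded through `x`.
    sound-take : ∀ {o e} → (∀ {e₁} → e₁ ∈ X o → Sound D B o e₁) →
                 Is (takes alive x o X e) → Sound D⁺ K o e
    sound-take {o} {e} X-sound ok = record
      { T₀       = T₁
      ; T₀⊆      = T₁⊆
      ; size     = ≤-trans (≤-reflexive count-T₁) (≤-trans (s≤s size) (≤ᵇ⁻ (proj₁ ok₂)))
      ; cover    = cover′
      ; cover-o  = cover-o′
      ; cover-S  = cover-S′
      ; grounded = grounded′
      ; touched  = touched′
      ; linked   = linked′
      }
      where
      A  = proj₁ e
      C  = proj₁ (proj₂ e)
      witness = any⁻ (X o) ok
      e₁ = proj₁ witness
      A₁ A⁺ : Fin n → Bool
      A₁ = proj₁ e₁
      A⁺ v = A₁ v || (S₁ v && adj x v)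
      C₁ = proj₁ (proj₂ e₁)
      ok₁ = &&⁻ {all vs λ v → C v ⇒ (C₁ v || linkable A⁺ v)} (proj₂ (proj₂ witness))
      ok₂ = &&⁻ {(1 + proj₂ (proj₂ e₁)) ≤ᵇ proj₂ (proj₂ e)} (proj₂ ok₁)
      open Sound (X-sound (proj₁ (proj₂ witness)))
      T₁ : Fin n → Bool
      T₁ v = (v == x) || T₀ v
      x∈T₁ : ∀ {v} → v ≡ x → Is (T₁ v)
      x∈T₁ eq = ||⁺ˡ (==⁺ eq)
      T₀⊆T₁ : ∀ {v} → Is (T₀ v) → Is (T₁ v)
      T₀⊆T₁ {v} = ||⁺ʳ {v == x}
      T₁⊆ : ∀ {v} → Is (T₁ v) → Is (D⁺ v)
      T₁⊆ {v} p with ||⁻ {v == x} p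
      ... | inj₁ q = ||⁺ˡ q
      ... | inj₂ q = D⊆D⁺ (T₀⊆ q)
      count-T₁ : count T₁ ≡ suc (count T₀)
      count-T₁ = trans (count-disjoint {f = λ v → v == x} {T₀} {T₁} split)
                       (cong (_+ count T₀) (count-single x (==⁺ {i = x} refl) λ v p → ==⁻ p))
        where
        split : ∀ v → toℕ₂ (T₁ v) ≡ toℕ₂ (v == x) + toℕ₂ (T₀ v)
        split v with v == x in eq | T₀ v in eq′
        ... | false | _     = refl
        ... | true  | false = refl
        ... | true  | true  = contradiction (subst (Is ∘ D) (==⁻ eq) (T₀⊆ eq′)) x∉D
      cover′ : ∀ {u w} → Is (D⁺ u) → Is (D⁺ w) → u ~ w → Is (T₁ u) ⊎ Is (T₁ w)
      cover′ p q e with D⁺⁻ p | D⁺⁻ q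
      ... | inj₁ eq | _       = inj₁ (x∈T₁ eq)
      ... | inj₂ _  | inj₁ eq = inj₂ (x∈T₁ eq)
      ... | inj₂ p  | inj₂ q with cover p q e
      ...   | inj₁ t = inj₁ (T₀⊆T₁ t)
      ...   | inj₂ t = inj₂ (T₀⊆T₁ t)
      cover-o′ : ∀ {u} → K o → Is (D⁺ u) → u ~ o → Is (T₁ u)
      cover-o′ k p e with D⁺⁻ p
      ... | inj₁ eq = x∈T₁ eq
      ... | inj₂ p  = T₀⊆T₁ (cover-o (inj₂ k) p e)
      cover-S′ : ∀ {u s} → Is (D⁺ u) → Is (S s) → S₁ s ≡ false → u ~ s → Is (T₁ u)
      cover-S′ p a b e with D⁺⁻ p
      ... | inj₁ eq = x∈T₁ eq
      ... | inj₂ p  = T₀⊆T₁ (cover-S p a b e)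
      module _ {T : Fin n → Bool} (agree : ∀ {v} → Is (D⁺ v) → T v ≡ T₁ v)
               (K⊆T : ∀ {y} → K y → y ≢ o → Is (T y)) where
        ext₁ : Extends T
        ext₁ = (λ {v} d → trans (agree (D⊆D⁺ d)) (T₁≡ v d)) ,
          λ { (inj₁ refl) _ → trans (agree x∈D⁺) (x∈T₁ refl) ; (inj₂ k) y≢o → K⊆T k y≢o }
          where
          T₁≡ : ∀ v → Is (D v) → T₁ v ≡ T₀ v
          T₁≡ v d rewrite ≠⁺ {i = v} {x} (λ { refl → x∉D d }) = refl
        HT-x : HT T x
        HT-x = x-H , trans (agree x∈D⁺) (x∈T₁ refl)
        to-x : ∀ {y} → B y → y ≢ o → Conn T y x
        to-x (inj₁ refl) _ = ε
        to-x (inj₂ k@(y-alive , x~y)) y≢o = edge (alive⇒ y-alive , K⊆T k y≢o) (~-sym x~y) HT-x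
        reach : ∀ {s} → Is (A⁺ s) → Is (S₁ s) × ∃[ w ] (HT T w × w ~ s) × Conn T w x
        reach {s} p with ||⁻ {A₁ s} p
        ... | inj₁ q = let a , y , b , y≢o , w , ws , c = touched ext₁ q in a , w , ws , c ◅◅ to-x b y≢o
        ... | inj₂ q = let a , b = &&⁻ {S₁ s} q in a , x , (HT-x , adj⁻ b) , ε
        escape : (∃[ y ] K y × y ≢ o × Conn T x y × (∀ s → Is (A s) → Is (A⁺ s))) ⊎
                 ((∃[ s ] Is (A⁺ s)) × (∀ s → A s ≡ false))
        escape with ||⁻ {(any vs λ y → alive y && adj x y && neg (y == o)) && (all vs λ v → A v ⇒ A⁺ v)} (proj₂ ok₂)
        ... | inj₁ p =
          let a , b = &&⁻ {any vs λ y → alive y && adj x y && neg (y == o)} p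
              y , q = anyV⁻ a
              y-alive , q′ = &&⁻ {alive y} q
              x~y , q″ = &&⁻ {adj x y} q′
              k = y-alive , adj⁻ x~y
              y≢o = ≠⁻ (neg⁻ q″)
          in inj₁ (y , k , y≢o , edge HT-x (adj⁻ x~y) (alive⇒ y-alive , K⊆T k y≢o) , λ s → ⇒⁻ (allV⁻ b s))
        ... | inj₂ p =
          let a , b = &&⁻ {any vs A⁺} p in inj₂ (anyV⁻ a , λ s → neg⁻ (allV⁻ b s))
        ground-x : ∀ {w} → Conn T w x → Grounded K o T w
        ground-x c with escape
        ... | inj₁ (y , k , y≢o , c′ , _) = inj₁ (y , k , y≢o , c ◅◅ c′)
        ... | inj₂ ((s , p) , _) =
          let a , w′ , ws , c′ = reach p in inj₂ (w′ , s , ws , a , c ◅◅ reverse c′)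
      Ext : (Fin n → Bool) → Set
      Ext T = (∀ {v} → Is (D⁺ v) → T v ≡ T₁ v) × (∀ {y} → K y → y ≢ o → Is (T y))
      grounded′ : ∀ {T} → Ext T → ∀ {w} → Is (T₁ w) → Grounded K o T w
      grounded′ (p , k) {w} t with ||⁻ {w == x} t
      ... | inj₁ eq with refl ← ==⁻ {i = w} {x} eq = ground-x p k ε
      ... | inj₂ t with grounded (ext₁ p k) t
      ...   | inj₁ (y , b , y≢o , c) = ground-x p k (c ◅◅ to-x p k b y≢o)
      ...   | inj₂ rest = inj₂ rest
      touched′ : ∀ {T} → Ext T → ∀ {s} → Is (A s) → Touched K o T s
      touched′ (p , k) {s} As with escape p k
      ... | inj₂ (_ , none) = contradiction As (false⇒¬Is (none s))
      ... | inj₁ (y , ky , y≢o , c , A⇒A⁺) =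
        let a , w , ws , c′ = reach p k (A⇒A⁺ s As) in a , y , ky , y≢o , w , ws , c′ ◅◅ c
      linked′ : ∀ {T} → Ext T → ∀ {s} → Is (C s) → Linked T s
      linked′ (p , k) {s} Cs with ||⁻ {C₁ s} (⇒⁻ (allV⁻ (proj₁ ok₁) s) Cs)
      ... | inj₁ q = linked (ext₁ p k) q
      ... | inj₂ q =
        let a , b = &&⁻ {A⁺ s} q
            u , b′ = anyV⁻ b
            a′ , lt = &&⁻ {A⁺ u} b′
            _ , w , ws , c = reach p k a
            Su , w′ , ws′ , c′ = reach p k a′
        in u , Su , ≤ᵇ⁻ lt , w , w′ , ws , ws′ , c ◅◅ reverse c′

    sound-forget : ∀ {o e} → (∀ {o e₁} → e₁ ∈ X o → Sound D B o e₁) →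
                   e ∈ forget alive x X o → Sound D⁺ K o e
    sound-forget {o} {e} X-sound e∈ with ||⁻ {omits alive x o X e} (proj₂ (filt⁻ es e∈))
    ... | inj₁ ok = sound-omit X-sound ok
    ... | inj₂ ok = sound-take X-sound ok

  -- The elimination loop

  SimplicialIn : (Fin n → Bool) → Fin n → Set
  SimplicialIn alive v = ∀ {a b} → Nbr alive v a → Nbr alive v b → a ≢ b → a ~ b

  simplicial⁻ : ∀ {alive v} → Is (simplicial alive v) → SimplicialIn alive v
  simplicial⁻ p {a} {b} (pa , ea) (pb , eb) a≢b = adj⁻ (⇒⁻ (allV⁻ (allV⁻ p a) b)
    (&&⁺ pa (&&⁺ pb (&&⁺ (adj⁺ ea) (&&⁺ (adj⁺ eb) (neg⁺ (≠⁺ a≢b)))))))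

  simplicial⁺ : ∀ {alive v} → SimplicialIn alive v → Is (simplicial alive v)
  simplicial⁺ {alive} {v} f = allV⁺ λ a → allV⁺ λ b → ⇒⁺ λ p →
    let pa , p = &&⁻ {alive a} p
        pb , p = &&⁻ {alive b} p
        ea , p = &&⁻ {adj v a} p
        eb , p = &&⁻ {adj v b} p
    in adj⁺ (f (pa , adj⁻ ea) (pb , adj⁻ eb) (≠⁻ (neg⁻ p)))

  unique : Unique vs
  unique = tabulate⁺ id

  -- Soundness and completeness are two invariants of one loop, so the analysis of the loop is
  -- carried out for an arbitrary property of tables.
  Property : Set₁
  Property = (Fin n → Bool) → (Fin n → Fin n) → (Fin n → Table n) → Fin n → Set

  record Good (P : Property) (p : Progress) : Set where
    alive = proj₁ p
    top   = proj₁ (proj₂ p)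
    W     = proj₂ (proj₂ p)
    field
      own   : Fin n → Fin n
      inv   : Inv alive top own
      holds : ∀ {c} → Is (top c) → P alive own W c

  Preserved : Property → Set
  Preserved P = ∀ {p} → Good P p → ∀ {x} → Is (proj₁ p x) → SimplicialIn (proj₁ p) x → Good P (eliminate x p)

  module _ (r∈S : Is (S r))
           (simplicial-exists : ∀ alive → (∀ {v} → Is (alive v) → S v ≡ false) → ∀ {v} → Is (alive v) →
                                ∃[ y ] Is (alive y) × SimplicialIn alive y)
           (P : Property) (preserved : Preserved P) where

    good-init : Good P ((λ v → neg (S v)) , (λ _ → false) , (λ _ _ → []))
    good-init = record
      { own = id
      ; inv = record
        { alive⇒ = neg⁻
        ; own-top = λ d → ⊥-elim (none d)
        ; top-dead = λ ()
        ; top-own = λ ()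
        ; same = λ d → ⊥-elim (none d)
        ; near = λ d → ⊥-elim (none d)
        ; clique = λ ()
        }
      ; holds = λ ()
      }
      where
      none : ∀ {w} → ¬ Dead (λ v → neg (S v)) w
      none {w} (p , q) = true≢false (neg⁺ p) q

    Found : Progress → Fin n → Set
    Found p y = (y ≡ r × (∀ {v} → v ∈ vs → ¬ Is (proj₁ p v && simplicial (proj₁ p) v))) ⊎
                Is (proj₁ p y && simplicial (proj₁ p) y)

    Advanced : Progress → Progress → Set
    Advanced p p′ = Good P p′ × (((∀ v → proj₁ p v ≡ false) × p′ ≡ p) ⊎ count (proj₁ p′) < count (proj₁ p))

    -- A living vertex would yield a living simplicial one, so the search could not have failed; nor
    -- can it have found `r`, which is not alive.
    stop : ∀ {p} → Good P p → Found p r → ∀ v → proj₁ p v ≡ false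
    stop {p} good found v = ¬Is⇒false λ a → absurd found (simplicial-exists alive (Inv.alive⇒ inv) a)
      where
      open Good good
      absurd : Found p r → ¬ (∃[ y ] Is (alive y) × SimplicialIn alive y)
      absurd (inj₁ (_ , none)) (y , a , s) = none (∈-vertices y) (&&⁺ a (simplicial⁺ {alive} {y} s))
      absurd (inj₂ q) _ = true≢false r∈S (Inv.alive⇒ inv (proj₁ (&&⁻ {alive r} q)))

    advance : ∀ {p} → Good P p → ∀ {x} → Is (proj₁ p x) → SimplicialIn (proj₁ p) x → Advanced p (eliminate x p)
    advance good {x} a s = preserved good a s ,
      inj₂ (count-< {f = alive′} {alive} (λ v q → proj₁ (alive′⁻ q)) {x = x} (¬Is⇒false λ q → proj₂ (alive′⁻ q) refl) a)
      where
      open Good good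
      open Eliminate inv a s

    step-with : ∀ {p} → Good P p → ∀ y → Found p y → Advanced p (if y == r then p else eliminate y p)
    step-with {p} good y found with y == r in eq
    ... | true  = good , inj₁ (stop good (subst (Found p) (==⁻ {i = y} eq) found) , refl)
    ... | false with found
    ...   | inj₁ (y≡r , _) = contradiction y≡r (≠⁻ eq)
    ...   | inj₂ q = advance good (proj₁ (&&⁻ {proj₁ p y} q)) (simplicial⁻ {proj₁ p} {y} (proj₂ (&&⁻ {proj₁ p y} q)))

    step-spec : ∀ {p} → Good P p → Advanced p (step p)
    step-spec {p} good =
      step-with good (pick (proj₁ p)) (find-spec (λ v → proj₁ p v && simplicial (proj₁ p) v) vs r)

    -- Each round removes a living vertex unless none is left, so after `n` rounds none is left.
    Nearly : ℕ → Progress → Set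
    Nearly k p = Good P p × ((∀ v → proj₁ p v ≡ false) ⊎ (count (proj₁ p) + k ≤ n))

    nearly-suc : ∀ {k p p′} → Nearly k p → Advanced p p′ → Nearly (suc k) p′
    nearly-suc (_ , _)       (good , inj₁ (dead , refl)) = good , inj₁ dead
    nearly-suc (_ , inj₁ dead) (good , inj₂ less) = contradiction less
      (λ lt → n≮0 (≤-trans lt (≤-reflexive (count-none dead))))
    nearly-suc (_ , inj₂ le)   (good , inj₂ less) =
      good , inj₂ (≤-trans (≤-reflexive (+-suc _ _)) (≤-trans (+-monoˡ-≤ _ less) le))

    after : List (Fin n) → Progress
    after = foldr (λ _ p → step p) ((λ v → neg (S v)) , (λ _ → false) , (λ _ _ → []))

    after-spec : ∀ xs → Nearly (List.length xs) (after xs)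
    after-spec []       = good-init , inj₂ (≤-trans (≤-reflexive (+-identityʳ _))
      (≤-trans (count-≤ {f = λ v → neg (S v)} {λ _ → true} λ _ _ → refl) (≤-reflexive (count-all n))))
    after-spec (x ∷ xs) = nearly-suc (after-spec xs) (step-spec (proj₁ (after-spec xs)))

    all-dead : ∀ {p} → Nearly (List.length vs) p → Good P p × (∀ v → proj₁ p v ≡ false)
    all-dead (good , inj₁ dead) = good , dead
    all-dead {p} (good , inj₂ le)   = good , λ v → ¬Is⇒false λ a → n≮0 (≤-trans
      (count-< {f = λ _ → false} {proj₁ p} (λ _ ()) {v} refl a)
      (+-cancelʳ-≤ (List.length vs) _ 0 (≤-trans le (≤-reflexive (sym (length-tabulate id))))))

    finish-spec : Good P finish × (∀ v → proj₁ finish v ≡ false)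
    finish-spec = all-dead (after-spec vs)

  module Step {alive top own} (inv : Inv alive top own) {x} (x-alive : Is (alive x))
              (simp : SimplicialIn alive x) (W : Fin n → Table n) where
    open Inv inv
    open Eliminate inv x-alive simp public

    B : Fin n → Set
    B y = y ≡ x ⊎ Nbr alive x y

    ch⇒top : ∀ {c} → Is (ch c) → Is (top c)
    ch⇒top {c} p = proj₁ (&&⁻ {top c} p)

    -- The living neighbours of a child form a clique that contains `x`.
    B⊇ : ∀ {c y} → Is (ch c) → Nbr alive c y → B y
    B⊇ {c} {y} p (a , e) with y ≟ x
    ... | yes eq = inj₁ eq
    ... | no y≢x = inj₂ (a , clique (ch⇒top p) (x-alive , adj⁻ (proj₂ (&&⁻ {top c} p))) (a , e) λ eq → y≢x (sym eq))

    B-alive : ∀ {y} → B y → Is (alive y)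
    B-alive (inj₁ refl)    = x-alive
    B-alive (inj₂ (a , _)) = a

    open Pull inv ch ch⇒top B B⊇ B-alive W public

    x∉ : ¬ Is (children x)
    x∉ p = true≢false x-alive (proj₂ (proj₁ (children⁻ p)))

    D⁺≡ : ∀ v → ((v == x) || children v) ≡ dom alive′ own′ x v
    D⁺≡ v = bool-ext (λ p → dom′-x⁺ (to p)) (λ p → from (dom′-x⁻ p))
      where
      to : Is ((v == x) || children v) → v ≡ x ⊎ Is (children v)
      to p with ||⁻ {v == x} p
      ... | inj₁ q = inj₁ (==⁻ q)
      ... | inj₂ q = inj₂ q
      from : v ≡ x ⊎ Is (children v) → Is ((v == x) || children v)
      from (inj₁ eq) = ||⁺ˡ (==⁺ eq)
      from (inj₂ q)  = ||⁺ʳ {v == x} q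

    K⇒ : ∀ {y} → Nbr alive x y → Nbr alive′ x y
    K⇒ (a , e) = alive′⁺ a (λ { refl → ~-irrefl refl e }) , e

    K⇐ : ∀ {c y} → Nbr alive′ c y → Nbr alive c y
    K⇐ (a , e) = proj₁ (alive′⁻ a) , e

    K⇒-old : ∀ {c y} → ¬ c ~ x → Nbr alive c y → Nbr alive′ c y
    K⇒-old ≁x (a , e) = alive′⁺ a (λ { refl → ≁x e }) , e

  TableSound : Property
  TableSound alive own W c = ∀ {o e} → e ∈ W c o → Sound (dom alive own c) (Nbr alive c) o e

  sound-eliminate : Preserved TableSound
  sound-eliminate {p} good {x} x-alive simp = record { own = own′ ; inv = inv′ ; holds = holds′ _ }
    where
    open Good good
    open Step inv x-alive simp W
    open Forget alive children x (Inv.alive⇒ inv x-alive) x∉ (Inv.alive⇒ inv) (pull ch W) using (sound-forget)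
    old : ∀ {c} → (c == x) ≡ false → Is (top′ c) → ∀ {o e} → e ∈ W c o → Sound (dom alive′ own′ c) (Nbr alive′ c) o e
    old eq t e∈ with top′⁻ t
    ... | inj₁ c≡x = contradiction c≡x (≠⁻ eq)
    ... | inj₂ (t , ≁x , c≢x) = sound-≈ (dom′-old t ≁x c≢x) (K⇒-old ≁x) K⇐ (holds t e∈)
    new : ∀ {c} → c ≡ x → ∀ {o e} → e ∈ forget alive x (pull ch W) o → Sound (dom alive′ own′ c) (Nbr alive′ c) o e
    new refl e∈ = sound-≈ D⁺≡ K⇒ K⇐ (sound-forget (pull-sound (λ t → λ e∈ → holds t e∈) vs unique) e∈)
    select : ∀ {c} b → (c == x) ≡ b → Is (top′ c) → ∀ {o e} → e ∈ (if b then forget alive x (pull ch W) else W c) o →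
             Sound (dom alive′ own′ c) (Nbr alive′ c) o e
    select true  eq t = new (==⁻ eq)
    select false eq t = old eq t
    holds′ : ∀ c → Is (top′ c) → TableSound alive′ own′ (proj₂ (proj₂ (eliminate x p))) c
    holds′ c t = select (c == x) refl t

  module _ where
    Walk : (Fin n → Bool) → Fin n → Fin n → Set
    Walk T = Star λ a b → Is (T a) × a ~ b × Is (T b)

    module Final {P p} (good : Good P p) (dead : ∀ v → proj₁ p v ≡ false) where
      open Good good public

      open Pull inv top id (λ _ → ⊥) (λ _ (a , _) → true≢false a (dead _)) (λ ()) W public

      everything : Fin n → Bool
      everything = U vs

      everything⁻ : ∀ {v} → Is (everything v) → S v ≡ false
      everything⁻ p = proj₁ (proj₁ (U-own {vs} p))

      everything⁺ : ∀ {v} → S v ≡ false → Is (everything v)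
      everything⁺ {v} p = union⁺ (∈-vertices (own v)) (Inv.own-top inv (p , dead v)) (dom⁺ (p , dead v) refl)

    succeeds-from : Progress → Bool
    succeeds-from p = plausible && any (pull (proj₁ (proj₂ p)) (proj₂ (proj₂ p)) r) accepts

    -- No vertex is alive, so every component of H[T] is attached to `S₁`. From a vertex of `S₁` the
    -- links lead to ever smaller ranks, and `r` is the only vertex where the descent can end.
    succeeds-sound : ∀ {p} → Good TableSound p → (∀ v → proj₁ p v ≡ false) → Is (succeeds-from p) → ∃[ T ] (∀ {u v} → u ~ v → Is (T u) ⊎ Is (T v)) ×
                     (∀ {v} → Is (T v) → Walk T v r) × count T ≤ l
    succeeds-sound good dead ok = T , cover′ , walk , small
      where
      open Final good dead
      ok₁ = &&⁻ {plausible} ok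
      ok₂ = &&⁻ {S₁ r} (proj₁ ok₁)
      ok₃ = &&⁻ {all vs λ v → S₁ v ⇒ S v} (proj₂ ok₂)
      chosen = any⁻ (pull top W r) (proj₂ ok₁)
      e = proj₁ chosen
      C : Fin n → Bool
      C = proj₁ (proj₂ e)
      ok₄ = &&⁻ {all vs λ v → S₁ v ⇒ ((v == r) || C v || any vs λ u → S₁ u && adj v u && rank u <ᵇ rank v)}
                (proj₂ (proj₂ chosen))
      open Sound (pull-sound (λ t → λ e∈ → holds t e∈) vs unique (proj₁ (proj₂ chosen)))
      S₁⊆S : ∀ {v} → Is (S₁ v) → Is (S v)
      S₁⊆S {v} = ⇒⁻ (allV⁻ (proj₁ ok₃) v)
      T : Fin n → Bool
      T v = S₁ v || T₀ v
      T₀∌ : ∀ {v} → Is (S v) → T₀ v ≡ false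
      T₀∌ p = ¬Is⇒false λ q → true≢false p (everything⁻ (T₀⊆ q))
      S₁∌ : ∀ {v} → S v ≡ false → S₁ v ≡ false
      S₁∌ p = ¬Is⇒false λ q → true≢false (S₁⊆S q) p
      ext : Extends T
      ext = (λ d → cong (_|| T₀ _) (S₁∌ (everything⁻ d))) , λ ()
      T₀⊆T : ∀ {v} → Is (T₀ v) → Is (T v)
      T₀⊆T {v} = ||⁺ʳ {S₁ v}
      cover-HS : ∀ {u v} → S u ≡ false → Is (S v) → u ~ v → Is (T u) ⊎ Is (T v)
      cover-HS {u} {v} p q e with S₁ v in eq
      ... | true  = inj₂ refl
      ... | false = inj₁ (T₀⊆T (cover-S (everything⁺ p) q eq e))
      cover′ : ∀ {u v} → u ~ v → Is (T u) ⊎ Is (T v)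
      cover′ {u} {v} e with S u in equ | S v in eqv
      ... | false | true  = cover-HS equ eqv e
      ... | true  | false = swap (cover-HS eqv equ (~-sym e))
      ... | false | false with cover (everything⁺ equ) (everything⁺ eqv) e
      ...   | inj₁ t = inj₁ (T₀⊆T t)
      ...   | inj₂ t = inj₂ (T₀⊆T t)
      cover′ {u} {v} e | true | true with S₁ u in eq | S₁ v in eq′
      ... | true  | _     = inj₁ refl
      ... | false | true  = inj₂ refl
      ... | false | false = contradiction (adj⁺ e) (false⇒¬Is (neg⁻
        (⇒⁻ (allV⁻ (allV⁻ (proj₂ ok₃) u) v) (&&⁺ (&&⁺ equ (neg⁺ eq)) (&&⁺ eqv (neg⁺ eq′))))))
      conn-walk : ∀ {a b} → Conn T a b → Walk T a b
      conn-walk = Star.map λ ((_ , p) , e , (_ , q)) → p , e , q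
      smaller : ∀ {s} → Is (S₁ s) → s ≡ r ⊎ (∃[ s′ ] Is (S₁ s′) × rank s′ < rank s × Walk T s s′)
      smaller {s} p with ||⁻ {s == r} (⇒⁻ (allV⁻ (proj₁ ok₄) s) p)
      ... | inj₁ q = inj₁ (==⁻ q)
      ... | inj₂ q with ||⁻ {C s} q
      ...   | inj₁ q =
        let s′ , p′ , lt , w , w′ , ((_ , t) , e) , ((_ , t′) , e′) , c = linked ext q
        in inj₂ (s′ , p′ , lt , (||⁺ˡ p , ~-sym e , t) ◅ (conn-walk c ◅◅ ((t′ , e′ , ||⁺ˡ p′) ◅ ε)))
      ...   | inj₂ q =
        let s′ , q = anyV⁻ q
            p′ , q = &&⁻ {S₁ s′} q
            e , q = &&⁻ {adj s s′} q
        in inj₂ (s′ , p′ , ≤ᵇ⁻ q , (||⁺ˡ p , adj⁻ e , ||⁺ˡ p′) ◅ ε)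
      walk-S : ∀ {s} → Acc _<_ (rank s) → Is (S₁ s) → Walk T s r
      walk-S (acc rec) p with smaller p
      ... | inj₁ refl = ε
      ... | inj₂ (s′ , p′ , lt , c) = c ◅◅ walk-S (rec lt) p′
      walk : ∀ {v} → Is (T v) → Walk T v r
      walk {v} p with ||⁻ {S₁ v} p
      ... | inj₁ q = walk-S (<-wellFounded _) q
      ... | inj₂ q with grounded ext q
      ...   | inj₁ (_ , () , _)
      ...   | inj₂ (w , s , ((_ , t) , e) , a , c) =
        conn-walk c ◅◅ ((t , e , ||⁺ˡ a) ◅ walk-S (<-wellFounded _) a)
      small : count T ≤ l
      small = ≤-trans (≤-reflexive (trans (count-disjoint {f = S₁} {T₀} {T} split) (+-comm (count S₁) _)))
        (≤-trans (+-monoˡ-≤ (count S₁) size) (≤ᵇ⁻ (proj₂ ok₄)))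
        where
        split : ∀ v → toℕ₂ (T v) ≡ toℕ₂ (S₁ v) + toℕ₂ (T₀ v)
        split v with S₁ v in eq
        ... | false = refl
        ... | true rewrite T₀∌ (S₁⊆S eq) = refl

  -- Completeness of the tables

  module Complete (T : Fin n → Bool)
    (T-cover : ∀ {u v} → u ~ v → Is (T u) ⊎ Is (T v))
    (S₁⇒ : ∀ {v} → Is (S₁ v) → Is (S v)) (⇒S₁ : ∀ {v} → Is (S v) → Is (T v) → Is (S₁ v))
    (conn? : ∀ u v → Dec (Conn T u v))
    (ground : ∀ {w} → HT T w → ∃[ w′ ] ∃[ s ] (HT T w′ × w′ ~ s) × Is (S₁ s) × Conn T w w′)
    (r∈S : Is (S r))
    (es-complete : ∀ (f g : Fin n → Bool) (q : ℕ) → (∀ {v} → Is (f v) → Is (S v)) → (∀ {v} → Is (g v) → Is (S v)) → q < n →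
                   ∃[ A ] ∃[ C ] (A , C , q) ∈ es × (∀ v → A v ≡ f v) × (∀ v → C v ≡ g v))
    where

    Reach : (Fin n → Set) → Fin n → Set
    Reach K w = ∃[ y ] (K y × Is (T y)) × Conn T w y

    In : (Fin n → Bool) → Fin n → Fin n → Set
    In D s w = Is (D w) × Is (T w) × w ~ s

    -- An entry must know of the links through finished components, which can no longer be recorded
    -- later. Links through components that still reach `K` may be missing, hence the `¬ Reach` in
    -- `Closed`.
    Marked Closed : (Fin n → Bool) → (Fin n → Set) → Fin n → Set
    Marked D K s = Is (S₁ s) × ∃[ w ] In D s w × Reach K w
    Closed D K s = Is (S₁ s) × ∃[ s′ ] (Is (S₁ s′) × rank s′ < rank s) ×
      ∃[ w ] ∃[ w′ ] In D s w × In D s′ w′ × Conn T w w′ × ¬ Reach K w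

    used : (Fin n → Bool) → ℕ
    used D = count (λ v → D v && T v)

    record Covers (D : Fin n → Bool) (K : Fin n → Set) (e : Entry n) : Set where
      field
        touched : ∀ {s} → Marked D K s → Is (proj₁ e s)
        closed  : ∀ {s} → Closed D K s → Is (proj₁ (proj₂ e) s)
        size    : proj₂ (proj₂ e) ≤ used D

    Comp : (Fin n → Bool) → (Fin n → Set) → List (Entry n) → Set
    Comp D K X = ∃[ e ] e ∈ X × Covers D K e

    -- Tables are filtered from `es`. The completeness proofs always let this entry, which describes
    -- T on `D` without understating, pass the filter.
    record Exact (D : Fin n → Bool) (K : Fin n → Set) : Set where
      field
        e        : Entry n
        e∈       : e ∈ es
        covers   : Covers D K e
        touched⁻ : ∀ {s} → Is (proj₁ e s) → Marked D K s
        closed⁻  : ∀ {s} → Is (proj₁ (proj₂ e) s) → Closed D K s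
        size⁻    : used D ≤ proj₂ (proj₂ e)

    abstract
      exact : ∀ {D K} → Decidable K → (∀ {v} → Is (D v) → S v ≡ false) → Exact D K
      exact {D} {K} K? D⊆H = record
        { e        = A , C , used D
        ; e∈       = e∈
        ; covers   = record
          { touched = λ {s} p → trans (A≡ s) (dec-true (touched? s) p)
          ; closed  = λ {s} p → trans (C≡ s) (dec-true (closed? s) p)
          ; size    = ≤-refl
          }
        ; touched⁻ = λ {s} p → does⇒ (touched? s) (trans (sym (A≡ s)) p)
        ; closed⁻  = λ {s} p → does⇒ (closed? s) (trans (sym (C≡ s)) p)
        ; size⁻    = ≤-refl
        }
        where
        is? : ∀ b → Dec (Is b)
        is? b = b ≟ᵇ true
        reach? : Decidable (Reach K)
        reach? w = any? λ y → (K? y ×-dec is? (T y)) ×-dec conn? w y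
        in? : ∀ s → Decidable (In D s)
        in? s w = is? (D w) ×-dec is? (T w) ×-dec (w ~? s)
        touched? : Decidable (Marked D K)
        touched? s = is? (S₁ s) ×-dec any? λ w → in? s w ×-dec reach? w
        closed? : Decidable (Closed D K)
        closed? s = is? (S₁ s) ×-dec any? λ s′ → (is? (S₁ s′) ×-dec (rank s′ <? rank s)) ×-dec
          any? λ w → any? λ w′ → in? s w ×-dec in? s′ w′ ×-dec conn? w w′ ×-dec ¬? (reach? w)
        -- The costs in `es` stop below `n`. This is enough because `r` is not in `D`.
        few : used D < n
        few = ≤-trans (count-< {f = λ v → D v && T v} {λ _ → true} (λ _ _ → refl) {r}
          (¬Is⇒false λ p → true≢false r∈S (D⊆H (proj₁ (&&⁻ {D r} p)))) refl) (≤-reflexive (count-all n))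
        found : ∃[ A ] ∃[ C ] (A , C , used D) ∈ es × (∀ v → A v ≡ does (touched? v)) × (∀ v → C v ≡ does (closed? v))
        found = es-complete (λ s → does (touched? s)) (λ s → does (closed? s)) (used D)
          (λ {s} p → S₁⇒ (proj₁ (does⇒ (touched? s) p))) (λ {s} p → S₁⇒ (proj₁ (does⇒ (closed? s) p))) few
        A C : Fin n → Bool
        A  = proj₁ found
        C  = proj₁ (proj₂ found)
        e∈ : (A , C , used D) ∈ es
        e∈ = proj₁ (proj₂ (proj₂ found))
        A≡ : ∀ v → A v ≡ does (touched? v)
        A≡ = proj₁ (proj₂ (proj₂ (proj₂ found)))
        C≡ : ∀ v → C v ≡ does (closed? v)
        C≡ = proj₂ (proj₂ (proj₂ (proj₂ found)))

    comp-start : ∀ {K o} → Decidable K → Comp (λ _ → false) K (start o)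
    comp-start K? = e , filt⁺ e∈ (allV⁺ λ v → &&⁺ (neg⁺ (¬Is⇒false λ p → empty {s = v} (touched⁻ {v} p)))
                                                  (neg⁺ (¬Is⇒false λ p → empty′ {s = v} (closed⁻ {v} p)))) , covers
      where
      open Exact (exact {λ _ → false} K? λ ())
      empty : ∀ {K s} → ¬ Marked (λ _ → false) K s
      empty (_ , _ , (() , _) , _)
      empty′ : ∀ {K s} → ¬ Closed (λ _ → false) K s
      empty′ (_ , _ , _ , _ , _ , (() , _) , _)

    -- A path of H[T] that leaves `D₂` shows that its component reaches `K₂`, which lies in `K₁`. So
    -- a component finished with respect to `K₁` cannot meet both regions, and its links are known
    -- to one of the two entries.
    comp-join : ∀ {D₁ D₂ K₁ K₂ X Y o} → Decidable K₁ →
      (∀ {v} → Is (D₁ v) → S v ≡ false) → (∀ {v} → Is (D₂ v) → S v ≡ false) →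
      (∀ {v} → Is (D₁ v) → Is (D₂ v) → ⊥) → (∀ {y} → K₂ y → K₁ y) → (∀ {y} → K₁ y → ¬ Is (D₂ y)) →
      (∀ {w u} → Is (D₂ w) → Is (T w) → Conn T w u → Is (D₂ u) ⊎ Reach K₂ w) →
      Comp D₁ K₁ (X o) → Comp D₂ K₂ (Y o) → Comp (λ v → D₁ v || D₂ v) K₁ (merge X Y o)
    comp-join {D₁} {D₂} {K₁} {K₂} K? H₁ H₂ disjoint K₂⊆ K₁∩D₂ exit (e₁ , e₁∈ , c₁) (e₂ , e₂∈ , c₂) =
      e , filt⁺ e∈ (any⁺ e₁∈ (any⁺ e₂∈ (&&⁺ (allV⁺ λ v → &&⁺ (⇒⁺ (joinA v)) (⇒⁺ (joinC v))) (≤ᵇ⁺ small)))) , covers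
      where
      D : Fin n → Bool
      D v = D₁ v || D₂ v
      D⊆H : ∀ {v} → Is (D v) → S v ≡ false
      D⊆H {v} p with ||⁻ {D₁ v} p
      ... | inj₁ q = H₁ q
      ... | inj₂ q = H₂ q
      open Exact (exact {D} {K₁} K? D⊆H)
      module C₁ = Covers c₁
      module C₂ = Covers c₂
      reach₂ : ∀ {w y} → Is (D₂ w) → Is (T w) → ¬ Is (D₂ y) → Conn T w y → Reach K₂ w
      reach₂ d t ¬d c with exit d t c
      ... | inj₁ d′ = contradiction d′ ¬d
      ... | inj₂ p  = p
      reach₁ : ∀ {w} → Reach K₂ w → Reach K₁ w
      reach₁ (y , (k , t) , c) = y , (K₂⊆ k , t) , c
      joinA : ∀ v → Is (proj₁ e v) → Is (proj₁ e₁ v || proj₁ e₂ v)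
      joinA v p with touched⁻ p
      ... | a , w , (d , t , w~v) , (y , (k , ty) , c) with ||⁻ {D₁ w} d
      ...   | inj₁ d = ||⁺ˡ (C₁.touched (a , w , (d , t , w~v) , (y , (k , ty) , c)))
      ...   | inj₂ d = ||⁺ʳ {proj₁ e₁ v} (C₂.touched (a , w , (d , t , w~v) , reach₂ d t (K₁∩D₂ k) c))
      joinC : ∀ v → Is (proj₁ (proj₂ e) v) → Is (proj₁ (proj₂ e₁) v || proj₁ (proj₂ e₂) v)
      joinC v p with closed⁻ p
      ... | a , s , as , w , w′ , (d , t , w~v) , (d′ , t′ , w′~s) , c , ¬reach
        with ||⁻ {D₁ w} d | ||⁻ {D₁ w′} d′
      ...   | inj₁ d | inj₁ d′ = ||⁺ˡ (C₁.closed (a , s , as , w , w′ , (d , t , w~v) , (d′ , t′ , w′~s) , c , ¬reach))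
      ...   | inj₂ d | inj₂ d′ = ||⁺ʳ {proj₁ (proj₂ e₁) v}
        (C₂.closed (a , s , as , w , w′ , (d , t , w~v) , (d′ , t′ , w′~s) , c , λ p → ¬reach (reach₁ p)))
      ...   | inj₂ d | inj₁ d′ = contradiction (reach₁ (reach₂ d t (disjoint d′) c)) ¬reach
      ...   | inj₁ d | inj₂ d′ with reach₁ (reach₂ d′ t′ (disjoint d) (reverse c))
      ...     | y , k , c′ = contradiction (y , k , c ◅◅ c′) ¬reach
      small : proj₂ (proj₂ e₁) + proj₂ (proj₂ e₂) ≤ proj₂ (proj₂ e)
      small = ≤-trans (+-mono-≤ C₁.size C₂.size) (≤-trans (≤-reflexive (sym
        (count-disjoint {f = λ v → D₁ v && T v} {λ v → D₂ v && T v} {λ v → D v && T v} split))) size⁻)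
        where
        split : ∀ v → toℕ₂ (D v && T v) ≡ toℕ₂ (D₁ v && T v) + toℕ₂ (D₂ v && T v)
        split v with D₁ v in eq₁ | D₂ v in eq₂ | T v
        ... | true  | true  | _     = ⊥-elim (disjoint eq₁ eq₂)
        ... | true  | false | true  = refl
        ... | true  | false | false = refl
        ... | false | _     | _     = refl

    module _ {alive top own} (inv : Inv alive top own) where
      open Inv inv

      -- Edges between dead vertices stay within a class, so a path can leave it only for a living
      -- vertex, and by `near` that vertex is a neighbour of the representative.
      exit : ∀ {c w u} → Is (top c) → Is (dom alive own c w) → Is (T w) → Conn T w u →
             Is (dom alive own c u) ⊎ Reach (Nbr alive c) w
      exit t d Tw ε = inj₁ d
      exit {c} {w} t d Tw ((hw , e , hv@(Hv , Tv)) ◅ p) with dom⁻ d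
      ... | dead , refl with alive _ in eq
      ...   | true  = inj₂ (_ , ((eq , near dead eq e) , Tv) , edge hw e hv)
      ...   | false with exit t (dom⁺ (Hv , eq) (sym (same dead (Hv , eq) e))) Tv p
      ...     | inj₁ q             = inj₁ q
      ...     | inj₂ (y , k , c)   = inj₂ (y , k , (hw , e , hv) ◅ c)

      module _ (ch : Fin n → Bool) (ch⇒top : ∀ {c} → Is (ch c) → Is (top c)) (B : Fin n → Set)
               (B? : Decidable B) (B⊇ : ∀ {c y} → Is (ch c) → Nbr alive c y → B y)
               (B-alive : ∀ {y} → B y → Is (alive y)) (W : Fin n → Table n) where
        open Pull inv ch ch⇒top B B⊇ B-alive W

        comp-pull : ∀ {o} → (∀ {c} → Is (ch c) → Comp (dom alive own c) (Nbr alive c) (W c o)) →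
                    ∀ cs → Unique cs → Comp (U cs) B (merged cs o)
        comp-pull {o} W-comp [] _ = comp-start {B} {o} B?
        comp-pull W-comp (c ∷ cs) (∉ ∷ uniq) with ch c in eq
        ... | false = comp-pull W-comp cs uniq
        ... | true  = comp-join {D₁ = U cs} {dom alive own c} {B} {Nbr alive c} {merged cs} {W c} B?
          (λ p → proj₁ (proj₁ (U-own {cs} p))) (λ p → proj₁ (proj₁ (dom⁻ p))) (U-disjoint ∉) (B⊇ eq)
          (λ b p → true≢false (B-alive b) (proj₂ (proj₁ (dom⁻ p)))) (exit (ch⇒top eq))
          (comp-pull W-comp cs uniq) (W-comp eq)

    Proper : (Fin n → Set) → Fin n → Set
    Proper K o = (∀ {y} → K y → T y ≡ false → y ≡ o) × (K o → T o ≡ false)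

    module _ (alive D : Fin n → Bool) (x : Fin n) (x-H : S x ≡ false) (x∉D : ¬ Is (D x))
             (D⊆H : ∀ {v} → Is (D v) → S v ≡ false)
             (alive⇒ : ∀ {v} → Is (alive v) → S v ≡ false) (X : Table n)
             (exit⁺ : ∀ {w u} → Is ((w == x) || D w) → Is (T w) → Conn T w u →
                      Is ((u == x) || D u) ⊎ Reach (Nbr alive x) w) where
      open Forget alive D x x-H x∉D alive⇒ X

      K? : Decidable K
      K? y = (alive y ≟ᵇ true) ×-dec (x ~? y)

      D⁺⊆H : ∀ {v} → Is (D⁺ v) → S v ≡ false
      D⁺⊆H p with D⁺⁻ p
      ... | inj₁ refl = x-H
      ... | inj₂ q    = D⊆H q

      module _ {o : Fin n} (proper : Proper K o) where
        open Exact (exact {D⁺} {K} K? D⁺⊆H)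

        -- All neighbours of `x` are in T, so the test passes. As `x` is not in T, reaching `B` and
        -- reaching `K` mean the same, and marks and finished links do not change.
        comp-omit : T x ≡ false → Comp D B (X x) → Comp D⁺ K (forget alive x X o)
        comp-omit Tx (e₁ , e₁∈ , c₁) = e , filt⁺ e∈ (||⁺ˡ
          (&&⁺ (allV⁺ λ v → ⇒⁺ λ p → neg⁺ (¬Is⇒false λ e → allowed v (&&⁻ {S v} p) (adj⁻ e)))
          (&&⁺ (neg⁺ (¬Is⇒false λ p → let a , b = &&⁻ {alive o} p in K-o (a , adj⁻ b)))
          (any⁺ e₁∈ (&&⁺ (allV⁺ λ v → &&⁺ (⇒⁺ λ p → C₁.touched {v} (shrinkA (touched⁻ {v} p)))
                                          (⇒⁺ λ p → C₁.closed {v} (shrinkC (closed⁻ {v} p))))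
                         (≤ᵇ⁺ (≤-trans C₁.size (≤-trans more size⁻)))))))) , covers
          where
          module C₁ = Covers c₁
          nbr∈T : ∀ {v} → x ~ v → Is (T v)
          nbr∈T e with T-cover e
          ... | inj₁ t = contradiction t (false⇒¬Is Tx)
          ... | inj₂ t = t
          allowed : ∀ v → Is (S v) × Is (neg (S₁ v)) → ¬ x ~ v
          allowed v (a , b) e = true≢false (⇒S₁ a (nbr∈T e)) (neg⁻ b)
          K-o : ¬ K o
          K-o k = true≢false (nbr∈T (proj₂ k)) (proj₂ proper k)
          old : ∀ {s w} → In D⁺ s w → In D s w
          old (d , t , e) with D⁺⁻ d
          ... | inj₁ refl = contradiction t (false⇒¬Is Tx)
          ... | inj₂ d    = d , t , e
          shrinkA : ∀ {s} → Marked D⁺ K s → Marked D B s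
          shrinkA (a , w , i , y , (k , t) , c) = a , w , old i , y , (inj₂ k , t) , c
          shrinkC : ∀ {s} → Closed D⁺ K s → Closed D B s
          shrinkC (a , s′ , b , w , w′ , i , i′ , c , ¬reach) =
            a , s′ , b , w , w′ , old i , old i′ , c , λ where
              (_ , (inj₁ refl , t) , _) → contradiction t (false⇒¬Is Tx)
              (y , (inj₂ k , t) , c′)   → ¬reach (y , (k , t) , c′)
          more : used D ≤ used D⁺
          more = count-≤ λ v p → let a , b = &&⁻ {D v} p in &&⁺ (D⊆D⁺ a) b

        -- The only component that can become finished is that of `x`. Its links lie within `A⁺`,
        -- where `linkable` finds them; every other finished component was finished before.
        comp-take : Is (T x) → Comp D B (X o) → Comp D⁺ K (forget alive x X o)
        comp-take Tx (e₁ , e₁∈ , c₁) = e , filt⁺ e∈ (||⁺ʳ {omits alive x o X e}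
          (any⁺ e₁∈ (&&⁺ (allV⁺ λ v → ⇒⁺ (closes v)) (&&⁺ (≤ᵇ⁺ (≤-trans (s≤s C₁.size) (≤-trans more size⁻))) escape)))) , covers
          where
          module C₁ = Covers c₁
          A⁺ : Fin n → Bool
          A⁺ v = proj₁ e₁ v || (S₁ v && adj x v)
          toA⁺ : ∀ {s w} → Is (S₁ s) → In D⁺ s w → Conn T w x → Is (A⁺ s)
          toA⁺ {s} a (d , t , w~s) c with D⁺⁻ d
          ... | inj₁ refl = ||⁺ʳ {proj₁ e₁ s} (&&⁺ a (adj⁺ w~s))
          ... | inj₂ d    = ||⁺ˡ (C₁.touched (a , _ , (d , t , w~s) , x , (inj₁ refl , Tx) , c))
          from-K : ∀ {y} → K y → Is (T y) → Conn T y x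
          from-K (y-alive , x~y) t = edge (alive⇒ y-alive , t) (~-sym x~y) (x-H , Tx)
          A⇒A⁺ : ∀ v → Is (proj₁ e v) → Is (A⁺ v)
          A⇒A⁺ v p with touched⁻ p
          ... | a , w , i , y , (k , t) , c = toA⁺ a i (c ◅◅ from-K k t)
          closes : ∀ v → Is (proj₁ (proj₂ e) v) → Is (proj₁ (proj₂ e₁) v || linkable A⁺ v)
          closes v p with closed⁻ p
          ... | a , s′ , (b , lt) , w , w′ , i , i′ , c , ¬reach with conn? w x
          ...   | yes wx = ||⁺ʳ {proj₁ (proj₂ e₁) v} (&&⁺ (toA⁺ a i wx)
            (anyV⁺ s′ (&&⁺ (toA⁺ b i′ (reverse c ◅◅ wx)) (≤ᵇ⁺ lt))))
          ...   | no ¬wx = ||⁺ˡ (C₁.closed (a , s′ , (b , lt) , w , w′ , old ¬wx i ,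
            old (λ w′x → ¬wx (c ◅◅ w′x)) i′ , c , λ where
              (_ , (inj₁ refl , _) , c′) → ¬wx c′
              (y , (inj₂ k , t) , c′)    → ¬reach (y , (k , t) , c′)))
            where
            old : ∀ {s w} → ¬ Conn T w x → In D⁺ s w → In D s w
            old ¬c (d , t , e) with D⁺⁻ d
            ... | inj₁ refl = contradiction ε ¬c
            ... | inj₂ d    = d , t , e
          more : suc (used D) ≤ used D⁺
          more = ≤-reflexive (trans (cong (_+ used D) (sym (count-single {f = λ v → v == x} x (==⁺ {i = x} refl) λ v p → ==⁻ p)))
            (sym (count-disjoint {f = λ v → v == x} {λ v → D v && T v} {λ v → D⁺ v && T v} split)))
            where
            split : ∀ v → toℕ₂ (D⁺ v && T v) ≡ toℕ₂ (v == x) + toℕ₂ (D v && T v)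
            split v with v == x in eq
            ... | false = refl
            ... | true with refl ← ==⁻ {i = v} {x} eq rewrite Tx | ¬Is⇒false x∉D = refl
          escape : Is (((any vs λ y → alive y && adj x y && neg (y == o)) && (all vs λ v → proj₁ e v ⇒ A⁺ v))
                       || (any vs A⁺ && (all vs λ v → neg (proj₁ e v))))
          escape with any vs (λ y → alive y && adj x y && neg (y == o)) in eq
          ... | true  = ||⁺ˡ (allV⁺ λ v → ⇒⁺ (A⇒A⁺ v))
          ... | false = &&⁺ some (allV⁺ λ v → neg⁺ (¬Is⇒false λ p → none v (touched⁻ {v} p)))
            where
            K∩T : ∀ {y} → K y → ¬ Is (T y)
            K∩T {y} k@(a , b) t = true≢false (anyV⁺ y (&&⁺ a (&&⁺ (adj⁺ b) (neg⁺ (≠⁺ {i = y} {o} λ { refl →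
              true≢false t (proj₂ proper k) }))))) eq
            none : ∀ v → ¬ Marked D⁺ K v
            none v (_ , _ , _ , _ , (k , t) , _) = K∩T k t
            some : Is (any vs A⁺)
            some with ground (x-H , Tx)
            ... | w′ , s , ((_ , t) , e) , a , c with exit⁺ x∈D⁺ Tx c
            ...   | inj₁ d = anyV⁺ s (toA⁺ a (d , t , e) (reverse c))
            ...   | inj₂ (y , (k , ty) , _) = contradiction ty (K∩T k)

    comp-≈ : ∀ {D D′ K K′ X} → (∀ v → D v ≡ D′ v) → (∀ {y} → K y → K′ y) → (∀ {y} → K′ y → K y) →
             Comp D K X → Comp D′ K′ X
    comp-≈ {D} {D′} {K} {K′} eq K⇒ K⇐ (e , e∈ , c) = e , e∈ , record
      { touched = λ (a , w , i , p) → touched (a , w , in⇐ i , reach⇐ p)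
      ; closed  = λ (a , s , b , w , w′ , i , i′ , p , q) →
          closed (a , s , b , w , w′ , in⇐ i , in⇐ i′ , p , λ z → q (reach⇒ z))
      ; size    = ≤-trans size (≤-reflexive (count-cong λ v → cong (_&& T v) (eq v)))
      }
      where
      open Covers c
      in⇐ : ∀ {s w} → In D′ s w → In D s w
      in⇐ {w = w} (d , rest) = trans (eq w) d , rest
      reach⇐ : ∀ {w} → Reach K′ w → Reach K w
      reach⇐ (y , (k , t) , p) = y , (K⇐ k , t) , p
      reach⇒ : ∀ {w} → Reach K w → Reach K′ w
      reach⇒ (y , (k , t) , p) = y , (K⇒ k , t) , p

    -- The index `r`, never a clique vertex, serves for cliques that T contains entirely.
    TableComplete : Property
    TableComplete alive own W c = ∀ {o} → Is (alive o) ⊎ o ≡ r → Proper (Nbr alive c) o →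
                                  Comp (dom alive own c) (Nbr alive c) (W c o)

    comp-eliminate : Preserved TableComplete
    comp-eliminate {p} good {x} x-alive simp = record { own = own′ ; inv = inv′ ; holds = holds′ _ }
      where
      open Good good
      open Step inv x-alive simp W
      x-H = Inv.alive⇒ inv x-alive
      X = pull ch W

      B? : Decidable B
      B? y = (y ≟ x) ⊎-dec ((alive y ≟ᵇ true) ×-dec (x ~? y))

      D⁺-H : ∀ {v} → Is (children v) → S v ≡ false
      D⁺-H q = proj₁ (proj₁ (children⁻ q))

      exit⁺ : ∀ {w u} → Is ((w == x) || children w) → Is (T w) → Conn T w u →
              Is ((u == x) || children u) ⊎ Reach (Nbr alive x) w
      exit⁺ {w} {u} d t c with exit inv′ top′-x (trans (sym (D⁺≡ w)) d) t c
      ... | inj₁ d′                = inj₁ (trans (D⁺≡ u) d′)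
      ... | inj₂ (y , (k , t) , c) = inj₂ (y , (K⇐ k , t) , c)

      pulled : ∀ {o} → Is (alive o) ⊎ o ≡ r → Proper B o → Comp children B (X o)
      pulled live (f , g) = comp-pull inv ch ch⇒top B B? B⊇ B-alive W
        (λ q → holds (ch⇒top q) live ((λ k → f (B⊇ q k)) , λ k → g (B⊇ q k))) vs unique

      x≢r : x ≢ r
      x≢r refl = true≢false r∈S x-H

      new : ∀ {c} → c ≡ x → ∀ {o} → Is (alive′ o) ⊎ o ≡ r → Proper (Nbr alive′ c) o →
            Comp (dom alive′ own′ c) (Nbr alive′ c) (forget alive x X o)
      new refl {o} live (f , g) = comp-≈ D⁺≡ K⇒ K⇐ (by-cases (T x) refl)
        where
        proper : Proper (Nbr alive x) o
        proper = (λ k → f (K⇒ k)) , λ k → g (K⇒ k)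
        live⇒ : Is (alive′ o) ⊎ o ≡ r → (Is (alive o) ⊎ o ≡ r) × o ≢ x
        live⇒ (inj₁ a)    = inj₁ (proj₁ (alive′⁻ a)) , proj₂ (alive′⁻ a)
        live⇒ (inj₂ refl) = inj₂ refl , λ eq → x≢r (sym eq)
        by-cases : ∀ b → T x ≡ b → Comp (λ v → (v == x) || children v) (Nbr alive x) (forget alive x X o)
        by-cases true Tx = comp-take alive children x x-H x∉ D⁺-H (Inv.alive⇒ inv) X exit⁺ proper Tx
          (pulled (proj₁ (live⇒ live))
            ((λ { (inj₁ refl) ¬t → true≢false Tx ¬t ; (inj₂ k) → proj₁ proper k }) ,
             λ { (inj₁ o≡x) → contradiction o≡x (proj₂ (live⇒ live)) ; (inj₂ k) → proj₂ proper k }))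
        -- The children are read at index `x`: every other vertex of `B` is a neighbour of `x` and
        -- hence in T.
        by-cases false Tx = comp-omit alive children x x-H x∉ D⁺-H (Inv.alive⇒ inv) X exit⁺ proper Tx
          (pulled (inj₁ x-alive)
            ((λ { (inj₁ eq) _ → eq ; (inj₂ (_ , e)) ¬t → ⊥-elim (uncovered (T-cover e) ¬t) }) , λ _ → Tx))
          where
          uncovered : ∀ {y} → Is (T x) ⊎ Is (T y) → T y ≡ false → ⊥
          uncovered (inj₁ t) _  = true≢false t Tx
          uncovered (inj₂ t) ¬t = true≢false t ¬t

      old : ∀ {c} → (c == x) ≡ false → Is (top′ c) → ∀ {o} → Is (alive′ o) ⊎ o ≡ r → Proper (Nbr alive′ c) o →
            Comp (dom alive′ own′ c) (Nbr alive′ c) (W c o)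
      old eq t live (f , g) with top′⁻ t
      ... | inj₁ c≡x = contradiction c≡x (≠⁻ eq)
      ... | inj₂ (t , ≁x , c≢x) = comp-≈ (dom′-old t ≁x c≢x) (K⇒-old ≁x) K⇐
        (holds t (live⇒ live) ((λ k → f (K⇒-old ≁x k)) , λ k → g (K⇒-old ≁x k)))
        where
        live⇒ : ∀ {o} → Is (alive′ o) ⊎ o ≡ r → Is (alive o) ⊎ o ≡ r
        live⇒ (inj₁ a)  = inj₁ (proj₁ (alive′⁻ a))
        live⇒ (inj₂ eq) = inj₂ eq

      select : ∀ {c} b → (c == x) ≡ b → Is (top′ c) → ∀ {o} → Is (alive′ o) ⊎ o ≡ r → Proper (Nbr alive′ c) o →
               Comp (dom alive′ own′ c) (Nbr alive′ c) ((if b then forget alive x X else W c) o)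
      select true  eq t = new (==⁻ eq)
      select false eq t = old eq t

      holds′ : ∀ c → Is (top′ c) → TableComplete alive′ own′ (proj₂ (proj₂ (eliminate x p))) c
      holds′ c t = select (c == x) refl t

    module _ (Tr : Is (T r)) (S₁⊆T : ∀ {v} → Is (S₁ v) → Is (T v)) (small : count T ≤ l)
             (lower : ∀ {s} → Is (S₁ s) → s ≢ r →
               (∃[ s′ ] Is (S₁ s′) × s ~ s′ × rank s′ < rank s) ⊎ Linked T s) where

      -- With no living vertex every component counts as finished, so every link given by `lower` is
      -- in the final entry.
      succeeds-complete : ∀ {p} → Good TableComplete p → (∀ v → proj₁ p v ≡ false) → Is (succeeds-from p)
      succeeds-complete {p} good dead = &&⁺ plausible′ (any⁺ e∈ (&&⁺ (allV⁺ λ v → ⇒⁺ (covered v)) (≤ᵇ⁺ enough)))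
        where
        open Final good dead
        none : ∀ {c y} → ¬ Nbr alive c y
        none (a , _) = true≢false a (dead _)
        final : Comp everything (λ _ → ⊥) (pull top W r)
        final = comp-pull inv top id (λ _ → ⊥) (λ _ → no λ ()) (λ _ → none) (λ ()) W
          (λ t → holds t (inj₂ refl) ((λ k → ⊥-elim (none k)) , λ k → ⊥-elim (none k))) vs unique
        e = proj₁ final
        e∈ = proj₁ (proj₂ final)
        C : Fin n → Bool
        C = proj₁ (proj₂ e)
        open Covers (proj₂ (proj₂ final))
        covered : ∀ v → Is (S₁ v) → Is ((v == r) || C v || any vs λ u → S₁ u && adj v u && rank u <ᵇ rank v)
        covered v p with v ≟ r
        ... | yes eq = ||⁺ˡ (==⁺ eq)
        ... | no v≢r with lower p v≢r
        ...   | inj₁ (u , q , e , lt) =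
          ||⁺ʳ {v == r} (||⁺ʳ {C v} (anyV⁺ u (&&⁺ q (&&⁺ (adj⁺ e) (≤ᵇ⁺ lt)))))
        ...   | inj₂ (u , q , lt , w , w′ , ((Hw , t) , i) , ((Hw′ , t′) , i′) , c) =
          ||⁺ʳ {v == r} (||⁺ˡ (closed (p , u , (q , lt) , w , w′ ,
            (everything⁺ Hw , t , i) , (everything⁺ Hw′ , t′ , i′) , c , λ { (_ , (() , _) , _) })))
        enough : proj₂ (proj₂ e) + count S₁ ≤ l
        enough = ≤-trans (+-monoˡ-≤ (count S₁) size) (≤-trans (≤-reflexive (sym
          (count-disjoint {f = λ v → everything v && T v} {S₁} {T} split))) small)
          where
          split : ∀ v → toℕ₂ (T v) ≡ toℕ₂ (everything v && T v) + toℕ₂ (S₁ v)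
          split v with S v in eq
          ... | true  rewrite ¬Is⇒false {everything v} (λ d → true≢false eq (everything⁻ d)) =
            cong toℕ₂ (bool-ext (⇒S₁ eq) S₁⊆T)
          ... | false rewrite everything⁺ eq | ¬Is⇒false {S₁ v} (λ p → true≢false (S₁⇒ p) eq) =
            sym (+-identityʳ (toℕ₂ (T v)))
        plausible′ : Is plausible
        plausible′ = &&⁺ (⇒S₁ r∈S Tr) (&&⁺ (allV⁺ λ v → ⇒⁺ (S₁⇒ {v})) (allV⁺ λ u → allV⁺ λ v → ⇒⁺ λ p →
          let p , q = &&⁻ {S u && neg (S₁ u)} p
              Su , ¬u = &&⁻ {S u} p
              Sv , ¬v = &&⁻ {S v} q
          in neg⁺ (¬Is⇒false λ e → independent (T-cover (adj⁻ {u} {v} e)) Su (neg⁻ ¬u) Sv (neg⁻ ¬v))))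
          where
          independent : ∀ {u v} → Is (T u) ⊎ Is (T v) → Is (S u) → S₁ u ≡ false → Is (S v) → S₁ v ≡ false → ⊥
          independent (inj₁ t) Su ¬u _ _ = true≢false (⇒S₁ Su t) ¬u
          independent (inj₂ t) _ _ Sv ¬v = true≢false (⇒S₁ Sv t) ¬v

-- Rankings from trees rooted at r

module Rank {n} (R : Fin n → Fin n → Set) (M : Fin n → Bool) (r : Fin n) where

  Path : Fin n → Fin n → Set
  Path = Star λ s s′ → Is (M s) × R s s′ × Is (M s′)

  -- A tree rooted at r in which every vertex but r has an R-successor that was
  -- inserted earlier; the rank of a vertex is the number of its predecessors.
  record Tree : Set where
    field
      Z     : Fin n → Bool
      rank  : Fin n → ℕ
      root∈ : Is (Z r)
      Z⊆M   : ∀ {z} → Is (Z z) → Is (M z)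
      rank< : ∀ {z} → Is (Z z) → rank z < count Z
      lower : ∀ {z} → Is (Z z) → z ≢ r → ∃[ z′ ] Is (Z z′) × R z z′ × rank z′ < rank z

  single : Is (M r) → Tree
  single Mr = record
    { Z     = λ v → v == r
    ; rank  = λ _ → 0
    ; root∈ = ==⁺ {i = r} refl
    ; Z⊆M   = λ {z} p → subst (Is ∘ M) (sym (==⁻ {i = z} p)) Mr
    ; rank< = λ _ → ≤-reflexive (sym (count-single {f = _== r} r (==⁺ {i = r} refl) λ v → ==⁻))
    ; lower = λ p z≢r → contradiction (==⁻ p) z≢r
    }

  insert : ∀ t {s z} → Is (M s) → Tree.Z t s ≡ false → Is (Tree.Z t z) → R s z →
           ∃[ t′ ] (∀ {v} → Is (Tree.Z t v) → Is (Tree.Z t′ v)) × Is (Tree.Z t′ s)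
  insert t {s} {z} Ms s∉ z∈ sz = record
    { Z     = Z′
    ; rank  = rank′
    ; root∈ = old root∈
    ; Z⊆M   = Z′⊆M
    ; rank< = rank′<
    ; lower = lower′
    } , old , new
    where
    open Tree t
    Z′ : Fin n → Bool
    Z′ v = (v == s) || Z v
    rank′ : Fin n → ℕ
    rank′ v = if v == s then count Z else rank v
    old : ∀ {v} → Is (Z v) → Is (Z′ v)
    old {v} = ||⁺ʳ {v == s}
    new : Is (Z′ s)
    new = ||⁺ˡ (==⁺ {i = s} refl)
    rank-old : ∀ {v} → Is (Z v) → rank′ v ≡ rank v
    rank-old {v} p rewrite ≠⁺ {i = v} {s} (λ { refl → true≢false p s∉ }) = refl
    count-Z′ : count Z < count Z′
    count-Z′ = count-< {f = Z} {Z′} (λ v → old) {s} s∉ new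
    Z′⊆M : ∀ {v} → Is (Z′ v) → Is (M v)
    Z′⊆M {v} p with ||⁻ {v == s} p
    ... | inj₁ q = subst (Is ∘ M) (sym (==⁻ {i = v} q)) Ms
    ... | inj₂ q = Z⊆M q
    rank′< : ∀ {v} → Is (Z′ v) → rank′ v < count Z′
    rank′< {v} p with v == s in eq
    ... | true  = count-Z′
    ... | false = ≤-trans (rank< p) (≤-trans (n≤1+n _) count-Z′)
    lower′ : ∀ {v} → Is (Z′ v) → v ≢ r → ∃[ v′ ] Is (Z′ v′) × R v v′ × rank′ v′ < rank′ v
    lower′ {v} p v≢r with v == s in eq
    ... | true  with refl ← ==⁻ {i = v} {s} eq = z , old z∈ , sz , subst (_< count Z) (sym (rank-old z∈)) (rank< z∈)
    ... | false =
      let z′ , q , e , lt = lower p v≢r in z′ , old q , e , subst (_< rank v) (sym (rank-old q)) lt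

  -- The rest of the path is settled first, so the successor of `s` is in the tree, with a smaller
  -- rank, when `s` is inserted.
  settle : ∀ t {s} → Path s r →
           ∃[ t′ ] (∀ {v} → Is (Tree.Z t v) → Is (Tree.Z t′ v)) × Is (Tree.Z t′ s)
  settle t ε = t , id , Tree.root∈ t
  settle t {s} ((Ms , sz , _) ◅ p) with settle t p
  ... | t′ , ⊆ , z∈ with Tree.Z t′ s in eq
  ...   | true  = t′ , ⊆ , eq
  ...   | false = let t″ , ⊆′ , s∈ = insert t′ Ms eq z∈ sz in t″ , (λ p → ⊆′ (⊆ p)) , s∈

  settleAll : Is (M r) → (∀ {s} → Is (M s) → Path s r) → ∀ xs →
              ∃[ t ] (∀ {s} → s ∈ xs → Is (M s) → Is (Tree.Z t s))
  settleAll Mr paths [] = single Mr , λ ()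
  settleAll Mr paths (x ∷ xs) with settleAll Mr paths xs
  ... | t , done with M x in eq
  ...   | false = t , λ { (here refl) p → ⊥-elim (true≢false p eq) ; (there s∈) p → done s∈ p }
  ...   | true  = let t′ , ⊆ , x∈ = settle t (paths eq) in
    t′ , λ { (here refl) _ → x∈ ; (there s∈) p → ⊆ (done s∈ p) }

  ranking : Is (M r) → (∀ {s} → Is (M s) → Path s r) →
            ∃[ rank ] (∀ {s} → Is (M s) → rank s < count M) ×
                      (∀ {s} → Is (M s) → s ≢ r → ∃[ s′ ] Is (M s′) × R s s′ × rank s′ < rank s)
  ranking Mr paths with settleAll Mr paths (vertices n)
  ... | t , done = rank ,
    (λ p → ≤-trans (rank< (in-tree p)) (count-≤ {f = Z} {M} λ v → Z⊆M)) ,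
    λ p s≢r → let s′ , q , e , lt = lower (in-tree p) s≢r in s′ , Z⊆M q , e , lt
    where
    open Tree t
    in-tree : ∀ {s} → Is (M s) → Is (Z s)
    in-tree = done (∈-vertices _)

-- From walks in the cover to links

module Anchors {n} (G : Graph (Fin n)) (S S₁ T : Fin n → Bool) (r : Fin n)
             (S₁⇒T : ∀ {v} → Is (S₁ v) → Is (T v))
             (⇒S₁ : ∀ {v} → Is (S v) → Is (T v) → Is (S₁ v)) where
  open Graph G

  HT : Fin n → Set
  HT w = S w ≡ false × Is (T w)

  Conn : Fin n → Fin n → Set
  Conn = Star λ u w → HT u × u ~ w × HT w

  Link : Fin n → Fin n → Set
  Link s s′ = s ~ s′ ⊎ (∃[ w ] ∃[ w′ ] (HT w × w ~ s) × (HT w′ × w′ ~ s′) × Conn w w′)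

  open Rank Link S₁ r using (Path)

  Anchored : Fin n → Set
  Anchored u = (Is (S u) → Path u r) ×
    (S u ≡ false → ∃[ w ] ∃[ s ] (HT w × w ~ s) × Is (S₁ s) × Conn u w × Path s r)

  -- The visits to `S` cut a walk to `r` into pieces. A run through H between two visits stays in
  -- one component, so it amounts to one link.
  anchor : Is (S r) → ∀ {u} → Star (λ a b → Is (T a) × a ~ b × Is (T b)) u r → Anchored u
  anchor r∈S ε = (λ _ → ε) , λ p → ⊥-elim (true≢false r∈S p)
  anchor r∈S {u} (_◅_ {j = v} (Tu , e , Tv) p) with anchor r∈S p
  ... | in-S , in-H with S v in eq
  ...   | true = (λ Su → (⇒S₁ Su Tu , inj₁ e , ⇒S₁ eq Tv) ◅ in-S refl) ,
                 λ Hu → u , v , ((Hu , Tu) , e) , ⇒S₁ eq Tv , ε , in-S refl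
  ...   | false with in-H refl
  ...     | w , s , ws , a , c , q =
    (λ Su → (⇒S₁ Su Tu , inj₂ (v , w , ((eq , Tv) , ~-sym e) , ws , c) , a) ◅ q) ,
    λ Hu → w , s , ws , a , ((Hu , Tu) , e , (eq , Tv)) ◅ c , q

-- Connected vertex covers with a root

∈⇒Is : ∀ {n} {T : Subset n} {v} → v ∈ˢ T → Is (Vec.lookup T v)
∈⇒Is p = []=⇒lookup p

Is⇒∈ : ∀ {n} {T : Subset n} {v} → Is (Vec.lookup T v) → v ∈ˢ T
Is⇒∈ {T = T} {v} p = lookup⇒[]= v T p

record RootedCover {n} (G : Graph (Fin n)) (l : ℕ) (T : Fin n → Bool) (r : Fin n) : Set where
  open Graph G
  field
    root∈ : Is (T r)
    cover : ∀ {u v} → u ~ v → Is (T u) ⊎ Is (T v)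
    walk  : ∀ {v} → Is (T v) → Star (λ a b → Is (T a) × a ~ b × Is (T b)) v r
    small : count T ≤ l

module _ {n} (G : Graph (Fin n)) {l : ℕ} where
  open Graph G

  Walk : (Fin n → Bool) → Fin n → Fin n → Set
  Walk T = Star λ a b → Is (T a) × a ~ b × Is (T b)

  toSubset : ∀ (T : Fin n → Bool) r → (∀ {u v} → u ~ v → Is (T u) ⊎ Is (T v)) → (∀ {v} → Is (T v) → Walk T v r) →
             count T ≤ l → HasConnectedVertexCover≤ G l
  toSubset T r cover walk small = U , (cover′ , connected) ,
    ≤-trans (≤-reflexive (trans (sym (count-∣∣ U)) (count-cong (lookup∘tabulate T)))) small
    where
    U : Subset n
    U = Vec.tabulate T
    to : ∀ {v} → Is (T v) → v ∈ˢ U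
    to {v} p = Is⇒∈ (trans (lookup∘tabulate T v) p)
    from : ∀ {v} → v ∈ˢ U → Is (T v)
    from {v} p = trans (sym (lookup∘tabulate T v)) (∈⇒Is p)
    cover′ : VertexCover G U
    cover′ e = Sum.map to to (cover e)
    lift : ∀ {a b} → Walk T a b → (p : a ∈ˢ U) (q : b ∈ˢ U) → Star (Graph._~_ (G [ _∈ˢ U ])) (a , p) (b , q)
    -- A vertex of the induced subgraph carries its proof of membership, so even the empty walk
    -- needs the two proofs to coincide.
    lift ε p q rewrite []=-irrelevant p q = ε
    lift ((_ , e , t) ◅ w) p q = e ◅ lift w (to t) q
    connected : Connected (G [ _∈ˢ U ])
    connected (a , p) (b , q) = lift (walk (from p) ◅◅ Star.reverse (λ (s , e , t) → t , ~-sym e , s) (walk (from q))) p q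

  -- A root needs a non-empty cover. If the given one is empty, there are no edges and a single
  -- vertex does as well; here `l` must be positive.
  fromSubset : .{{NonZero l}} → (v₀ : Fin n) → HasConnectedVertexCover≤ G l → ∃[ T ] ∃[ r ] RootedCover G l T r
  fromSubset v₀ (U , (cover , connected) , small) with nonempty? U
  ... | yes (r , r∈) = Vec.lookup U , r , record
    { root∈ = ∈⇒Is r∈
    ; cover = λ e → Sum.map ∈⇒Is ∈⇒Is (cover e)
    ; walk  = λ {v} p → Star.gmap proj₁ (λ {(a , p)} {(b , q)} e → ∈⇒Is p , e , ∈⇒Is q)
                (connected (v , Is⇒∈ p) (r , r∈))
    ; small = ≤-trans (≤-reflexive (count-∣∣ U)) small
    }
  ... | no empty = (_== v₀) , v₀ , record
    { root∈ = ==⁺ {i = v₀} refl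
    ; cover = λ e → ⊥-elim (edgeless (cover e))
    ; walk  = λ {v} p → subst (λ v → Walk (_== v₀) v v₀) (sym (==⁻ {i = v} p)) ε
    ; small = ≤-trans (≤-reflexive (count-single {f = _== v₀} v₀ (==⁺ {i = v₀} refl) λ v p → ==⁻ p)) (>-nonZero⁻¹ l)
    }
    where
    edgeless : ∀ {u v} → u ∈ˢ U ⊎ v ∈ˢ U → ⊥
    edgeless (inj₁ p) = empty (_ , p)
    edgeless (inj₂ p) = empty (_ , p)

smallNumbers⁺ : ∀ {n k x} → x < n → x ≤ k → x ∈ smallNumbers n k
smallNumbers⁺ {n} {k} {x} x<n x≤k = ∈-concatMap⁺ _ (lose (∈-vertices i) member)
  where
  i = fromℕ< x<n
  member : x ∈ (if toℕ i ≤ᵇ k then toℕ i ∷ [] else [])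
  member rewrite toℕ-fromℕ< x<n | ≤ᵇ⁺ {x} {k} x≤k = here refl

-- Correctness for a fixed root

module Rooted {n} (G : Graph (Fin n)) (S₀ : Subset n) (chordal : ChordalDeletionSet G S₀) (r : Fin n) where
  open Graph G

  S : Fin n → Bool
  S v = Vec.lookup S₀ v || (v == r)

  r∈S : Is (S r)
  r∈S = ||⁺ʳ {Vec.lookup S₀ r} (==⁺ {i = r} refl)

  ∁S⊆ : ∀ {v} → S v ≡ false → v ∈ˢ ∁ S₀
  ∁S⊆ {v} p = x∉p⇒x∈∁p λ q → true≢false (||⁺ˡ (∈⇒Is q)) p

  xs : List (Fin n)
  xs = r ∷ members (Vec.lookup S₀)

  ∈xs : ∀ {v} → Is (S v) → v ∈ xs
  ∈xs {v} p with ||⁻ {Vec.lookup S₀ v} p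
  ... | inj₁ q = there (filt⁺ (∈-vertices v) q)
  ... | inj₂ q = here (==⁻ q)

  count-S : count S ≤ suc (count (Vec.lookup S₀))
  count-S with Vec.lookup S₀ r in eq
  ... | true  = ≤-trans (count-≤ below) (n≤1+n _)
    where
    below : ∀ v → Is (S v) → Is (Vec.lookup S₀ v)
    below v p with ||⁻ {Vec.lookup S₀ v} p
    ... | inj₁ q = q
    ... | inj₂ q = subst (Is ∘ Vec.lookup S₀) (sym (==⁻ {i = v} q)) eq
  ... | false = ≤-reflexive (trans (count-disjoint {f = _== r} {Vec.lookup S₀} {S} split)
      (cong (_+ count (Vec.lookup S₀)) (count-single {f = _== r} r (==⁺ {i = r} refl) λ v → ==⁻)))
    where
    split : ∀ v → toℕ₂ (S v) ≡ toℕ₂ (v == r) + toℕ₂ (Vec.lookup S₀ v)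
    split v with Vec.lookup S₀ v in eq′ | v == r in eq″
    ... | true  | false = refl
    ... | false | b     = sym (+-identityʳ (toℕ₂ b))
    ... | true  | true  = ⊥-elim (true≢false (subst (Is ∘ Vec.lookup S₀) (==⁻ eq″) eq′) eq)

  es : List (Entry n)
  es = entries (subsets xs)

  module _ (S₁ : Fin n → Bool) (rank : Fin n → ℕ) (l : ℕ) where
    open Solve G S S₁ rank es r l
    open Guess (matrix G) S S₁ rank es r l using (simplicial; succeeds; succeeds-def)

    -- Dirac's theorem gives the vertex only under a double negation, but simpliciality is tested by
    -- a Boolean, so the search for it is decidable.
    simplicial-vertex : ∀ alive → (∀ {v} → Is (alive v) → S v ≡ false) → ∀ {v} → Is (alive v) →
                        ∃[ y ] Is (alive y) × SimplicialIn alive y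
    simplicial-vertex alive alive⇒ {v} v-alive =
      let y , a , p = decidable-stable (any? λ y → (alive y ≟ᵇ true) ×-dec (simplicial alive y ≟ᵇ true))
            λ none → Simplicial.simplicial-exists G chordal (λ v → Is (alive v)) (λ v → alive v ≟ᵇ true)
              (λ a → ∁S⊆ (alive⇒ a)) v-alive λ (y , a , cl) →
                none (y , a , simplicial⁺ {alive} {y} λ (pa , ea) (pb , eb) → cl pa pb ea eb)
      in y , a , simplicial⁻ {alive} {y} p

    succeeds⇒ : Is succeeds → HasConnectedVertexCover≤ G l
    succeeds⇒ ok =
      let good , dead = finish-spec r∈S simplicial-vertex TableSound sound-eliminate
          T , cover , walk , small = succeeds-sound good dead (trans (sym succeeds-def) ok)
      in toSubset G T r cover walk small

  entries-enough : ∀ (f g : Fin n → Bool) (q : ℕ) → (∀ {v} → Is (f v) → Is (S v)) → (∀ {v} → Is (g v) → Is (S v)) →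
                   q < n → ∃[ A ] ∃[ C ] (A , C , q) ∈ es × (∀ v → A v ≡ f v) × (∀ v → C v ≡ g v)
  entries-enough f g q f⊆ g⊆ q<n =
    let A , A∈ , A≡ = subsets-complete f xs (λ v p → ∈xs (f⊆ p))
        C , C∈ , C≡ = subsets-complete g xs (λ v p → ∈xs (g⊆ p))
    in A , C , subst (λ q → (A , C , q) ∈ es) (toℕ-fromℕ< q<n) (entries-complete A∈ C∈ (fromℕ< q<n)) , A≡ , C≡

  module _ {l T} (rooted : RootedCover G l T r) where
    open RootedCover rooted

    module _ {S₁ : Fin n → Bool} (S₁≡ : ∀ v → S₁ v ≡ S v && T v) where
      S₁⇒ : ∀ {v} → Is (S₁ v) → Is (S v) × Is (T v)
      S₁⇒ {v} p = &&⁻ {S v} (trans (sym (S₁≡ v)) p)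

      ⇒S₁ : ∀ {v} → Is (S v) → Is (T v) → Is (S₁ v)
      ⇒S₁ {v} p q = trans (S₁≡ v) (&&⁺ p q)

      open Anchors G S S₁ T r (λ p → proj₂ (S₁⇒ p)) ⇒S₁
      open Rank Link S₁ r

      anchored : ∀ {u} → Is (T u) → Anchored u
      anchored t = anchor r∈S (walk t)

      ranked = ranking (⇒S₁ r∈S root∈) (λ p → proj₁ (anchored (proj₂ (S₁⇒ p))) (proj₁ (S₁⇒ p)))
      rank₀ : Fin n → ℕ
      rank₀ = proj₁ ranked

      ks : List ℕ
      ks = smallNumbers n (count (Vec.lookup S₀))

      -- `rank₀` is bounded on `S₁` only; elsewhere the rank is irrelevant and is reset to 0, which
      -- always occurs in `ks`.
      rank₁ : Fin n → ℕ
      rank₁ v = if S₁ v then rank₀ v else 0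

      rank₁∈ : ∀ v → rank₁ v ∈ ks
      rank₁∈ v with S₁ v in eq
      ... | true  = smallNumbers⁺ {k = count (Vec.lookup S₀)} (<-≤-trans lt (≤-trans (count-≤ {f = S₁} {λ _ → true} λ _ _ → refl) (≤-reflexive (count-all n))))
                      (≤-pred (≤-trans lt (≤-trans (count-≤ {f = S₁} {S} λ v p → proj₁ (S₁⇒ p)) count-S)))
        where lt = proj₁ (proj₂ ranked) eq
      ... | false = smallNumbers⁺ {k = count (Vec.lookup S₀)} (≤-trans (s≤s z≤n) (toℕ<n v)) z≤n

      guessed : ∃[ rank ] rank ∈ rankings ks xs × (∀ {v} → Is (S₁ v) → rank v ≡ rank₀ v)
      guessed with growList-complete ks 0 rank₁ xs (λ {v} _ → rank₁∈ v)
      ... | rank , rank∈ , rank≡ = rank , rank∈ , λ {v} p → agree p (rank≡ v)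
        where
        agree : ∀ {v} → Is (S₁ v) → (v ∈ xs × rank v ≡ rank₁ v) ⊎ (¬ v ∈ xs × rank v ≡ 0) → rank v ≡ rank₀ v
        agree {v} p (inj₁ (_ , eq))  rewrite p = eq
        agree {v} p (inj₂ (v∉ , _)) = contradiction (∈xs (proj₁ (S₁⇒ p))) v∉

      rank = proj₁ guessed

      open Guess (matrix G) S S₁ rank es r l using (succeeds; succeeds-def)
      open Solve G S S₁ rank es r l using (finish-spec; module Complete)

      succeeds⇐ : (∀ u v → Dec (Conn u v)) → Is succeeds
      succeeds⇐ conn? =
        let good , dead = finish-spec r∈S (simplicial-vertex S₁ rank l) TableComplete comp-eliminate
        in trans succeeds-def (succeeds-complete root∈ (λ p → proj₂ (S₁⇒ p)) small lower good dead)
        where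
        ground : ∀ {w} → HT w → ∃[ w′ ] ∃[ s ] (HT w′ × w′ ~ s) × Is (S₁ s) × Conn w w′
        ground (Hw , Tw) = let w′ , s , ws , a , c , _ = proj₂ (anchored Tw) Hw in w′ , s , ws , a , c
        open Complete T cover (λ p → proj₁ (S₁⇒ p)) ⇒S₁ conn? ground r∈S entries-enough
        lower : ∀ {s} → Is (S₁ s) → s ≢ r →
                (∃[ s′ ] Is (S₁ s′) × s ~ s′ × rank s′ < rank s) ⊎
                (∃[ s′ ] Is (S₁ s′) × rank s′ < rank s ×
                  ∃[ w ] ∃[ w′ ] (HT w × w ~ s) × (HT w′ × w′ ~ s′) × Conn w w′)
        lower {s} p s≢r with proj₂ (proj₂ ranked) p s≢r
        ... | s′ , p′ , e , lt with subst₂ _<_ (sym (proj₂ (proj₂ guessed) p′)) (sym (proj₂ (proj₂ guessed) p)) lt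
        ...   | lt′ with e
        ...     | inj₁ e = inj₁ (s′ , p′ , e , lt′)
        ...     | inj₂ e = inj₂ (s′ , p′ , lt′ , e)

-- The decision over all guesses

decision : ∀ {n} → Graph (Fin n) → Subset n → ℕ → Bool
decision {n} G S₀ l =
  decide (matrix G) (Vec.lookup S₀) l (smallNumbers n (count (Vec.lookup S₀))) (members (Vec.lookup S₀))

decision-sound : ∀ {n} (G : Graph (Fin n)) S₀ l → ChordalDeletionSet G S₀ →
                 Is (decision G S₀ l) → HasConnectedVertexCover≤ G l
decision-sound {zero} G S₀ l chordal _ = [] , ((λ { {()} }) , λ { (() , _) _ }) , z≤n
decision-sound {suc n} G S₀ l chordal ok =
  let r , p = anyV⁻ {p = accepted} ok
      S₁ , _ , q = any⁻ (subsets (r ∷ members U)) {withSet r} p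
      rank , _ , q = any⁻ (rankings (smallNumbers (suc n) (count U)) (r ∷ members U)) {withRanking r S₁} q
  in Rooted.succeeds⇒ G S₀ chordal r S₁ rank l q
  where
  U = Vec.lookup S₀
  open Decide (matrix G) U l (smallNumbers (suc n) (count U)) (members U)

decision-complete : ∀ {n} (G : Graph (Fin n)) S₀ l .{{_ : NonZero l}} → ChordalDeletionSet G S₀ →
                    HasConnectedVertexCover≤ G l → Is (decision G S₀ l)
decision-complete {zero} G S₀ l chordal _ = refl
-- Whether two vertices are connected is used as if it were decidable, which is
-- harmless because the answer is.
decision-complete {suc n} G S₀ l chordal has =
  let T , r , rooted = fromSubset G zero has
      open Rooted G S₀ chordal r
      S₁ , S₁∈ , S₁≡ = subsets-complete (λ v → S v && T v) xs (λ v p → ∈xs (proj₁ (&&⁻ {S v} p)))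
      rank , rank∈ , _ = guessed rooted S₁≡
  in decidable-stable (decision G S₀ l ≟ᵇ true) λ fails →
       ¬¬-all (λ u → ¬¬-decide (Anchors.Conn G S S₁ T r (λ p → proj₂ (S₁⇒ rooted S₁≡ p)) (⇒S₁ rooted S₁≡) u))
         λ conn? → fails (anyV⁺ {p = accepted} r (any⁺ {p = withSet r} S₁∈ (any⁺ {p = withRanking r S₁} rank∈
           (succeeds⇐ rooted S₁≡ conn?))))
  where
  U = Vec.lookup S₀
  open Decide (matrix G) U l (smallNumbers (suc n) (count U)) (members U)

-- The complete program

module Compose {A B Γ C} (s : Tm (A ∷ []) B) (t : Tm Γ C) where

  size-s = arity s
  size-t = arity t

  φ : Fin size-s → Fin (suc (size-s + size-t))
  φ i = suc (i ↑ˡ size-t)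

  ψ : Fin size-t → Fin (suc (size-s + size-t))
  ψ i = suc (size-s ↑ʳ i)

  body : Fin (suc (size-s + size-t)) → Exp (suc (size-s + size-t)) 1
  body zero    = bind (cons (var 0F) (lit 0)) (bind (comp s φ 0F) (comp t ψ 0F))
  body (suc i) = (defs s φ ⊕ defs t ψ) i

  program : Program
  program = record { body = body }

  open Correctness body
  open Runtime body using (Runs; runBind; runCons; runVar; runLit)

  -- Encodings do not record list sizes. The second term can thus be typed with bounds in `k` that
  -- the types of the first do not provide; they enter as `FitsEnv` for `γ` and are proved by
  -- counting.
  runs : ∃[ d ] ∀ par (x : ⟦ A ⟧ (Params.n par)) (γ : Env Γ (Params.n par)) →
         enc B (sem s (x , tt)) ≡ encEnv Γ γ → Params.Fits par A x → Params.FitsEnv par Γ γ →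
         ∀ {y} → sem t γ ≡ y → Runs par (enc A x ∷ []) (body zero) (enc C y) d
  runs with correct s φ (agreeˡ (λ i → refl)) | correct t ψ (agreeʳ size-s (λ i → refl))
  ... | _ , s-ok | _ , t-ok = _ , λ { par x γ eq fx fγ refl →
    runBind par (runCons par (runVar par 0F) (runLit par))
      (runBind par (s-ok par _ 0F (x , tt) refl (fx , tt)) (t-ok par _ 0F γ eq fγ)) }

input output : Ty
input  = (dim ⊗ arr (arr bool)) ⊗ (arr bool ⊗ nat)
output = list (pow 1) nat ⊗ list (pow 1) idx ⊗ arr idx ⊗ arr (arr bool) ⊗ set ⊗ nat ⊗ dim ⊗ nat

prepareᵗ : Tm (input ∷ []) output
prepareᵗ =
  lett (mapi (op₁ sndᵒ (op₁ fstᵒ (var #0))) (var #1))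
  (lett (op₁ fstᵒ (op₁ sndᵒ (var #1)))
  (lett (fold (op₁ toListᵒ (var #1)) (op₀ zeroᵒ) (cond (#2 at #0) (sucᵗ (var #1)) (var #1)))
    (op₂ pairᵒ (forl (op₁ toListᵒ (var #2)) (cond (op₂ leqᵒ (op₁ toNatᵒ (var #0)) (var #1)) (op₁ singleᵒ (op₁ toNatᵒ (var #0))) (op₀ nilᵒ)))
    (op₂ pairᵒ (filtᵗ (op₁ toListᵒ (var #2)) (#2 at #0))
    (op₂ pairᵒ (var #2)
    (op₂ pairᵒ (op₁ sndᵒ (op₁ fstᵒ (var #3)))
    (op₂ pairᵒ (var #1)
    (op₂ pairᵒ (op₁ sndᵒ (op₁ sndᵒ (var #3)))
    -- The last 0 encodes the empty environment, so that the output is literally an encoded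
    -- `context`.
    (op₂ pairᵒ (op₁ fstᵒ (op₁ fstᵒ (var #3))) (op₀ zeroᵒ))))))))))

length-filt : ∀ {A : Set} (p : A → Bool) xs →
              length (filt xs p) ≡ foldr (λ v acc → if p v then 1 + acc else acc) 0 xs
length-filt p [] = refl
length-filt p (x ∷ xs) with p x
... | true  = cong suc (length-filt p xs)
... | false = length-filt p xs

-- The numbers increase along the list, so at most `suc k ∸ j` of those from `j` on pass the test.
length-smallNumbers : ∀ n k → length (smallNumbers n k) ≤ suc k
length-smallNumbers n k = go id 0 (λ i → refl)
  where
  choose : Fin n → List ℕ
  choose i = if toℕ i ≤ᵇ k then toℕ i ∷ [] else []
  go : ∀ {m} (g : Fin m → Fin n) j → (∀ i → toℕ (g i) ≡ j + toℕ i) →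
       length (concatMap choose (List.tabulate g)) ≤ suc k ∸ j
  go {zero}  g j eq = z≤n
  go {suc m} g j eq with toℕ (g zero) ≤ᵇ k in small | go (g ∘ suc) (suc j) (λ i → trans (eq (suc i)) (+-suc j (toℕ i)))
  ... | false | len = ≤-trans len (∸-monoʳ-≤ (suc k) (n≤1+n j))
  ... | true  | len = ≤-trans (s≤s len) (≤-reflexive (sym (+-∸-assoc 1
    (subst (_≤ k) (trans (eq zero) (+-identityʳ j)) (≤ᵇ⁻ small)))))

-- Running time

n≤2^⌈log₂n⌉ : ∀ n → Acc _<_ n → n ≤ 2 ^ ⌈log₂ n ⌉
n≤2^⌈log₂n⌉ 0 _ = z≤n
n≤2^⌈log₂n⌉ 1 _ = ≤-refl
n≤2^⌈log₂n⌉ n@(suc (suc m)) (acc rec) = begin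
  n                            ≡⟨ ⌊n/2⌋+⌈n/2⌉≡n n ⟨
  ⌊ n /2⌋ + h                  ≤⟨ +-monoˡ-≤ h (⌊n/2⌋≤⌈n/2⌉ n) ⟩
  h + h                        ≡⟨ cong (h +_) (+-identityʳ h) ⟨
  2 * h                        ≤⟨ *-monoʳ-≤ 2 (n≤2^⌈log₂n⌉ h (rec (⌈n/2⌉<n m))) ⟩
  2 * 2 ^ ⌈log₂ h ⌉            ≡⟨ cong (λ e → 2 * 2 ^ e) (⌈log₂⌈n/2⌉⌉≡⌈log₂n⌉∸1 n) ⟩
  2 ^ suc (⌈log₂ n ⌉ ∸ 1)      ≡⟨ cong (2 ^_) (m+[n∸m]≡n (⌈log₂⌉-mono-≤ {2} {n} (s≤s (s≤s z≤n)))) ⟩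
  2 ^ ⌈log₂ n ⌉                ∎
  where
  open ≤-Reasoning
  h = ⌈ n /2⌉

-- The 27 is 3 ^ 3, forced by `k = 1`, where the logarithm vanishes. For `k ≥ 2` the base is at most
-- `2 ^ (2 * L)` and the exponent at most `2 * k`; the two factors 2 make the 4.
power≤ : ∀ k → (2 + k) ^ (2 + k) ≤ 27 * 2 ^ (4 * (k * ⌈log₂ k ⌉))
power≤ 0 = m≤m+n 4 23
power≤ 1 = ≤-refl
power≤ k@(suc (suc m)) = begin
  (2 + k) ^ (2 + k)              ≤⟨ ^-monoˡ-≤ (2 + k) base ⟩
  (2 ^ (2 * L)) ^ (2 + k)        ≤⟨ ^-monoʳ-≤ (2 ^ (2 * L)) {{m^n≢0 2 (2 * L)}} double ⟩
  (2 ^ (2 * L)) ^ (2 * k)        ≡⟨ ^-*-assoc 2 (2 * L) (2 * k) ⟩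
  2 ^ (2 * L * (2 * k))          ≡⟨ cong (2 ^_) (rearrange L k) ⟩
  2 ^ (4 * (k * L))              ≤⟨ m≤m+n _ _ ⟩
  27 * 2 ^ (4 * (k * L))         ∎
  where
  open ≤-Reasoning
  L = ⌈log₂ k ⌉
  1≤L : 1 ≤ L
  1≤L = ⌈log₂⌉-mono-≤ {2} {k} (s≤s (s≤s z≤n))
  double : 2 + k ≤ 2 * k
  double = ≤-trans (+-monoˡ-≤ k (s≤s (s≤s z≤n))) (≤-reflexive (cong (k +_) (sym (+-identityʳ k))))
  base : 2 + k ≤ 2 ^ (2 * L)
  base = ≤-trans double (≤-trans (*-monoʳ-≤ 2 (n≤2^⌈log₂n⌉ k (<-wellFounded k)))
    (^-monoʳ-≤ 2 (≤-trans (+-monoˡ-≤ L 1≤L) (≤-reflexive (cong (L +_) (sym (+-identityʳ L)))))))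
  rearrange : ∀ L k → 2 * L * (2 * k) ≡ 4 * (k * L)
  rearrange = solve-∀

^-distrib-* : ∀ d a b → (a * b) ^ d ≡ a ^ d * b ^ d
^-distrib-* zero    a b = refl
^-distrib-* (suc d) a b = trans (cong (a * b *_) (^-distrib-* d a b)) ([m*n]*[o*p]≡[m*o]*[n*p] a b (a ^ d) (b ^ d))

time-bound : ∀ d n k → (32 * suc n * (2 + k) ^ (2 + k)) ^ d ≤
             864 ^ d * (2 ^ (4 * d * (k * ⌈log₂ k ⌉)) * suc n ^ d)
time-bound d n k = begin
  (32 * suc n * (2 + k) ^ (2 + k)) ^ d     ≤⟨ ^-monoˡ-≤ d (*-monoʳ-≤ (32 * suc n) (power≤ k)) ⟩
  -- 864 is 32 * 27, the constant in X times the constant of `power≤`.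
  (32 * suc n * (27 * 2 ^ (4 * E))) ^ d    ≡⟨ cong (_^ d) (rearrange 32 27 (suc n) (2 ^ (4 * E))) ⟩
  (864 * (2 ^ (4 * E) * suc n)) ^ d        ≡⟨ ^-distrib-* d 864 (2 ^ (4 * E) * suc n) ⟩
  864 ^ d * (2 ^ (4 * E) * suc n) ^ d      ≡⟨ cong (864 ^ d *_) (^-distrib-* d (2 ^ (4 * E)) (suc n)) ⟩
  864 ^ d * ((2 ^ (4 * E)) ^ d * suc n ^ d)
                                           ≡⟨ cong (λ x → 864 ^ d * (x * suc n ^ d)) (^-*-assoc 2 (4 * E) d) ⟩
  864 ^ d * (2 ^ (4 * E * d) * suc n ^ d)  ≡⟨ cong (λ e → 864 ^ d * (2 ^ e * suc n ^ d)) (rearrange′ E d) ⟩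
  864 ^ d * (2 ^ (4 * d * E) * suc n ^ d)  ∎
  where
  open ≤-Reasoning
  E = k * ⌈log₂ k ⌉
  rearrange : ∀ c d a b → c * a * (d * b) ≡ c * d * (b * a)
  rearrange = solve-∀
  rearrange′ : ∀ e d → 4 * e * d ≡ 4 * d * e
  rearrange′ = solve-∀

open Compose prepareᵗ decideᵗ using (program; body; runs)
open Runtime body using (run)

params : ℕ → ℕ → Params
params n k = record
  { n      = n
  ; k      = k
  ; X      = 32 * suc n * (2 + k) ^ (2 + k)
  ; const≤ = ≤-trans (m≤m*n 32 (suc n)) (m≤m*n (32 * suc n) P {{m^n≢0 (2 + k) (2 + k)}})
  ; n≤     = ≤-trans (≤-trans (n≤1+n n) (m≤n*m (suc n) 32)) (m≤m*n (32 * suc n) P {{m^n≢0 (2 + k) (2 + k)}})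
  ; k≤     = m≤n*m P (32 * suc n)
  }
  where P = (2 + k) ^ (2 + k)

theorem23 : ∃[ P ] ∃[ a ] ∃[ b ] ∃[ c ]
    (∀ (n : ℕ) (G : Graph (Fin n)) (S : Subset n) (l : ℕ) .{{_ : NonZero l}} →
    ChordalDeletionSet G S →
    ∃[ answer ] ∃[ t ]
    (P on encodeInstance G S l returns encodeBool answer inTime t)
    × (answer ≡ true ⇔ HasConnectedVertexCover≤ G l)
    × t ≤ a * (2 ^ (b * (∣ S ∣ * ⌈log₂ ∣ S ∣ ⌉)) * suc n ^ c))
theorem23 = program , 864 ^ d , 4 * d , d , λ n G S l chordal →
  let adj = matrix G
      U = Vec.lookup S
      k = ∣ S ∣
      ks = smallNumbers n (count U)
      xs = members U
      run {t} derivation t≤ = proj₂ runs (params n k) ((tt , adj) , (U , l))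
        (ks , xs , (λ i → i) , adj , U , l , tt , tt) refl ((tt , λ _ _ → tt) , ((λ _ → tt) , tt))
        -- The bounds that the sizes `loose` and `tight` in `context` take for granted: at most
        -- `k + 1` ranks and `k` members of `S`.
        ( (≤-trans (length-smallNumbers n (count U)) (≤-trans (≤-reflexive (cong suc (count-∣∣ S))) (n≤1+n (suc k)))
          , All.tabulate (λ _ → tt))
        , (≤-reflexive (trans (length-filt U (vertices n)) (count-∣∣ S)) , All.tabulate (λ _ → tt))
        , (λ _ → tt) , (λ _ _ → tt) , (λ _ → tt) , tt , tt , tt )
        (decide-sem adj U l ks xs)
  in decision G S l , t , derivation ,
     mk⇔ (decision-sound G S l chordal) (decision-complete G S l chordal) ,
     ≤-trans t≤ (time-bound d n k)
  where d = proj₁ runs
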